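{- There is an algorithm that solves the APSP problem correctly on every input consisting of a finite simple digraph $D=(V,A)$ with $n=|V|$ vertices and a weight function $c:A\to\mathbb{R}$, and that runs in time $O(2^{k_0}\cdot n^4)$ whenever $D$ (with $c$) has $k_0$ negative trees. The constant in the $O$ is absolute (independent of $D$, $c$, $k_0$, $n$).
   Context: A digraph is simple if it has no loops and at most one arc from $u$ to $v$ for each ordered pair $(u,v)$. A negative cycle is a directed cycle (all vertices distinct) whose total weight is negative. The weight function $c$ is nearly conservative on $D$ if every negative cycle of $D$ consists of (at most) two arcs. The APSP problem for $(D,c)$: first decide whether $c$ is nearly conservative on $D$; if it is, then for every ordered pair $s\neq t$ of vertices determine the distance $d_D(s,t)$, the minimum total weight of a directed simple path from $s$ to $t$ (a path has no repeated vertices), with $d_D(s,t)=+\infty$ if there is no such path. Negative trees: let $F=(V,E)$ be the undirected graph whose edges are the unordered pairs $\{u,v\}$, $u\ne v$, such that both $uv$ and $vu$ are arcs of $D$ and $c(uv)+c(vu)<0$. It is supposed that $F$ is a forest (if $F$ contains a cycle, then $c$ is not nearly conservative on $D$ and the algorithm stops with this answer). The negative trees of $D$ are the connected components of $F$ having at least one edge. Running time counts elementary steps, an arithmetic operation or comparison on real weights counting as one step. -}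

module Defs where

open import Algebra.Structures using (IsCommutativeRing)
open import Data.Bool using (Bool; true; false; T; not; if_then_else_) renaming (_∧_ to _and_)
open import Data.Fin using (Fin; toℕ)
open import Data.List using (List; []; _∷_)
open import Data.List.Relation.Unary.Unique.Propositional using (Unique)
open import Data.Nat as ℕ using (ℕ; suc; _∸_)
open import Data.Product using (Σ; ∃; _×_; _,_; proj₁)
open import Data.Sum using (_⊎_)
open import Function.Bundles using (Inverse)
open import Level using (0ℓ)
open import Relation.Binary using (Rel; Setoid; IsDecTotalOrder)
open import Relation.Binary.Construct.Closure.ReflexiveTransitive using (Star; ε; _◅_)
import Relation.Binary.Construct.Closure.Equivalence as EqClosure
import Relation.Binary.Construct.On as On
open import Relation.Binary.PropositionalEquality using (_≡_; _≢_)
import Relation.Binary.PropositionalEquality as ≡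
open import Relation.Nullary using (¬_)
open import Relation.Nullary.Decidable using (⌊_⌋)
open import Relation.Nullary.Construct.Add.Supremum using (_⁺; ⊤⁺; [_])

------------------------------------------------------------------------
-- Real numbers

-- The axioms of a Dedekind-complete ordered field, which determine ℝ up
-- to isomorphism.  Comparison of reals is decidable, as is implicit in
-- counting it as one elementary step; under excluded middle the
-- Dedekind cuts of ℚ form an instance.

record RealNumbers : Set₁ where
  infix  4 _≈_ _≤_ _<_
  infixl 6 _+_
  infixl 7 _*_
  infix  8 -_
  field
    Carrier           : Set
    _≈_ _≤_           : Rel Carrier 0ℓ
    _+_ _*_           : Carrier → Carrier → Carrier
    -_                : Carrier → Carrier
    0# 1#             : Carrier
    isCommutativeRing : IsCommutativeRing _≈_ _+_ _*_ -_ 0# 1#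
    isDecTotalOrder   : IsDecTotalOrder _≈_ _≤_
    1≉0               : ¬ 1# ≈ 0#
    invertible        : ∀ x → ¬ x ≈ 0# → ∃ λ y → x * y ≈ 1#
    +-monoʳ-≤         : ∀ x {y z} → y ≤ z → x + y ≤ x + z
    *-nonNegative     : ∀ {x y} → 0# ≤ x → 0# ≤ y → 0# ≤ x * y

  UpperBound : (Carrier → Set) → Carrier → Set
  UpperBound P b = ∀ x → P x → x ≤ b

  field
    complete : (P : Carrier → Set) → ∃ P → ∃ (UpperBound P) →
               ∃ λ s → UpperBound P s × (∀ b → UpperBound P b → s ≤ b)

  open IsCommutativeRing isCommutativeRing public using (_-_)
  open IsDecTotalOrder isDecTotalOrder public using (_≤?_)

  _<_ : Rel Carrier 0ℓ
  x < y = x ≤ y × ¬ x ≈ y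

------------------------------------------------------------------------
-- Simple digraphs

-- A Boolean adjacency matrix allows at most one arc per ordered pair.

record Digraph (n : ℕ) : Set where
  field
    arc    : Fin n → Fin n → Bool
    noLoop : ∀ v → arc v v ≡ false

  Arc : Rel (Fin n) 0ℓ
  Arc u v = T (arc u v)

  Walk : Rel (Fin n) 0ℓ
  Walk = Star Arc

  vertices : ∀ {u v} → Walk u v → List (Fin n)
  vertices {u} ε       = u ∷ []
  vertices {u} (_ ◅ p) = u ∷ vertices p

  arcs : ∀ {u v} → Walk u v → ℕ
  arcs ε       = 0
  arcs (_ ◅ p) = suc (arcs p)

  record Path (u v : Fin n) : Set where
    field
      walk   : Walk u v
      simple : Unique (vertices walk)

  -- A cycle, cut open at one of its arcs.  The path has at least one
  -- arc, since there are no loops.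
  record Cycle : Set where
    field
      {start end} : Fin n
      path        : Path start end
      closing     : Arc end start

    length : ℕ
    length = suc (arcs (Path.walk path))

------------------------------------------------------------------------
-- Weights, distances and negative trees

module Weighted (ℝ : RealNumbers) {n : ℕ} (D : Digraph n) where
  open RealNumbers ℝ
  open Digraph D

  WeightFunction : Set
  WeightFunction = ∀ {u v} → Arc u v → Carrier

  module _ (c : WeightFunction) where

    walkWeight : ∀ {u v} → Walk u v → Carrier
    walkWeight ε       = 0#
    walkWeight (a ◅ p) = c a + walkWeight p

    pathWeight : ∀ {u v} → Path u v → Carrier
    pathWeight p = walkWeight (Path.walk p)

    cycleWeight : Cycle → Carrier
    cycleWeight C = c (Cycle.closing C) + pathWeight (Cycle.path C)

    NearlyConservative : Set
    NearlyConservative = ∀ C → cycleWeight C < 0# → Cycle.length C ℕ.≤ 2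

    IsDistance : Fin n → Fin n → Carrier ⁺ → Set
    IsDistance s t ⊤⁺    = ¬ Path s t
    IsDistance s t [ d ] = (∃ λ (p : Path s t) → pathWeight p ≈ d)
                         × (∀ (p : Path s t) → d ≤ pathWeight p)

    -- Adjacency in the graph F; it is symmetric, and u ≢ v because
    -- there are no loops.
    NegativeEdge : Rel (Fin n) 0ℓ
    NegativeEdge u v = Σ (Arc u v) λ a → Σ (Arc v u) λ b → c a + c b < 0#

    -- The connected components of F with at least one edge: the
    -- vertices incident with an edge of F, modulo being connected in F.
    negativeTrees : Setoid 0ℓ 0ℓ
    negativeTrees = On.setoid {B = ∃ λ v → ∃ (NegativeEdge v)}
                              (EqClosure.setoid NegativeEdge) proj₁

    HasNegativeTrees : ℕ → Set
    HasNegativeTrees k = Inverse (≡.setoid (Fin k)) negativeTrees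

------------------------------------------------------------------------
-- A unit-cost random access machine with real cells, programmed in a
-- structured language

-- Memory consists of one-dimensional arrays of natural numbers and of
-- real numbers, each named by a literal; a scalar variable is cell 0 of
-- an array.  Indices are computed, so addressing is indirect.  There is
-- no multiplication of naturals, which prevents packing exponentially
-- much information into a cell, and reals can only be added, subtracted
-- and compared; programs contain no real constant other than 0.

data NatExp : Set where
  lit     : ℕ → NatExp
  getℕ    : ℕ → NatExp → NatExp
  _⊕_ _⊖_ : NatExp → NatExp → NatExp

data RealExp : Set where
  zeroʳ     : RealExp
  getℝ      : ℕ → NatExp → RealExp
  _⊕ʳ_ _⊖ʳ_ : RealExp → RealExp → RealExp

data BoolExp : Set where
  _≤ⁿ_ : NatExp → NatExp → BoolExp
  _≤ʳ_ : RealExp → RealExp → BoolExp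
  notᵇ : BoolExp → BoolExp
  _∧ᵇ_ : BoolExp → BoolExp → BoolExp

infixr 5 _⨾_

data Program : Set where
  skip  : Program
  setℕ  : ℕ → NatExp → NatExp → Program
  setℝ  : ℕ → NatExp → RealExp → Program
  _⨾_   : Program → Program → Program
  ifᵖ   : BoolExp → Program → Program → Program
  while : BoolExp → Program → Program

-- Evaluating an expression takes one step per operation, comparison,
-- memory access or literal.

natCost : NatExp → ℕ
natCost (lit _)    = 1
natCost (getℕ _ i) = 1 ℕ.+ natCost i
natCost (d ⊕ e)    = 1 ℕ.+ natCost d ℕ.+ natCost e
natCost (d ⊖ e)    = 1 ℕ.+ natCost d ℕ.+ natCost e

realCost : RealExp → ℕ
realCost zeroʳ      = 1
realCost (getℝ _ i) = 1 ℕ.+ natCost i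
realCost (d ⊕ʳ e)   = 1 ℕ.+ realCost d ℕ.+ realCost e
realCost (d ⊖ʳ e)   = 1 ℕ.+ realCost d ℕ.+ realCost e

boolCost : BoolExp → ℕ
boolCost (d ≤ⁿ e) = 1 ℕ.+ natCost d ℕ.+ natCost e
boolCost (d ≤ʳ e) = 1 ℕ.+ realCost d ℕ.+ realCost e
boolCost (notᵇ b) = 1 ℕ.+ boolCost b
boolCost (a ∧ᵇ b) = 1 ℕ.+ boolCost a ℕ.+ boolCost b

update : ∀ {A : Set} → (ℕ → ℕ → A) → ℕ → ℕ → A → (ℕ → ℕ → A)
update m a i x b j = if (a ℕ.≡ᵇ b) and (i ℕ.≡ᵇ j) then x else m b j

module Machine (ℝ : RealNumbers) where
  open RealNumbers ℝ

  -- natMem a i and realMem a i are the contents of cell i of array a.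
  record State : Set where
    constructor ⟨_,_⟩
    field
      natMem  : ℕ → ℕ → ℕ
      realMem : ℕ → ℕ → Carrier
  open State public

  evalℕ : NatExp → State → ℕ
  evalℕ (lit k)    σ = k
  evalℕ (getℕ a i) σ = natMem σ a (evalℕ i σ)
  evalℕ (d ⊕ e)    σ = evalℕ d σ ℕ.+ evalℕ e σ
  evalℕ (d ⊖ e)    σ = evalℕ d σ ∸ evalℕ e σ

  evalℝ : RealExp → State → Carrier
  evalℝ zeroʳ      σ = 0#
  evalℝ (getℝ a i) σ = realMem σ a (evalℕ i σ)
  evalℝ (d ⊕ʳ e)   σ = evalℝ d σ + evalℝ e σ
  evalℝ (d ⊖ʳ e)   σ = evalℝ d σ - evalℝ e σ

  evalB : BoolExp → State → Bool
  evalB (d ≤ⁿ e) σ = evalℕ d σ ℕ.≤ᵇ evalℕ e σ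
  evalB (d ≤ʳ e) σ = ⌊ evalℝ d σ ≤? evalℝ e σ ⌋
  evalB (notᵇ b) σ = not (evalB b σ)
  evalB (a ∧ᵇ b) σ = evalB a σ and evalB b σ

  writeℕ : ℕ → ℕ → ℕ → State → State
  writeℕ a i x σ = ⟨ update (natMem σ) a i x , realMem σ ⟩

  writeℝ : ℕ → ℕ → Carrier → State → State
  writeℝ a i x σ = ⟨ natMem σ , update (realMem σ) a i x ⟩

  -- p , σ ⇓[ t ] τ : started in σ, p halts in state τ after t steps.
  infix 4 _,_⇓[_]_

  data _,_⇓[_]_ : Program → State → ℕ → State → Set where
    ⇓skip : ∀ {σ} → skip , σ ⇓[ 1 ] σ
    ⇓setℕ : ∀ {a i e σ} →
            setℕ a i e , σ ⇓[ 1 ℕ.+ natCost i ℕ.+ natCost e ]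
              writeℕ a (evalℕ i σ) (evalℕ e σ) σ
    ⇓setℝ : ∀ {a i e σ} →
            setℝ a i e , σ ⇓[ 1 ℕ.+ natCost i ℕ.+ realCost e ]
              writeℝ a (evalℕ i σ) (evalℝ e σ) σ
    ⇓seq  : ∀ {p q σ₀ σ₁ σ₂ t₁ t₂} →
            p , σ₀ ⇓[ t₁ ] σ₁ → q , σ₁ ⇓[ t₂ ] σ₂ →
            p ⨾ q , σ₀ ⇓[ t₁ ℕ.+ t₂ ] σ₂
    ⇓if-true  : ∀ {b p q σ τ t} → evalB b σ ≡ true → p , σ ⇓[ t ] τ →
                ifᵖ b p q , σ ⇓[ 1 ℕ.+ boolCost b ℕ.+ t ] τ
    ⇓if-false : ∀ {b p q σ τ t} → evalB b σ ≡ false → q , σ ⇓[ t ] τ →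
                ifᵖ b p q , σ ⇓[ 1 ℕ.+ boolCost b ℕ.+ t ] τ
    ⇓while-true  : ∀ {b p σ₀ σ₁ σ₂ t₁ t₂} → evalB b σ₀ ≡ true →
                   p , σ₀ ⇓[ t₁ ] σ₁ → while b p , σ₁ ⇓[ t₂ ] σ₂ →
                   while b p , σ₀ ⇓[ 1 ℕ.+ boolCost b ℕ.+ t₁ ℕ.+ t₂ ] σ₂
    ⇓while-false : ∀ {b p σ} → evalB b σ ≡ false →
                   while b p , σ ⇓[ 1 ℕ.+ boolCost b ] σ

------------------------------------------------------------------------
-- The APSP problem

module APSP (ℝ : RealNumbers) {n : ℕ} (D : Digraph n)
            (c : Weighted.WeightFunction ℝ D) where
  open RealNumbers ℝ
  open Digraph D
  open Weighted ℝ D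
  open Machine ℝ

  entry : Fin n → Fin n → ℕ
  entry u v = toℕ u ℕ.* n ℕ.+ toℕ v

  -- Input: n is scalar 0, the adjacency matrix is array 1 of the
  -- natural memory, the weights are array 0 of the real memory, both
  -- matrices in row-major order.  All other cells are arbitrary.
  record HoldsInput (σ : State) : Set where
    field
      size      : natMem σ 0 0 ≡ n
      adjacency : ∀ u v → natMem σ 1 (entry u v) ≡ (if arc u v then 1 else 0)
      weights   : ∀ {u v} (a : Arc u v) → realMem σ 0 (entry u v) ≈ c a

  -- Output: the verdict is scalar 2 of the natural memory; array 3 of
  -- the natural memory records which distances are finite (nonzero) and
  -- array 1 of the real memory holds the finite ones.
  verdict : State → ℕ
  verdict σ = natMem σ 2 0

  distance : State → Fin n → Fin n → Carrier ⁺
  distance σ s t =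
    if natMem σ 3 (entry s t) ℕ.≡ᵇ 0 then ⊤⁺ else [ realMem σ 1 (entry s t) ]

  HoldsSolution : State → Set
  HoldsSolution σ =
      (¬ NearlyConservative c × verdict σ ≡ 0)
    ⊎ (NearlyConservative c × verdict σ ≡ 1
        × (∀ s t → s ≢ t → IsDistance c s t (distance σ s t)))

module Submission where

-- Every negative tree is traversed by tree paths, which are shortest
-- between their ends when c is nearly conservative: a detour outside the
-- tree from x to z closes up with the tree path from z to x, and a walk
-- inside the tree that backtracks over an edge must have crossed the cut
-- of that edge by such a detour.  Hence some shortest path meets each tree
-- in one tree path, and dynamic programming over the set of trees already
-- left finds it: n rounds in the manner of Bellman and Ford, for each of
-- the 2 ^ k₀ sets, suffice.  Conversely the walks found repeat only
-- vertices without negative edges, and such repetitions can be cut out.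
-- The weights are nearly conservative if and only if the negative edges
-- form a forest and no arc outside it closes one of these shortest walks
-- to a negative cycle; the forest is grown edge by edge, updating the
-- weights of all tree paths.

-- Relaxation over arbitrary walks is useless here, since a walk may run to and fro over a negative
-- edge for ever; the set `S` of trees already left prevents this. Only trees with an edge are
-- recorded in `S`, which keeps the number of sets at `2 ^ k₀`. Single vertices are not, so several
-- rounds per set remain necessary and walks may revisit such vertices. The step from one tree to
-- the next is split into a move along a tree path and an exit by an arc: each half ranges over
-- three vertices, so a round costs `n ^ 3` per set and `n` rounds stay within `2 ^ k₀ * n ^ 4`. The
-- decision problem threatens circularity, because tree paths are known to be shortest only for
-- nearly conservative weights. Hence the optimality of tree paths, and the fact that no simple path
-- is lighter than the tables say, are derived from the success of the final check alone, by
-- induction on the number of arcs; near conservativity follows. The converse, that every finite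
-- entry is at least the weight of some simple path, uses near conservativity, and also shows that a
-- failing check refutes it.

open import Defs
open import Algebra.Bundles using (CommutativeRing)
import Algebra.Properties.AbelianGroup as AbelianGroupProperties
import Algebra.Properties.CommutativeMonoid.Mult as Mult
import Algebra.Properties.CommutativeSemigroup as CommutativeSemigroupProperties
open import Data.Bool using (Bool; true; false; T; if_then_else_; _∧_; _∨_; not)
open import Data.Bool.ListAction using (any)
import Data.Bool.Properties as Bool
open import Data.Empty using (⊥-elim)
open import Data.Fin using (Fin; zero; suc; #_; toℕ; fromℕ<; combine)
open import Data.Fin.Properties using (_≟_; toℕ<n; toℕ-injective; toℕ-fromℕ<; toℕ-combine; combine-injective; injective⇒≤)
open import Data.List using (List; []; _∷_; _++_; length; lookup)
open import Data.List.Membership.Propositional using (_∈_; _∉_)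
open import Data.List.Membership.Propositional.Properties using (∈-++⁺ˡ; ∈-++⁺ʳ; ∈-lookup)
import Data.List.Membership.DecPropositional as DecMembership
open import Data.List.Relation.Unary.All as All using (All; []; _∷_)
import Data.List.Relation.Unary.All.Properties as All
open import Data.List.Relation.Unary.AllPairs using ([]; _∷_)
open import Data.List.Relation.Unary.Any using (here; there)
open import Data.List.Relation.Unary.Unique.Propositional using (Unique)
import Data.List.Relation.Unary.Unique.Propositional.Properties as Unique
open import Data.Nat as ℕ using (ℕ; zero; suc; z≤n; s≤s; _∸_; _≤ᵇ_; _≡ᵇ_)
import Data.Nat.Properties as ℕ
open import Data.Nat.Tactic.RingSolver using (solve-∀)
open import Data.Product using (Σ; ∃; _×_; _,_; proj₁; proj₂)
open import Data.Product.Properties using (≡-dec)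
open import Data.Sum using (_⊎_; inj₁; inj₂; map₂)
open import Data.Unit using (⊤; tt)
open import Data.Vec as Vec using (Vec; []; _∷_)
open import Function.Bundles using (Inverse)
open import Relation.Binary using (IsDecTotalOrder; tri<; tri≈; tri>)
import Relation.Binary.Construct.Closure.Equivalence as EqClosure
open import Relation.Binary.Construct.Closure.ReflexiveTransitive using (ε; _◅_; _◅◅_)
open import Relation.Binary.PropositionalEquality using (_≡_; _≢_; refl; sym; trans; cong; cong₂; subst; isEquivalence)
import Relation.Binary.Reasoning.Setoid as SetoidReasoning
open import Relation.Nullary using (¬_; Dec; yes; no)
open import Relation.Nullary.Decidable using (⌊_⌋)
open import Relation.Unary using (Decidable)

-- Linear inequalities

infix  4 _≼_
infixl 6 _⊞_ _⊟_

data LinExp (k : ℕ) : Set where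
  var     : Fin k → LinExp k
  𝟘       : LinExp k
  ⊝_      : LinExp k → LinExp k
  _⊞_ _⊟_ : LinExp k → LinExp k → LinExp k

data LinIneq (k : ℕ) : Set where
  _≼_ : LinExp k → LinExp k → LinIneq k

pattern #0 = var zero
pattern #1 = var (suc zero)
pattern #2 = var (suc (suc zero))
pattern #3 = var (suc (suc (suc zero)))
pattern #4 = var (suc (suc (suc (suc zero))))
pattern #5 = var (suc (suc (suc (suc (suc zero)))))
pattern #6 = var (suc (suc (suc (suc (suc (suc zero))))))
pattern #7 = var (suc (suc (suc (suc (suc (suc (suc zero)))))))
pattern #8 = var (suc (suc (suc (suc (suc (suc (suc (suc zero))))))))

-- An expression is pos − neg for two formal sums of variables.
pos neg : ∀ {k} → LinExp k → Vec ℕ k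
pos (var i) = Vec.replicate _ 0 Vec.[ i ]≔ 1
pos 𝟘       = Vec.replicate _ 0
pos (⊝ a)   = neg a
pos (a ⊞ b) = Vec.zipWith ℕ._+_ (pos a) (pos b)
pos (a ⊟ b) = Vec.zipWith ℕ._+_ (pos a) (neg b)
neg (var i) = Vec.replicate _ 0
neg 𝟘       = Vec.replicate _ 0
neg (⊝ a)   = pos a
neg (a ⊞ b) = Vec.zipWith ℕ._+_ (neg a) (neg b)
neg (a ⊟ b) = Vec.zipWith ℕ._+_ (neg a) (pos b)

lhsSum rhsSum : ∀ {k} → List (LinIneq k) → LinExp k
lhsSum []              = 𝟘
lhsSum ((a ≼ b) ∷ hs)  = a ⊞ lhsSum hs
rhsSum []              = 𝟘
rhsSum ((a ≼ b) ∷ hs)  = b ⊞ rhsSum hs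

-- The inequality is the sum of the hypotheses; the two sides are moved
-- so that only formal sums of variables are compared.
Follows : ∀ {k} → List (LinIneq k) → LinIneq k → Set
Follows hs (a ≼ b) = Vec.zipWith ℕ._+_ (pos (a ⊞ rhsSum hs)) (neg (b ⊞ lhsSum hs))
                   ≡ Vec.zipWith ℕ._+_ (pos (b ⊞ lhsSum hs)) (neg (a ⊞ rhsSum hs))

module LinearArithmetic (ℝ : RealNumbers) where
  open RealNumbers ℝ
  open IsDecTotalOrder isDecTotalOrder public
    using (≤-respˡ-≈; ≤-respʳ-≈)
    renaming (refl to ≤-refl; trans to ≤-trans; total to ≤-total; reflexive to ≤-reflexive; antisym to ≤-antisym)

  ring : CommutativeRing _ _
  ring = record { isCommutativeRing = isCommutativeRing }

  open CommutativeRing ring public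
    using (setoid; +-cong; +-identityˡ; +-identityʳ; -‿inverseʳ; -‿cong)
    renaming (refl to ≈-refl; sym to ≈-sym; trans to ≈-trans)
  open CommutativeRing ring using (+-abelianGroup; +-commutativeMonoid; +-commutativeSemigroup; +-comm; +-assoc)
  open Mult +-commutativeMonoid using (×-homo-+) renaming (_×_ to _·_)
  open AbelianGroupProperties +-abelianGroup using (⁻¹-∙-comm; ⁻¹-involutive; ε⁻¹≈ε; ∙-cancelʳ)
  open CommutativeSemigroupProperties +-commutativeSemigroup using (interchange)
  open SetoidReasoning setoid

  ⟦_⟧ : ∀ {k} → LinExp k → Vec Carrier k → Carrier
  ⟦ var i ⟧ ρ = Vec.lookup ρ i
  ⟦ 𝟘 ⟧     ρ = 0#
  ⟦ ⊝ a ⟧   ρ = - ⟦ a ⟧ ρ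
  ⟦ a ⊞ b ⟧ ρ = ⟦ a ⟧ ρ + ⟦ b ⟧ ρ
  ⟦ a ⊟ b ⟧ ρ = ⟦ a ⟧ ρ - ⟦ b ⟧ ρ

  formal : ∀ {k} → Vec ℕ k → Vec Carrier k → Carrier
  formal []       []      = 0#
  formal (m ∷ ms) (x ∷ ρ) = m · x + formal ms ρ

  formal-0 : ∀ {k} (ρ : Vec Carrier k) → formal (Vec.replicate k 0) ρ ≈ 0#
  formal-0 []      = ≈-refl
  formal-0 (x ∷ ρ) = ≈-trans (+-identityˡ _) (formal-0 ρ)

  formal-var : ∀ {k} (i : Fin k) (ρ : Vec Carrier k) →
               formal (Vec.replicate _ 0 Vec.[ i ]≔ 1) ρ ≈ Vec.lookup ρ i
  formal-var zero    (x ∷ ρ) = ≈-trans (+-cong (+-identityʳ x) (formal-0 ρ)) (+-identityʳ x)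
  formal-var (suc i) (x ∷ ρ) = ≈-trans (+-identityˡ _) (formal-var i ρ)

  formal-+ : ∀ {k} (ms ns : Vec ℕ k) ρ →
             formal (Vec.zipWith ℕ._+_ ms ns) ρ ≈ formal ms ρ + formal ns ρ
  formal-+ []       []       []      = ≈-sym (+-identityˡ 0#)
  formal-+ (m ∷ ms) (l ∷ ns) (x ∷ ρ) = begin
    (m ℕ.+ l) · x + formal (Vec.zipWith ℕ._+_ ms ns) ρ ≈⟨ +-cong (×-homo-+ x m l) (formal-+ ms ns ρ) ⟩
    (m · x + l · x) + (formal ms ρ + formal ns ρ)      ≈⟨ interchange _ _ _ _ ⟩
    (m · x + formal ms ρ) + (l · x + formal ns ρ)      ∎

  -‿interchange : ∀ a b c d → (a - b) + (c - d) ≈ (a + c) - (b + d)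
  -‿interchange a b c d = begin
    (a + - b) + (c + - d) ≈⟨ interchange _ _ _ _ ⟩
    (a + c) + (- b + - d) ≈⟨ +-cong ≈-refl (⁻¹-∙-comm b d) ⟩
    (a + c) - (b + d)     ∎

  -‿swap : ∀ a b → - (a - b) ≈ b - a
  -‿swap a b = begin
    - (a + - b)   ≈⟨ ⁻¹-∙-comm a (- b) ⟨
    - a + - - b   ≈⟨ +-cong ≈-refl (⁻¹-involutive b) ⟩
    - a + b       ≈⟨ +-comm _ _ ⟩
    b - a         ∎

  value : ∀ {k} (a : LinExp k) ρ → ⟦ a ⟧ ρ ≈ formal (pos a) ρ - formal (neg a) ρ
  value (var i) ρ = begin
    Vec.lookup ρ i       ≈⟨ +-identityʳ _ ⟨
    Vec.lookup ρ i + 0#  ≈⟨ +-cong (formal-var i ρ) (≈-trans (-‿cong (formal-0 ρ)) ε⁻¹≈ε) ⟨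
    _                    ∎
  value 𝟘 ρ = ≈-sym (-‿inverseʳ _)
  value (⊝ a) ρ = ≈-trans (-‿cong (value a ρ)) (-‿swap _ _)
  value (a ⊞ b) ρ = begin
    ⟦ a ⟧ ρ + ⟦ b ⟧ ρ ≈⟨ +-cong (value a ρ) (value b ρ) ⟩
    _                 ≈⟨ -‿interchange _ _ _ _ ⟩
    _                 ≈⟨ +-cong (formal-+ (pos a) (pos b) ρ) (-‿cong (formal-+ (neg a) (neg b) ρ)) ⟨
    _                 ∎
  value (a ⊟ b) ρ = begin
    ⟦ a ⟧ ρ - ⟦ b ⟧ ρ ≈⟨ +-cong (value a ρ) (≈-trans (-‿cong (value b ρ)) (-‿swap _ _)) ⟩
    _                 ≈⟨ -‿interchange _ _ _ _ ⟩
    _                 ≈⟨ +-cong (formal-+ (pos a) (neg b) ρ) (-‿cong (formal-+ (neg a) (pos b) ρ)) ⟨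
    _                 ∎

  cross : ∀ {p q r s} → p + s ≈ r + q → p - q ≈ r - s
  cross {p} {q} {r} {s} eq = ∙-cancelʳ (q + s) _ _ (begin
    (p - q) + (q + s)       ≈⟨ regroup p q s ⟩
    p + s                   ≈⟨ eq ⟩
    r + q                   ≈⟨ regroup r s q ⟨
    (r - s) + (s + q)       ≈⟨ +-cong ≈-refl (+-comm s q) ⟩
    (r - s) + (q + s)       ∎)
    where
    regroup : ∀ a b c → (a - b) + (b + c) ≈ a + c
    regroup a b c = begin
      (a + - b) + (b + c) ≈⟨ +-assoc a (- b) (b + c) ⟩
      a + (- b + (b + c)) ≈⟨ +-cong ≈-refl (+-assoc (- b) b c) ⟨
      a + ((- b + b) + c) ≈⟨ +-cong ≈-refl (+-cong (≈-trans (+-comm _ _) (-‿inverseʳ b)) ≈-refl) ⟩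
      a + (0# + c)        ≈⟨ +-cong ≈-refl (+-identityˡ c) ⟩
      a + c               ∎

  balance : ∀ {k} (a b : LinExp k) ρ →
            Vec.zipWith ℕ._+_ (pos a) (neg b) ≡ Vec.zipWith ℕ._+_ (pos b) (neg a) →
            ⟦ a ⟧ ρ ≈ ⟦ b ⟧ ρ
  balance a b ρ eq = begin
    ⟦ a ⟧ ρ                               ≈⟨ value a ρ ⟩
    formal (pos a) ρ - formal (neg a) ρ   ≈⟨ cross sums ⟩
    formal (pos b) ρ - formal (neg b) ρ   ≈⟨ value b ρ ⟨
    ⟦ b ⟧ ρ                               ∎
    where
    sums : formal (pos a) ρ + formal (neg b) ρ ≈ formal (pos b) ρ + formal (neg a) ρ
    sums = begin
      _ ≈⟨ formal-+ (pos a) (neg b) ρ ⟨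
      formal (Vec.zipWith ℕ._+_ (pos a) (neg b)) ρ ≡⟨ cong (λ ms → formal ms ρ) eq ⟩
      formal (Vec.zipWith ℕ._+_ (pos b) (neg a)) ρ ≈⟨ formal-+ (pos b) (neg a) ρ ⟩
      _ ∎

  +-mono-≤ : ∀ {a b c d} → a ≤ b → c ≤ d → a + c ≤ b + d
  +-mono-≤ {a} {b} {c} {d} a≤b c≤d =
    ≤-trans (+-monoʳ-≤ a c≤d) (≤-respˡ-≈ (+-comm d a) (≤-respʳ-≈ (+-comm d b) (+-monoʳ-≤ d a≤b)))

  +-cancelʳ-≤ : ∀ {a b} c → a + c ≤ b + c → a ≤ b
  +-cancelʳ-≤ {a} {b} c p = ≤-respˡ-≈ (drop a) (≤-respʳ-≈ (drop b) (+-mono-≤ p (≤-refl { - c})))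
    where
    drop : ∀ x → (x + c) - c ≈ x
    drop x = ≈-trans (+-assoc x c (- c)) (≈-trans (+-cong ≈-refl (-‿inverseʳ c)) (+-identityʳ x))

  ⟦_⟧ᴵ : ∀ {k} → LinIneq k → Vec Carrier k → Set
  ⟦ a ≼ b ⟧ᴵ ρ = ⟦ a ⟧ ρ ≤ ⟦ b ⟧ ρ

  AllHold : ∀ {k} → List (LinIneq k) → Vec Carrier k → Set
  AllHold []       ρ = ⊤
  AllHold (h ∷ hs) ρ = ⟦ h ⟧ᴵ ρ × AllHold hs ρ

  summed : ∀ {k} (hs : List (LinIneq k)) {ρ} → AllHold hs ρ → ⟦ lhsSum hs ⟧ ρ ≤ ⟦ rhsSum hs ⟧ ρ
  summed []             _        = ≤-refl
  summed ((a ≼ b) ∷ hs) (p , ps) = +-mono-≤ p (summed hs ps)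

  -- With `L` and `R` for the sums of the left and right sides of the hypotheses, `Follows` is the
  -- formal identity `a + R = b + L`. Since `L ≤ R`, it gives `a + R ≤ b + R`, and `R` cancels. All
  -- coefficients are concrete numerals, so `refl` proves the identity at each use; the list of
  -- hypotheses is the whole certificate, each counted once.
  linear : ∀ {k} (ρ : Vec Carrier k) (hs : List (LinIneq k)) (h : LinIneq k) →
           Follows hs h → AllHold hs ρ → ⟦ h ⟧ᴵ ρ
  linear ρ hs (a ≼ b) eq ps = +-cancelʳ-≤ (⟦ rhsSum hs ⟧ ρ)
    (≤-respˡ-≈ (≈-sym (balance (a ⊞ rhsSum hs) (b ⊞ lhsSum hs) ρ eq)) (+-monoʳ-≤ (⟦ b ⟧ ρ) (summed hs ps)))

  ≮⇒≥ : ∀ {x y} → ¬ x < y → y ≤ x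
  ≮⇒≥ {x} {y} ¬x<y with ≤-total y x
  ... | inj₁ y≤x = y≤x
  ... | inj₂ x≤y with IsDecTotalOrder._≟_ isDecTotalOrder x y
  ...   | yes x≈y = ≤-reflexive (≈-sym x≈y)
  ...   | no  x≉y = ⊥-elim (¬x<y (x≤y , x≉y))

  ≰⇒> : ∀ {x y} → ¬ x ≤ y → y < x
  ≰⇒> {x} {y} x≰y with ≤-total x y
  ... | inj₁ x≤y = ⊥-elim (x≰y x≤y)
  ... | inj₂ y≤x = y≤x , λ y≈x → x≰y (≤-reflexive (≈-sym y≈x))

  <⇒≱ : ∀ {x y} → x < y → ¬ y ≤ x
  <⇒≱ (x≤y , x≉y) y≤x = x≉y (≤-antisym x≤y y≤x)

  ≤?-true : ∀ {x y} → ⌊ x ≤? y ⌋ ≡ true → x ≤ y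
  ≤?-true {x} {y} eq with x ≤? y
  ... | yes x≤y = x≤y

  ≤?-false : ∀ {x y} → ⌊ x ≤? y ⌋ ≡ false → ¬ x ≤ y
  ≤?-false {x} {y} eq with x ≤? y
  ... | no x≰y = x≰y

  ≡⇒≈ : ∀ {x y : Carrier} → x ≡ y → x ≈ y
  ≡⇒≈ refl = ≈-refl

-- Walks and simple paths

lookup-injective : ∀ {A : Set} {xs : List A} → Unique xs → ∀ i j → lookup xs i ≡ lookup xs j → i ≡ j
lookup-injective (_ ∷ _)  zero    zero    _  = refl
lookup-injective (x∉ ∷ _) zero    (suc j) eq = ⊥-elim (All.lookup x∉ (∈-lookup j) eq)
lookup-injective (x∉ ∷ _) (suc i) zero    eq = ⊥-elim (All.lookup x∉ (∈-lookup i) (sym eq))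
lookup-injective (_ ∷ u)  (suc i) (suc j) eq = cong suc (lookup-injective u i j eq)

unique⇒length≤ : ∀ {k} {xs : List (Fin k)} → Unique xs → length xs ℕ.≤ k
unique⇒length≤ u = injective⇒≤ (lookup-injective u _ _)

∉⇒All≢ : ∀ {A : Set} {x : A} {xs} → x ∉ xs → All (x ≢_) xs
∉⇒All≢ x∉ = All.tabulate λ { y∈ refl → x∉ y∈ }

unique-++⁻ˡ : ∀ {A : Set} (xs : List A) {ys} → Unique (xs ++ ys) → Unique xs
unique-++⁻ˡ []       _        = []
unique-++⁻ˡ (x ∷ xs) (x∉ ∷ u) = All.++⁻ˡ xs x∉ ∷ unique-++⁻ˡ xs u

unique-++⁻ʳ : ∀ {A : Set} (xs : List A) {ys} → Unique (xs ++ ys) → Unique ys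
unique-++⁻ʳ []       u       = u
unique-++⁻ʳ (x ∷ xs) (_ ∷ u) = unique-++⁻ʳ xs u

unique-++⇒disjoint : ∀ {A : Set} (xs : List A) {ys} → Unique (xs ++ ys) → ∀ {z} → z ∈ xs → z ∉ ys
unique-++⇒disjoint (x ∷ xs) (x∉ ∷ u) (here refl) z∈ = All.lookup (All.++⁻ʳ xs x∉) z∈ refl
unique-++⇒disjoint (x ∷ xs) (_ ∷ u)  (there z∈xs) z∈ = unique-++⇒disjoint xs u z∈xs z∈

module WalkLemmas {n : ℕ} (D : Digraph n) where
  open Digraph D

  -- Cutting at an arc rather than at a vertex makes `vertices p` the concatenation of the vertex
  -- lists of the two parts, so that in a simple walk these are disjoint and both simple.
  record Split {u v} (p : Walk u v) : Set where
    constructor mkSplit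
    field
      {x y}  : Fin n
      before : Walk u x
      arc′   : Arc x y
      after  : Walk y v
      eq     : p ≡ before ◅◅ (arc′ ◅ after)

  ◅-split : ∀ {u w v} (a : Arc u w) {p : Walk w v} → Split p → Split (a ◅ p)
  ◅-split a (mkSplit q b r refl) = mkSplit (a ◅ q) b r refl

  start∈ : ∀ {u v} (p : Walk u v) → u ∈ vertices p
  start∈ ε       = here refl
  start∈ (_ ◅ _) = here refl

  end∈ : ∀ {u v} (p : Walk u v) → v ∈ vertices p
  end∈ ε       = here refl
  end∈ (_ ◅ p) = there (end∈ p)

  vertices-◅◅ : ∀ {u x y v} (p : Walk u x) (a : Arc x y) (q : Walk y v) →
                vertices (p ◅◅ (a ◅ q)) ≡ vertices p ++ vertices q
  vertices-◅◅ ε       a q = refl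
  vertices-◅◅ (b ◅ p) a q = cong (_ ∷_) (vertices-◅◅ p a q)

  ∈-◅◅⁻ : ∀ {u x v} (p : Walk u x) (q : Walk x v) {z} → z ∈ vertices (p ◅◅ q) → z ∈ vertices p ⊎ z ∈ vertices q
  ∈-◅◅⁻ ε       q z∈         = inj₂ z∈
  ∈-◅◅⁻ (a ◅ p) q (here eq)  = inj₁ (here eq)
  ∈-◅◅⁻ (a ◅ p) q (there z∈) with ∈-◅◅⁻ p q z∈
  ... | inj₁ z∈p = inj₁ (there z∈p)
  ... | inj₂ z∈q = inj₂ z∈q

  arcs-◅◅ : ∀ {u x v} (p : Walk u x) (q : Walk x v) → arcs (p ◅◅ q) ≡ arcs p ℕ.+ arcs q
  arcs-◅◅ ε       q = refl
  arcs-◅◅ (a ◅ p) q = cong suc (arcs-◅◅ p q)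

  length-vertices : ∀ {u v} (p : Walk u v) → length (vertices p) ≡ suc (arcs p)
  length-vertices ε       = refl
  length-vertices (_ ◅ p) = cong suc (length-vertices p)

  arcs<n : ∀ {u v} (p : Walk u v) → Unique (vertices p) → arcs p ℕ.< n
  arcs<n p u = subst (ℕ._≤ n) (length-vertices p) (unique⇒length≤ u)

  module _ {u x y v} (p : Walk u x) (a : Arc x y) (q : Walk y v) (simple : Unique (vertices (p ◅◅ (a ◅ q)))) where
    private
      simple′ : Unique (vertices p ++ vertices q)
      simple′ = subst Unique (vertices-◅◅ p a q) simple

    simpleˡ : Unique (vertices p)
    simpleˡ = unique-++⁻ˡ (vertices p) simple′

    simpleʳ : Unique (vertices q)
    simpleʳ = unique-++⁻ʳ (vertices p) simple′

    simple-disjoint : ∀ {z} → z ∈ vertices p → z ∉ vertices q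
    simple-disjoint = unique-++⇒disjoint (vertices p) simple′

    ∈-before : ∀ {z} → z ∈ vertices p → z ∈ vertices (p ◅◅ (a ◅ q))
    ∈-before z∈ = subst (_ ∈_) (sym (vertices-◅◅ p a q)) (∈-++⁺ˡ z∈)

    ∈-after : ∀ {z} → z ∈ vertices q → z ∈ vertices (p ◅◅ (a ◅ q))
    ∈-after z∈ = subst (_ ∈_) (sym (vertices-◅◅ p a q)) (∈-++⁺ʳ (vertices p) z∈)

  simple-◅◅ : ∀ {u x y v} (p : Walk u x) (a : Arc x y) (q : Walk y v) →
              Unique (vertices p) → Unique (vertices q) → (∀ {z} → z ∈ vertices p → z ∉ vertices q) →
              Unique (vertices (p ◅◅ (a ◅ q)))
  simple-◅◅ p a q up uq disj = subst Unique (sym (vertices-◅◅ p a q)) (Unique.++⁺ up uq λ (z∈p , z∈q) → disj z∈p z∈q)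

  suffixFrom : ∀ {u v z} (p : Walk u v) → Unique (vertices p) → z ∈ vertices p →
               Σ (Walk u z) λ q → Σ (Walk z v) λ r → p ≡ q ◅◅ r × Unique (vertices q) × Unique (vertices r)
                 × (∀ {x} → x ∈ vertices q → x ∈ vertices p) × (∀ {x} → x ∈ vertices r → x ∈ vertices p)
  suffixFrom ε       s (here refl) = ε , ε , refl , s , s , (λ m → m) , (λ m → m)
  suffixFrom (a ◅ p) s (here refl) = ε , a ◅ p , refl , ([] ∷ []) , s , (λ { (here eq) → here eq }) , (λ m → m)
  suffixFrom (a ◅ p) (u∉ ∷ s) (there z∈) with suffixFrom p s z∈
  ... | q , r , refl , sq , sr , ⊆q , ⊆r =
    a ◅ q , r , refl , (All.tabulate (λ m → All.lookup u∉ (⊆q m)) ∷ sq) , sr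
    , (λ { (here eq) → here eq ; (there m) → there (⊆q m) }) , (λ m → there (⊆r m))

  module _ {P : Fin n → Set} (P? : Decidable P) where

    -- In the third case the arc of the split is the one by which the walk leaves `P` for good; in
    -- `FirstIn` it is the arc of the first entry. The completeness proof decomposes paths in these
    -- two ways, with `P` a tree or a side of a cut.
    data LastIn {u v} (p : Walk u v) : Set where
      never  : All (λ z → ¬ P z) (vertices p) → LastIn p
      atEnd  : P v → LastIn p
      midway : (s : Split p) → P (Split.x s) → All (λ z → ¬ P z) (vertices (Split.after s)) → LastIn p

    lastIn : ∀ {u v} (p : Walk u v) → LastIn p
    lastIn {u} ε with P? u
    ... | yes Pu = atEnd Pu
    ... | no ¬Pu = never (¬Pu ∷ [])
    lastIn {u} (a ◅ p) with lastIn p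
    ... | atEnd Pv                           = atEnd Pv
    ... | midway s@(mkSplit _ _ _ refl) Px ¬P = midway (◅-split a s) Px ¬P
    ... | never ¬P with P? u
    ...   | yes Pu = midway (mkSplit ε a p refl) Pu ¬P
    ...   | no ¬Pu = never (¬Pu ∷ ¬P)

    data FirstIn {u v} (p : Walk u v) : Set where
      never   : All (λ z → ¬ P z) (vertices p) → FirstIn p
      atStart : P u → FirstIn p
      midway  : (s : Split p) → P (Split.y s) → All (λ z → ¬ P z) (vertices (Split.before s)) → FirstIn p

    firstIn : ∀ {u v} (p : Walk u v) → FirstIn p
    firstIn {u} p with P? u
    firstIn {u} p       | yes Pu = atStart Pu
    firstIn {u} ε       | no ¬Pu = never (¬Pu ∷ [])
    firstIn {u} (a ◅ p) | no ¬Pu with firstIn p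
    ... | never ¬P                            = never (¬Pu ∷ ¬P)
    ... | atStart Py                          = midway (mkSplit ε a p refl) Py (¬Pu ∷ [])
    ... | midway s@(mkSplit _ _ _ refl) Py ¬P = midway (◅-split a s) Py (¬Pu ∷ ¬P)

-- Forests of negative edges

module Weights (ℝ : RealNumbers) {n : ℕ} (D : Digraph n) (c : Weighted.WeightFunction ℝ D) where
  open RealNumbers ℝ
  open LinearArithmetic ℝ
  open Digraph D
  open Weighted ℝ D
  open WalkLemmas D

  weight : ∀ {u v} → Walk u v → Carrier
  weight = walkWeight c

  noLoops : ∀ {v} → ¬ Arc v v
  noLoops {v} a = subst T (noLoop v) a

  weight-◅◅ : ∀ {u x v} (p : Walk u x) (q : Walk x v) → weight (p ◅◅ q) ≈ weight p + weight q
  weight-◅◅ ε       q = ≈-sym (+-identityˡ _)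
  weight-◅◅ (a ◅ p) q = ≈-trans (+-cong ≈-refl (weight-◅◅ p q))
    (≤-antisym (linear ρ [] (#0 ⊞ (#1 ⊞ #2) ≼ #0 ⊞ #1 ⊞ #2) refl tt)
               (linear ρ [] (#0 ⊞ #1 ⊞ #2 ≼ #0 ⊞ (#1 ⊞ #2)) refl tt))
    where ρ = c a ∷ weight p ∷ weight q ∷ []

  weight-split : ∀ {u x y v} (p : Walk u x) (a : Arc x y) (q : Walk y v) →
                 weight (p ◅◅ (a ◅ q)) ≈ weight p + (c a + weight q)
  weight-split p a q = weight-◅◅ p (a ◅ q)

  symNeg : ∀ {u v} → NegativeEdge c u v → NegativeEdge c v u
  symNeg (a , b , le , ne) = b , a , ≤-trans swap≤ le , λ eq → ne (≤-antisym le (≤-trans (≤-reflexive (≈-sym eq)) swap≤))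
    where
    swap≤ : c b + c a ≤ c a + c b
    swap≤ = linear (c a ∷ c b ∷ []) [] (#1 ⊞ #0 ≼ #0 ⊞ #1) refl tt

  longCycle≥0 : NearlyConservative c → ∀ {s x} (p : Path s x) (a : Arc x s) → ¬ arcs (Path.walk p) ℕ.≤ 1 →
                0# ≤ c a + pathWeight c p
  longCycle≥0 nc p a long = ≮⇒≥ λ neg → long (ℕ.≤-pred (nc (record { path = p ; closing = a }) neg))

  Edges : Set
  Edges = List (Fin n × Fin n)

  -- Deleting the edge `uy` splits its tree in two, and `side` is the part of `y`. `through`
  -- reverses the triangle inequality: a tree path between the two parts has to use the edge.
  record Cut (E : Edges) (comp : Fin n → Fin n) (e : Fin n → Fin n → Carrier) (u y : Fin n) : Set where
    field
      side     : Fin n → Bool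
      head-in  : side y ≡ true
      tail-out : side u ≡ false
      within   : ∀ {x} → side x ≡ true → comp x ≡ comp y
      crossing : ∀ {x z} → (x , z) ∈ E → side x ≡ true → side z ≡ false → x ≡ y × z ≡ u
      through  : ∀ {x z} → comp z ≡ comp y → side x ≡ true → side z ≡ false →
                 e x y + e y u + e u z ≤ e x z

  record TreePath (E : Edges) (comp : Fin n → Fin n) (e : Fin n → Fin n → Carrier) (x z : Fin n) : Set where
    field
      path   : Path x z
      light  : pathWeight c path ≤ - e z x
      inside : ∀ {y} → y ∈ vertices (Path.walk path) → comp y ≡ comp x
      -- Serves `cyclic`: an edge outside `E` between two vertices of a tree closes the tree path to
      -- a cycle of at least three arcs.
      short  : arcs (Path.walk path) ℕ.≤ 1 → x ≡ z ⊎ (x , z) ∈ E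

  -- e x z is the negated weight of the tree path from z to x; it is a
  -- quasimetric on every tree, because the two arcs of an edge have
  -- negative total weight.
  record Forest (E : Edges) (comp : Fin n → Fin n) (e : Fin n → Fin n → Carrier) : Set where
    field
      negative : ∀ {x z} → (x , z) ∈ E → NegativeEdge c x z
      symmetric : ∀ {x z} → (x , z) ∈ E → (z , x) ∈ E
      sameTree : ∀ {x z} → (x , z) ∈ E → comp x ≡ comp z
      e-arc    : ∀ {x z} → (x , z) ∈ E → (a : Arc z x) → e x z ≈ - c a
      e-refl   : ∀ {x} → e x x ≈ 0#
      triangle : ∀ {x y z} → comp x ≡ comp y → comp y ≡ comp z → e x z ≤ e x y + e y z
      cut      : ∀ {u y} → (u , y) ∈ E → Cut E comp e u y
      treePath : ∀ {x z} → comp x ≡ comp z → TreePath E comp e x z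

    e-0≤ : ∀ {x} → 0# ≤ e x x
    e-0≤ = ≤-reflexive (≈-sym e-refl)

    e-≤0 : ∀ {x} → e x x ≤ 0#
    e-≤0 = ≤-reflexive e-refl

    e-round : ∀ {x y} → comp x ≡ comp y → 0# ≤ e x y + e y x
    e-round p = ≤-trans e-0≤ (triangle p (sym p))

    -- The tree paths from `u` to `v` and back have at least two arcs each, so each closes with one
    -- arc of the new edge to a cycle of at least three arcs. If both cycles are nonnegative, then
    -- `c a + c b` is at least `e u v + e v u`, which is nonnegative by `e-round`.
    cyclic : ∀ {u v} → NegativeEdge c u v → comp u ≡ comp v → (u , v) ∉ E → ¬ NearlyConservative c
    cyclic {u} {v} (a , b , neg) same new nc = <⇒≱ neg
      (linear (e u v ∷ e v u ∷ c a ∷ c b ∷ pathWeight c (path there-path) ∷ pathWeight c (path back-path) ∷ [])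
        ((𝟘 ≼ #0 ⊞ #1) ∷ (#4 ≼ ⊝ #1) ∷ (#5 ≼ ⊝ #0) ∷ (𝟘 ≼ #3 ⊞ #4) ∷ (𝟘 ≼ #2 ⊞ #5) ∷ [])
        (𝟘 ≼ #2 ⊞ #3) refl
        (e-round same , light there-path , light back-path
        , longCycle≥0 nc (path there-path) b (λ s → no-short (short there-path s))
        , longCycle≥0 nc (path back-path) a (λ s → no-short′ (short back-path s)) , tt))
      where
      open TreePath
      there-path = treePath same
      back-path  = treePath (sym same)
      no-short : ¬ (u ≡ v ⊎ (u , v) ∈ E)
      no-short (inj₁ refl) = noLoops a
      no-short (inj₂ old)  = new old
      no-short′ : ¬ (v ≡ u ⊎ (v , u) ∈ E)
      no-short′ (inj₁ refl) = noLoops a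
      no-short′ (inj₂ old)  = new (symmetric old)

  -- While every vertex is its own tree, the conditions consult only the diagonal of `e`, so
  -- arbitrary initial contents of the other cells do no harm.
  emptyForest : ∀ {e} → (∀ {x} → e x x ≈ 0#) → Forest [] (λ x → x) e
  emptyForest {e} e-refl = record
    { negative = λ ()
    ; symmetric = λ ()
    ; sameTree = λ ()
    ; e-arc    = λ ()
    ; e-refl   = e-refl
    ; triangle = λ { {x} refl refl → linear (e x x ∷ []) ((𝟘 ≼ #0) ∷ []) (#0 ≼ #0 ⊞ #0) refl (≤-reflexive (≈-sym e-refl) , tt) }
    ; cut      = λ ()
    ; treePath = λ { {x} refl → record
        { path   = record { walk = ε ; simple = [] ∷ [] }
        ; light  = linear (e x x ∷ []) ((#0 ≼ 𝟘) ∷ []) (𝟘 ≼ ⊝ #0) refl (≤-reflexive e-refl , tt)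
        ; inside = λ { (here eq) → eq }
        ; short  = λ _ → inj₁ refl } }
    }

  -- Joining two trees by a negative edge

  record Joins (u v : Fin n) (comp comp′ : Fin n → Fin n) (e e′ : Fin n → Fin n → Carrier) : Set where
    field
      distinct : comp u ≢ comp v
      keep     : ∀ {x y} → comp x ≡ comp y → comp′ x ≡ comp′ y
      join     : ∀ {x y} → comp x ≡ comp u → comp y ≡ comp v → comp′ x ≡ comp′ y
      split    : ∀ {x y} → comp′ x ≡ comp′ y →
                 comp x ≡ comp y ⊎ (comp x ≡ comp u × comp y ≡ comp v) ⊎ (comp x ≡ comp v × comp y ≡ comp u)
      e-keep   : ∀ {x y} → comp x ≡ comp y → e′ x y ≈ e x y
      -- The tree path from `y` to `x` runs to `v`, over the arc `vu`, and on from `u`; `e` negates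
      -- its weight, whence `- c a`.
      e-join   : ∀ {x y} → comp x ≡ comp u → comp y ≡ comp v → (a : Arc v u) → e′ x y ≈ e x u - c a + e v y
      e-join′  : ∀ {x y} → comp x ≡ comp v → comp y ≡ comp u → (a : Arc u v) → e′ x y ≈ e x v - c a + e u y

  flip : ∀ {u v comp comp′ e e′} → Joins u v comp comp′ e e′ → Joins v u comp comp′ e e′
  flip J = record
    { distinct = λ eq → distinct (sym eq)
    ; keep     = keep
    ; join     = λ p q → sym (join q p)
    ; split    = λ p → swap (split p)
    ; e-keep   = e-keep
    ; e-join   = e-join′
    ; e-join′  = e-join
    }
    where
    open Joins J
    swap : ∀ {A B C : Set} → A ⊎ B ⊎ C → A ⊎ C ⊎ B
    swap (inj₁ x)        = inj₁ x
    swap (inj₂ (inj₁ x)) = inj₂ (inj₂ x)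
    swap (inj₂ (inj₂ x)) = inj₂ (inj₁ x)

  -- The construction is symmetric in the ends of the new edge. The cases are proved for one
  -- orientation, and `joinedForest` instantiates the module again with `flip J`. The new edge list
  -- is described by `old`, `new` and `inv` because the list itself is not symmetric in `u` and `v`.
  module Half {E comp e} (F : Forest E comp e) {u v comp′ e′} (J : Joins u v comp comp′ e e′)
              (uv : Arc u v) (vu : Arc v u) (neg : c uv + c vu < 0#)
              {E′ : Edges} (old : ∀ {x z} → (x , z) ∈ E → (x , z) ∈ E′) (new : (u , v) ∈ E′)
              (inv : ∀ {x z} → (x , z) ∈ E′ → (x , z) ∈ E ⊎ (x ≡ u × z ≡ v) ⊎ (x ≡ v × z ≡ u)) where
    open Forest F
    open Joins J

    private
      keep≤ : ∀ {x y} → comp x ≡ comp y → e′ x y ≤ e x y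
      keep≤ p = ≤-reflexive (e-keep p)
      keep≥ : ∀ {x y} → comp x ≡ comp y → e x y ≤ e′ x y
      keep≥ p = ≤-reflexive (≈-sym (e-keep p))
      join≤ : ∀ {x y} → comp x ≡ comp u → comp y ≡ comp v → e′ x y ≤ e x u - c vu + e v y
      join≤ p q = ≤-reflexive (e-join p q vu)
      join≥ : ∀ {x y} → comp x ≡ comp u → comp y ≡ comp v → e x u - c vu + e v y ≤ e′ x y
      join≥ p q = ≤-reflexive (≈-sym (e-join p q vu))
      join′≤ : ∀ {x y} → comp x ≡ comp v → comp y ≡ comp u → e′ x y ≤ e x v - c uv + e u y
      join′≤ p q = ≤-reflexive (e-join′ p q uv)
      join′≥ : ∀ {x y} → comp x ≡ comp v → comp y ≡ comp u → e x v - c uv + e u y ≤ e′ x y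
      join′≥ p q = ≤-reflexive (≈-sym (e-join′ p q uv))

    triangle-keep-join : ∀ {x y z} → comp x ≡ comp y → comp y ≡ comp u → comp z ≡ comp v → e′ x z ≤ e′ x y + e′ y z
    triangle-keep-join {x} {y} {z} xy yu zv =
      linear (e′ x z ∷ e x u ∷ c vu ∷ e v z ∷ e x y ∷ e y u ∷ e′ x y ∷ e′ y z ∷ [])
        ((#0 ≼ #1 ⊟ #2 ⊞ #3) ∷ (#1 ≼ #4 ⊞ #5) ∷ (#4 ≼ #6) ∷ (#5 ⊟ #2 ⊞ #3 ≼ #7) ∷ []) (#0 ≼ #6 ⊞ #7) refl
        (join≤ (trans xy yu) zv , triangle xy yu , keep≥ xy , join≥ yu zv , tt)

    triangle-join-keep : ∀ {x y z} → comp x ≡ comp u → comp y ≡ comp v → comp y ≡ comp z → e′ x z ≤ e′ x y + e′ y z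
    triangle-join-keep {x} {y} {z} xu yv yz =
      linear (e′ x z ∷ e x u ∷ c vu ∷ e v z ∷ e v y ∷ e y z ∷ e′ x y ∷ e′ y z ∷ [])
        ((#0 ≼ #1 ⊟ #2 ⊞ #3) ∷ (#3 ≼ #4 ⊞ #5) ∷ (#1 ⊟ #2 ⊞ #4 ≼ #6) ∷ (#5 ≼ #7) ∷ []) (#0 ≼ #6 ⊞ #7) refl
        (join≤ xu (trans (sym yz) yv) , triangle (sym yv) yz , join≥ xu yv , keep≥ yz , tt)

    -- The tour to `y` and back adds `- (c uv + c vu)` for the new edge and `e v y + e y v` for the
    -- other tree, and neither is negative. This is the one triangle case in which the negativity of
    -- the edge enters.
    triangle-join-join′ : ∀ {x y z} → comp x ≡ comp u → comp y ≡ comp v → comp z ≡ comp u → e′ x z ≤ e′ x y + e′ y z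
    triangle-join-join′ {x} {y} {z} xu yv zu =
      linear (e′ x z ∷ e x u ∷ e u z ∷ c vu ∷ c uv ∷ e v y ∷ e y v ∷ e′ x y ∷ e′ y z ∷ [])
        ((#0 ≼ #1 ⊞ #2) ∷ (𝟘 ≼ #5 ⊞ #6) ∷ (#4 ⊞ #3 ≼ 𝟘) ∷ (#1 ⊟ #3 ⊞ #5 ≼ #7) ∷ (#6 ⊟ #4 ⊞ #2 ≼ #8) ∷ [])
        (#0 ≼ #7 ⊞ #8) refl
        (≤-trans (keep≤ (trans xu (sym zu))) (triangle xu (sym zu)) , e-round (sym yv) , proj₁ neg
        , join≥ xu yv , join′≥ yv zu , tt)

    newCut : Cut E′ comp′ e′ u v
    newCut = record
      { side     = λ x → ⌊ comp x ≟ comp v ⌋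
      ; head-in  = inside refl
      ; tail-out = outside distinct
      ; within   = λ s → keep (inside⁻ s)
      ; crossing = λ m s t → crossing m (inside⁻ s) (outside⁻ t)
      ; through  = λ {x} {z} zv s t → through x z (zu zv (outside⁻ t)) (inside⁻ s)
      }
      where
      inside : ∀ {x} → comp x ≡ comp v → ⌊ comp x ≟ comp v ⌋ ≡ true
      inside {x} p with comp x ≟ comp v
      ... | yes _ = refl
      ... | no ¬p = ⊥-elim (¬p p)
      outside : ∀ {x} → comp x ≢ comp v → ⌊ comp x ≟ comp v ⌋ ≡ false
      outside {x} ¬p with comp x ≟ comp v
      ... | yes p = ⊥-elim (¬p p)
      ... | no _  = refl
      inside⁻ : ∀ {x} → ⌊ comp x ≟ comp v ⌋ ≡ true → comp x ≡ comp v
      inside⁻ {x} s with comp x ≟ comp v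
      ... | yes p = p
      outside⁻ : ∀ {x} → ⌊ comp x ≟ comp v ⌋ ≡ false → comp x ≢ comp v
      outside⁻ {x} s with comp x ≟ comp v
      ... | no ¬p = ¬p
      crossing : ∀ {x z} → (x , z) ∈ E′ → comp x ≡ comp v → comp z ≢ comp v → x ≡ v × z ≡ u
      crossing m xv zv with inv m
      ... | inj₁ o                    = ⊥-elim (zv (trans (sym (sameTree o)) xv))
      ... | inj₂ (inj₁ (refl , refl)) = ⊥-elim (zv refl)
      ... | inj₂ (inj₂ eqs)           = eqs
      zu : ∀ {z} → comp′ z ≡ comp′ v → comp z ≢ comp v → comp z ≡ comp u
      zu zv ¬zv with split zv
      ... | inj₁ p               = ⊥-elim (¬zv p)
      ... | inj₂ (inj₁ (p , _))  = p
      ... | inj₂ (inj₂ (_ , vu)) = ⊥-elim (distinct (sym vu))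
      through : ∀ x z → comp z ≡ comp u → comp x ≡ comp v → e′ x v + e′ v u + e′ u z ≤ e′ x z
      through x z zu xv =
        linear (e x v ∷ e u z ∷ c uv ∷ e v v ∷ e u u ∷ e′ x v ∷ e′ v u ∷ e′ u z ∷ e′ x z ∷ [])
          ((#5 ≼ #0) ∷ (#6 ≼ #3 ⊟ #2 ⊞ #4) ∷ (#7 ≼ #1) ∷ (#3 ≼ 𝟘) ∷ (#4 ≼ 𝟘) ∷ (#0 ⊟ #2 ⊞ #1 ≼ #8) ∷ [])
          (#5 ⊞ #6 ⊞ #7 ≼ #8) refl
          (keep≤ xv , join′≤ refl refl , keep≤ (sym zu) , e-≤0 , e-≤0 , join′≥ xv zu , tt)

    -- The whole tree of v joins the side of u.
    extendedCut : ∀ {s t} → comp s ≡ comp u → comp t ≡ comp u → Cut E comp e s t → Cut E′ comp′ e′ s t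
    extendedCut {s} {t} su tu C = record
      { side     = side′
      ; head-in  = trans (away λ tv → distinct (trans (sym tu) tv)) head-in
      ; tail-out = trans (away λ sv → distinct (trans (sym su) sv)) tail-out
      ; within   = within′
      ; crossing = crossing′
      ; through  = through′
      }
      where
      open Cut C
      side′ : Fin n → Bool
      side′ x with comp x ≟ comp v
      ... | yes _ = side u
      ... | no _  = side x
      near : ∀ {x} → comp x ≡ comp v → side′ x ≡ side u
      near {x} p with comp x ≟ comp v
      ... | yes _ = refl
      ... | no ¬p = ⊥-elim (¬p p)
      away : ∀ {x} → comp x ≢ comp v → side′ x ≡ side x
      away {x} ¬p with comp x ≟ comp v
      ... | yes p = ⊥-elim (¬p p)
      ... | no _  = refl
      within′ : ∀ {x} → side′ x ≡ true → comp′ x ≡ comp′ t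
      within′ {x} in′ with comp x ≟ comp v
      ... | yes p = sym (join tu p)
      ... | no _  = keep (within in′)
      different : ∀ {b : Bool} → b ≡ true → b ≢ false
      different refl ()
      crossing′ : ∀ {x z} → (x , z) ∈ E′ → side′ x ≡ true → side′ z ≡ false → x ≡ t × z ≡ s
      crossing′ {x} {z} m in′ out with inv m
      ... | inj₂ (inj₁ (refl , refl)) = ⊥-elim (different (trans (trans (near refl) (sym (away distinct))) in′) out)
      ... | inj₂ (inj₂ (refl , refl)) = ⊥-elim (different (trans (trans (away distinct) (sym (near refl))) in′) out)
      ... | inj₁ o with comp x ≟ comp v | comp z ≟ comp v
      ...   | yes p | yes q = ⊥-elim (different in′ out)
      ...   | yes p | no ¬q = ⊥-elim (¬q (trans (sym (sameTree o)) p))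
      ...   | no ¬p | yes q = ⊥-elim (¬p (trans (sameTree o) q))
      ...   | no ¬p | no ¬q = crossing o in′ out
      through′ : ∀ {x z} → comp′ z ≡ comp′ t → side′ x ≡ true → side′ z ≡ false → e′ x t + e′ t s + e′ s z ≤ e′ x z
      through′ {x} {z} zt in′ out with comp x ≟ comp v | comp z ≟ comp v
      ... | yes p | yes q = ⊥-elim (different in′ out)
      ... | yes xv | no ¬zv =
        linear (e x v ∷ c uv ∷ e u t ∷ e t s ∷ e s z ∷ e u z ∷ e′ x t ∷ e′ t s ∷ e′ s z ∷ e′ x z ∷ [])
          ((#6 ≼ #0 ⊟ #1 ⊞ #2) ∷ (#7 ≼ #3) ∷ (#8 ≼ #4) ∷ (#2 ⊞ #3 ⊞ #4 ≼ #5) ∷ (#0 ⊟ #1 ⊞ #5 ≼ var (# 9)) ∷ [])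
          (#6 ⊞ #7 ⊞ #8 ≼ var (# 9)) refl
          (join′≤ xv tu , keep≤ (trans tu (sym su)) , keep≤ (trans su (sym zu)) , through (trans zu (sym tu)) in′ out
          , join′≥ xv zu , tt)
        where
        zu : comp z ≡ comp u
        zu with split zt
        ... | inj₁ p              = trans p tu
        ... | inj₂ (inj₁ (p , _)) = p
        ... | inj₂ (inj₂ (p , _)) = ⊥-elim (¬zv p)
      ... | no ¬xv | yes zv =
        linear (e x u ∷ c vu ∷ e v z ∷ e x t ∷ e t s ∷ e s u ∷ e′ x t ∷ e′ t s ∷ e′ s z ∷ e′ x z ∷ [])
          ((#6 ≼ #3) ∷ (#7 ≼ #4) ∷ (#8 ≼ #5 ⊟ #1 ⊞ #2) ∷ (#3 ⊞ #4 ⊞ #5 ≼ #0) ∷ (#0 ⊟ #1 ⊞ #2 ≼ var (# 9)) ∷ [])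
          (#6 ⊞ #7 ⊞ #8 ≼ var (# 9)) refl
          (keep≤ (within in′) , keep≤ (trans tu (sym su)) , join≤ su zv , through (sym tu) in′ out
          , join≥ (trans (within in′) tu) zv , tt)
      ... | no ¬xv | no ¬zv =
        linear (e x t ∷ e t s ∷ e s z ∷ e x z ∷ e′ x t ∷ e′ t s ∷ e′ s z ∷ e′ x z ∷ [])
          ((#4 ≼ #0) ∷ (#5 ≼ #1) ∷ (#6 ≼ #2) ∷ (#0 ⊞ #1 ⊞ #2 ≼ #3) ∷ (#3 ≼ #7) ∷ [])
          (#4 ⊞ #5 ⊞ #6 ≼ #7) refl
          (keep≤ (within in′) , keep≤ (trans tu (sym su)) , keep≤ (trans su (trans (sym tu) (sym zt′)))
          , through zt′ in′ out , keep≥ (trans (within in′) (sym zt′)) , tt)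
        where
        zt′ : comp z ≡ comp t
        zt′ with split zt
        ... | inj₁ p              = p
        ... | inj₂ (inj₁ (_ , p)) = ⊥-elim (distinct (trans (sym tu) p))
        ... | inj₂ (inj₂ (p , _)) = ⊥-elim (¬zv p)

    joinedPath : ∀ {x z} → comp x ≡ comp u → comp z ≡ comp v → TreePath E′ comp′ e′ x z
    joinedPath {x} {z} xu zv = record
      { path   = record
          { walk   = p ◅◅ (uv ◅ q)
          ; simple = simple-◅◅ p uv q (Path.simple (path P)) (Path.simple (path Q))
              λ y∈p y∈q → distinct (trans (sym (trans (inside P y∈p) xu)) (inside Q y∈q)) }
      ; light  = ≤-trans (≤-reflexive (weight-split p uv q))
          (linear (weight p ∷ weight q ∷ c uv ∷ e u x ∷ e z v ∷ e′ z x ∷ [])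
            ((#0 ≼ ⊝ #3) ∷ (#1 ≼ ⊝ #4) ∷ (#5 ≼ #4 ⊟ #2 ⊞ #3) ∷ []) (#0 ⊞ (#2 ⊞ #1) ≼ ⊝ #5) refl
            (light P , light Q , join′≤ zv xu , tt))
      ; inside = λ y∈ → inside′ (∈-◅◅⁻ p (uv ◅ q) y∈)
      ; short  = short′ p q
      }
      where
      open TreePath
      P = treePath xu
      Q = treePath (sym zv)
      p = Path.walk (path P)
      q = Path.walk (path Q)
      inside′ : ∀ {y} → y ∈ vertices p ⊎ y ∈ vertices (uv ◅ q) → comp′ y ≡ comp′ x
      inside′ (inj₁ y∈)          = keep (inside P y∈)
      inside′ (inj₂ (here refl)) = keep (sym xu)
      inside′ (inj₂ (there y∈))  = sym (join xu (inside Q y∈))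
      short′ : ∀ {x z} (p : Walk x u) (q : Walk v z) → arcs (p ◅◅ (uv ◅ q)) ℕ.≤ 1 → x ≡ z ⊎ (x , z) ∈ E′
      short′ ε       ε       _ = inj₂ new
      short′ ε       (_ ◅ _) (s≤s ())
      short′ (_ ◅ p) q       (s≤s le) = ⊥-elim (absurd (subst (ℕ._≤ 0) (arcs-◅◅ p (uv ◅ q)) le))
        where
        absurd : ¬ arcs p ℕ.+ suc (arcs q) ℕ.≤ 0
        absurd le rewrite ℕ.+-suc (arcs p) (arcs q) with () ← le

  joinedForest : ∀ {E comp e u v comp′ e′} → Forest E comp e → Joins u v comp comp′ e e′ →
                 NegativeEdge c u v → Forest ((u , v) ∷ (v , u) ∷ E) comp′ e′
  joinedForest {E} {comp} {e} {u} {v} {comp′} {e′} F J neg@(uv , vu , _) = record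
    { negative = λ m → negative′ (inv m)
    ; symmetric = λ m → symmetric′ (inv m)
    ; sameTree = λ m → sameTree′ (inv m)
    ; e-arc    = λ m → e-arc′ (inv m)
    ; e-refl   = ≈-trans (e-keep refl) e-refl
    ; triangle = λ p q → triangle′ (split p) (split q)
    ; cut      = λ m → cut′ (inv m)
    ; treePath = λ p → treePath′ (split p)
    }
    where
    open Forest F
    open Joins J
    E′ = (u , v) ∷ (v , u) ∷ E
    old : ∀ {x z} → (x , z) ∈ E → (x , z) ∈ E′
    old m = there (there m)
    inv : ∀ {x z} → (x , z) ∈ E′ → (x , z) ∈ E ⊎ (x ≡ u × z ≡ v) ⊎ (x ≡ v × z ≡ u)
    inv (here refl)         = inj₂ (inj₁ (refl , refl))
    inv (there (here refl)) = inj₂ (inj₂ (refl , refl))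
    inv (there (there m))   = inj₁ m
    inv′ : ∀ {x z} → (x , z) ∈ E′ → (x , z) ∈ E ⊎ (x ≡ v × z ≡ u) ⊎ (x ≡ u × z ≡ v)
    inv′ (here refl)         = inj₂ (inj₂ (refl , refl))
    inv′ (there (here refl)) = inj₂ (inj₁ (refl , refl))
    inv′ (there (there m))   = inj₁ m
    module U = Half F J uv vu (proj₂ (proj₂ neg)) old (here refl) inv
    module V = Half F (flip J) vu uv (proj₂ (proj₂ (symNeg neg))) old (there (here refl)) inv′
    New : Fin n → Fin n → Set
    New x z = (x , z) ∈ E ⊎ (x ≡ u × z ≡ v) ⊎ (x ≡ v × z ≡ u)
    negative′ : ∀ {x z} → New x z → NegativeEdge c x z
    negative′ (inj₁ m)                    = negative m
    negative′ (inj₂ (inj₁ (refl , refl))) = neg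
    negative′ (inj₂ (inj₂ (refl , refl))) = symNeg neg
    symmetric′ : ∀ {x z} → New x z → (z , x) ∈ E′
    symmetric′ (inj₁ m)                    = old (symmetric m)
    symmetric′ (inj₂ (inj₁ (refl , refl))) = there (here refl)
    symmetric′ (inj₂ (inj₂ (refl , refl))) = here refl
    sameTree′ : ∀ {x z} → New x z → comp′ x ≡ comp′ z
    sameTree′ (inj₁ m)                    = keep (sameTree m)
    sameTree′ (inj₂ (inj₁ (refl , refl))) = join refl refl
    sameTree′ (inj₂ (inj₂ (refl , refl))) = sym (join refl refl)
    drop : ∀ {s t w} → s ≈ 0# → t ≈ 0# → s - w + t ≈ - w
    drop {s} {t} {w} p q = ≤-antisym
      (linear (s ∷ t ∷ w ∷ []) ((#0 ≼ 𝟘) ∷ (#1 ≼ 𝟘) ∷ []) (#0 ⊟ #2 ⊞ #1 ≼ ⊝ #2) refl (≤-reflexive p , ≤-reflexive q , tt))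
      (linear (s ∷ t ∷ w ∷ []) ((𝟘 ≼ #0) ∷ (𝟘 ≼ #1) ∷ []) (⊝ #2 ≼ #0 ⊟ #2 ⊞ #1) refl
        (≤-reflexive (≈-sym p) , ≤-reflexive (≈-sym q) , tt))
    e-arc′ : ∀ {x z} → New x z → (a : Arc z x) → e′ x z ≈ - c a
    e-arc′ (inj₁ m)                    a = ≈-trans (e-keep (sameTree m)) (e-arc m a)
    e-arc′ (inj₂ (inj₁ (refl , refl))) a = ≈-trans (e-join refl refl a) (drop e-refl e-refl)
    e-arc′ (inj₂ (inj₂ (refl , refl))) a = ≈-trans (e-join′ refl refl a) (drop e-refl e-refl)
    Case : Fin n → Fin n → Set
    Case x y = comp x ≡ comp y ⊎ (comp x ≡ comp u × comp y ≡ comp v) ⊎ (comp x ≡ comp v × comp y ≡ comp u)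
    triangle′ : ∀ {x y z} → Case x y → Case y z → e′ x z ≤ e′ x y + e′ y z
    triangle′ {x} {y} {z} (inj₁ p) (inj₁ q) =
      linear (e x z ∷ e x y ∷ e y z ∷ e′ x z ∷ e′ x y ∷ e′ y z ∷ [])
        ((#3 ≼ #0) ∷ (#0 ≼ #1 ⊞ #2) ∷ (#1 ≼ #4) ∷ (#2 ≼ #5) ∷ []) (#3 ≼ #4 ⊞ #5) refl
        (≤-reflexive (e-keep (trans p q)) , triangle p q
        , ≤-reflexive (≈-sym (e-keep p)) , ≤-reflexive (≈-sym (e-keep q)) , tt)
    triangle′ (inj₁ p) (inj₂ (inj₁ (q , r))) = U.triangle-keep-join p q r
    triangle′ (inj₁ p) (inj₂ (inj₂ (q , r))) = V.triangle-keep-join p q r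
    triangle′ (inj₂ (inj₁ (p , q))) (inj₁ r) = U.triangle-join-keep p q r
    triangle′ (inj₂ (inj₂ (p , q))) (inj₁ r) = V.triangle-join-keep p q r
    triangle′ (inj₂ (inj₁ (p , q))) (inj₂ (inj₂ (_ , r))) = U.triangle-join-join′ p q r
    triangle′ (inj₂ (inj₂ (p , q))) (inj₂ (inj₁ (_ , r))) = V.triangle-join-join′ p q r
    triangle′ (inj₂ (inj₁ (_ , q))) (inj₂ (inj₁ (q′ , _))) = ⊥-elim (distinct (trans (sym q′) q))
    triangle′ (inj₂ (inj₂ (_ , q))) (inj₂ (inj₂ (q′ , _))) = ⊥-elim (distinct (trans (sym q) q′))
    unchangedCut : ∀ {s t} → comp s ≡ comp t → comp t ≢ comp u → comp t ≢ comp v → Cut E comp e s t → Cut E′ comp′ e′ s t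
    unchangedCut {s} {t} st tu tv C = record
      { side     = side
      ; head-in  = head-in
      ; tail-out = tail-out
      ; within   = λ m → keep (within m)
      ; crossing = λ m → crossing′ (inv m)
      ; through  = λ {x} {z} zt in′ out → let zt′ = back zt in
          linear (e x t ∷ e t s ∷ e s z ∷ e x z ∷ e′ x t ∷ e′ t s ∷ e′ s z ∷ e′ x z ∷ [])
            ((#4 ≼ #0) ∷ (#5 ≼ #1) ∷ (#6 ≼ #2) ∷ (#0 ⊞ #1 ⊞ #2 ≼ #3) ∷ (#3 ≼ #7) ∷ [])
            (#4 ⊞ #5 ⊞ #6 ≼ #7) refl
            (≤-reflexive (e-keep (within in′)) , ≤-reflexive (e-keep (sym st))
            , ≤-reflexive (e-keep (trans st (sym zt′)))
            , through zt′ in′ out , ≤-reflexive (≈-sym (e-keep (trans (within in′) (sym zt′)))) , tt)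
      }
      where
      open Cut C
      crossing′ : ∀ {x z} → New x z → side x ≡ true → side z ≡ false → x ≡ t × z ≡ s
      crossing′ (inj₁ m)                    in′ out = crossing m in′ out
      crossing′ (inj₂ (inj₁ (refl , refl))) in′ out = ⊥-elim (tu (sym (within in′)))
      crossing′ (inj₂ (inj₂ (refl , refl))) in′ out = ⊥-elim (tv (sym (within in′)))
      back : ∀ {z} → comp′ z ≡ comp′ t → comp z ≡ comp t
      back p with split p
      ... | inj₁ q              = q
      ... | inj₂ (inj₁ (_ , q)) = ⊥-elim (tv q)
      ... | inj₂ (inj₂ (_ , q)) = ⊥-elim (tu q)
    cut′ : ∀ {s t} → New s t → Cut E′ comp′ e′ s t
    cut′ (inj₂ (inj₁ (refl , refl))) = U.newCut
    cut′ (inj₂ (inj₂ (refl , refl))) = V.newCut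
    cut′ {s} {t} (inj₁ m) with comp t ≟ comp u | comp t ≟ comp v
    ... | yes tu | _      = U.extendedCut (trans (sameTree m) tu) tu (cut m)
    ... | no _   | yes tv = V.extendedCut (trans (sameTree m) tv) tv (cut m)
    ... | no tu  | no tv  = unchangedCut (sameTree m) tu tv (cut m)
    treePath′ : ∀ {x z} → Case x z → TreePath E′ comp′ e′ x z
    treePath′ (inj₂ (inj₁ (p , q))) = U.joinedPath p q
    treePath′ (inj₂ (inj₂ (p , q))) = V.joinedPath p q
    treePath′ {x} {z} (inj₁ p) = record
      { path   = path
      ; light  = linear (pathWeight c path ∷ e z x ∷ e′ z x ∷ []) ((#0 ≼ ⊝ #1) ∷ (#2 ≼ #1) ∷ []) (#0 ≼ ⊝ #2) refl
          (light , ≤-reflexive (e-keep (sym p)) , tt)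
      ; inside = λ m → keep (inside m)
      ; short  = λ s → map₂ old (short s)
      }
      where open TreePath (treePath p)

-- Shortest walks through forbidden sets of trees

-- Sets of forbidden trees are numbered: blocked S r says that S forbids
-- the tree with label r, and S + bit r forbids that tree in addition.
record Encoding (n : ℕ) (nontrivial : Fin n → Bool) : Set where
  field
    size      : ℕ
    bit       : Fin n → ℕ
    blocked   : ℕ → Fin n → Bool
    0<size    : 0 ℕ.< size
    blocked-0 : ∀ r → blocked 0 r ≡ false
    add-<     : ∀ {S r} → S ℕ.< size → blocked S r ≡ false → S ℕ.+ bit r ℕ.< size
    add-other : ∀ {S r r′} → S ℕ.< size → blocked S r ≡ false → r′ ≢ r → blocked (S ℕ.+ bit r) r′ ≡ blocked S r′
    add-self  : ∀ {S r} → S ℕ.< size → blocked S r ≡ false → nontrivial r ≡ true → blocked (S ℕ.+ bit r) r ≡ true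

module Routes (ℝ : RealNumbers) {n : ℕ} (D : Digraph n) (c : Weighted.WeightFunction ℝ D)
              (comp : Fin n → Fin n) (e : Fin n → Fin n → RealNumbers.Carrier ℝ)
              {nontrivial : Fin n → Bool} (enc : Encoding n nontrivial) where
  open RealNumbers ℝ
  open Digraph D
  open Encoding enc

  -- Route j S s t w: some walk from s to t of weight w meets at most j
  -- trees, none forbidden by S; it crosses each of them along a tree
  -- path and meets it only once unless it is a single vertex.
  -- Exit is the same for walks that leave the tree of s at once.
  data Route : ℕ → ℕ → Fin n → Fin n → Carrier → Set
  data Exit  : ℕ → ℕ → Fin n → Fin n → Carrier → Set

  data Route where
    move : ∀ {j S s b t w} → comp b ≡ comp s → Exit j S b t w → Route (suc j) S s t (w - e b s)

  data Exit where
    stop  : ∀ {j S t} → blocked S (comp t) ≡ false → Exit j S t t 0#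
    leave : ∀ {j S b y t w} → blocked S (comp b) ≡ false → (a : Arc b y) →
            Route j (S ℕ.+ bit (comp b)) y t w → Exit j S b t (c a + w)

  route-mono : ∀ {j k S s t w} → j ℕ.≤ k → Route j S s t w → Route k S s t w
  exit-mono  : ∀ {j k S s t w} → j ℕ.≤ k → Exit j S s t w → Exit k S s t w
  route-mono (s≤s le) (move eq x)   = move eq (exit-mono le x)
  exit-mono  le       (stop f)      = stop f
  exit-mono  le       (leave f a r) = leave f a (route-mono le r)

-- Completeness: no simple path is lighter than all routes

module Completeness
  (ℝ : RealNumbers) {n : ℕ} (D : Digraph n) (c : Weighted.WeightFunction ℝ D)
  {E : Weights.Edges ℝ D c} {comp : Fin n → Fin n} {e : Fin n → Fin n → RealNumbers.Carrier ℝ}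
  (F : Weights.Forest ℝ D c E comp e)
  (allNegative : ∀ {u v} → Weighted.NegativeEdge ℝ D c u v → (u , v) ∈ E)
  {nontrivial : Fin n → Bool} (enc : Encoding n nontrivial)
  where
  open RealNumbers ℝ
  open LinearArithmetic ℝ
  open Digraph D
  open Weighted ℝ D
  open WalkLemmas D
  open Weights ℝ D c
  open Forest F
  open Encoding enc
  open Routes ℝ D c comp e enc
  open DecMembership (≡-dec (_≟_ {n}) (_≟_ {n})) using (_∈?_)

  Free : ∀ {u v} → ℕ → Walk u v → Set
  Free S p = ∀ {z} → z ∈ vertices p → blocked S (comp z) ≡ false

  -- The success of the final check, taken in place of near conservativity, which is to be derived
  -- from it. Since `E` contains every negative edge, the check applies to each arc outside the
  -- forest.
  module _ (check : ∀ {x s} (a : Arc x s) → ¬ NegativeEdge c x s → ∀ {w} → Route n 0 s x w → 0# ≤ w + c a) where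

    private
      1≤n : Fin n → 1 ℕ.≤ n
      1≤n v = ℕ.≤-trans (s≤s z≤n) (toℕ<n v)

      notTrue : ∀ {b} → ¬ b ≡ true → b ≡ false
      notTrue = Bool.¬-not

    Light : ℕ → Set
    Light m = ∀ {S s t} (p : Walk s t) → arcs p ℕ.≤ m → Unique (vertices p) → S ℕ.< size → Free S p →
              ∃ λ w → Route (suc (arcs p)) S s t w × w ≤ weight p

    -- `z` is the first vertex of `p` that is back in the tree of `x`. After cancelling `rest`,
    -- `bound` says that the detour from `x` to `z` weighs at least `e x z`; by `e-round` this is no
    -- less than `- e z x`, which stands for the weight of the tree path from `x` to `z`.
    record Return {v} (x : Fin n) {y} (a : Arc x y) (p : Walk y v) : Set where
      field
        {z}     : Fin n
        rest    : Walk z v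
        same    : comp z ≡ comp x
        shorter : arcs rest ℕ.≤ arcs p
        simple  : Unique (vertices rest)
        z∈p     : z ∈ vertices p
        bound   : e x z + weight rest ≤ c a + weight p

    -- A walk outside a tree from x back to z closes up with the tree
    -- path from z to x, so the check bounds it from below by e x z.
    return : ∀ {m} → Light m → ∀ {x y v} (a : Arc x y) (p : Walk y v) → (x , y) ∉ E → arcs p ℕ.≤ m →
             Unique (vertices (a ◅ p)) → comp v ≡ comp x → Return x a p
    return light {x} {y} {v} a p a∉ p≤m u@(x∉ ∷ up) v~x with firstIn (λ z → comp z ≟ comp x) p
    ... | never ¬T = ⊥-elim (All.lookup ¬T (end∈ p) v~x)
    ... | atStart y~x = record
      { rest = p ; same = y~x ; shorter = ℕ.≤-refl ; simple = up ; z∈p = start∈ p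
      ; bound = linear (e x y ∷ c a ∷ weight p ∷ []) ((𝟘 ≼ 𝟘 ⊟ #0 ⊞ #1) ∷ []) (#0 ⊞ #2 ≼ #1 ⊞ #2) refl
          (check a (λ ne → a∉ (allNegative ne))
            (route-mono (1≤n x) (move {j = 0} (sym y~x) (stop (blocked-0 _)))) , tt) }
    ... | midway (mkSplit {g} {z} q b r refl) z~x ¬T = record
      { rest = r ; same = z~x
      ; shorter = subst (arcs r ℕ.≤_) (sym (arcs-◅◅ q (b ◅ r)))
                    (ℕ.≤-trans (ℕ.n≤1+n _) (ℕ.m≤n+m _ (arcs q)))
      ; simple = simpleʳ q b r up ; z∈p = ∈-after q b r up (start∈ r)
      ; bound = linear (e x z ∷ c a ∷ c b ∷ weight q ∷ weight r ∷ weight (q ◅◅ (b ◅ r)) ∷ proj₁ inner ∷ [])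
          ((𝟘 ≼ #1 ⊞ #6 ⊟ #0 ⊞ #2) ∷ (#6 ≼ #3) ∷ (#3 ⊞ (#2 ⊞ #4) ≼ #5) ∷ []) (#0 ⊞ #4 ≼ #1 ⊞ #5) refl
          ( check b (λ ne → g≁x (trans (sameTree (allNegative ne)) z~x))
              -- One visit to the tree of `x` and at most `suc (arcs q)` visits between `y` and `g`:
              -- together as many as the simple walk `a ◅ q` has vertices, hence at most `n`.
              (route-mono (arcs<n (a ◅ q) (simpleˡ (a ◅ q) b r u))
                (move (sym z~x) (leave (blocked-0 _) a (proj₁ (proj₂ inner)))))
          , proj₂ (proj₂ inner) , ≤-reflexive (≈-sym (weight-split q b r)) , tt) }
      where
      g≁x : comp g ≢ comp x
      g≁x = All.lookup ¬T (end∈ q)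
      inner : ∃ λ w → Route (suc (arcs q)) (0 ℕ.+ bit (comp x)) y g w × w ≤ weight q
      inner = light q (ℕ.≤-trans (subst (arcs q ℕ.≤_) (sym (arcs-◅◅ q (b ◅ r))) (ℕ.m≤m+n _ _)) p≤m)
                (simpleˡ q b r up) (add-< 0<size (blocked-0 _))
                (λ z∈ → trans (add-other 0<size (blocked-0 _) (All.lookup ¬T z∈)) (blocked-0 _))

    -- Induction step of `treeLight`, by the first arc. An arc outside the forest begins a detour to
    -- some `z` of the tree, and `triangle` combines its bound `e u z` with the induction hypothesis
    -- for the rest from `z`. A forest arc that leads towards `v` is settled by `through`.
    tree≤ : ∀ m → Light m → (∀ {u v} (p : Walk u v) → arcs p ℕ.≤ m → Unique (vertices p) → comp u ≡ comp v →
                               - e v u ≤ weight p) →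
            ∀ {u y v} (a : Arc u y) (p : Walk y v) → arcs p ℕ.≤ m → Unique (vertices (a ◅ p)) → comp u ≡ comp v →
            - e v u ≤ c a + weight p
    tree≤ m light IH {u} {y} {v} a p p≤m up@(u∉ ∷ sp) u~v with (u , y) ∈? E
    ... | no a∉ =
      linear (e v u ∷ e u z ∷ e v z ∷ weight rest ∷ c a ∷ weight p ∷ [])
        ((#2 ≼ #0 ⊞ #1) ∷ (⊝ #2 ≼ #3) ∷ (#1 ⊞ #3 ≼ #4 ⊞ #5) ∷ []) (⊝ #0 ≼ #4 ⊞ #5) refl
        ( triangle (sym u~v) (sym same) , IH rest (ℕ.≤-trans shorter p≤m) simple (trans same u~v) , bound , tt)
      where open Return (return light a p a∉ p≤m up (sym u~v))
    ... | yes a∈ with Cut.side (cut a∈) v Bool.≟ true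
    ...   | yes v-in =
      linear (e v y ∷ e y u ∷ e u u ∷ e v u ∷ c a ∷ weight p ∷ [])
        ((#0 ⊞ #1 ⊞ #2 ≼ #3) ∷ (𝟘 ≼ #2) ∷ (⊝ #0 ≼ #5) ∷ (⊝ #4 ≼ #1) ∷ []) (⊝ #3 ≼ #4 ⊞ #5) refl
        ( Cut.through (cut a∈) (sameTree a∈) v-in (Cut.tail-out (cut a∈)) , e-0≤
        , IH p p≤m sp (trans (sym (sameTree a∈)) u~v) , ≤-reflexive (≈-sym (e-arc (symmetric a∈) a)) , tt)
    ...   | no v-out with lastIn (λ z → Cut.side (cut a∈) z Bool.≟ true) p
    ...     | never ¬in    = ⊥-elim (All.lookup ¬in (start∈ p) (Cut.head-in (cut a∈)))
    ...     | atEnd v-in   = ⊥-elim (v-out v-in)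
    -- The arc `a` leads away from `v`, so the walk must come back across the cut of `a`. The arc
    -- `b` of its last exit is not in `E`: the only forest arc out enters `u`, where the simple walk
    -- has already been. The detour beginning with `b` thus costs at least `e x z`, and by `through`
    -- this makes up for whatever `q` and `a` have gained.
    ...     | midway (mkSplit {x} {y′} q b r refl) x-in ¬in =
      linear (e x y ∷ e y u ∷ e u z ∷ e x z ∷ e v z ∷ e v u ∷ c a ∷ weight q ∷ c b ∷ weight r ∷ weight rest ∷
              weight (q ◅◅ (b ◅ r)) ∷ [])
        ((#0 ⊞ #1 ⊞ #2 ≼ #3) ∷ (⊝ #0 ≼ #7) ∷ (⊝ #4 ≼ var (# 10)) ∷ (#4 ≼ #5 ⊞ #2) ∷ (⊝ #6 ≼ #1)
          ∷ (#3 ⊞ var (# 10) ≼ #8 ⊞ var (# 9)) ∷ (#7 ⊞ (#8 ⊞ var (# 9)) ≼ var (# 11)) ∷ [])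
        (⊝ #5 ≼ #6 ⊞ var (# 11)) refl
        ( through (trans same x~y) x-in z-out
        , IH q q≤m (simpleˡ q b r sp) (sym x~y)
        , IH rest (ℕ.≤-trans shorter r≤m) simple (trans same (trans x~y y~v))
        , triangle (sym u~v) (trans (sameTree a∈) (trans (sym x~y) (sym same)))
        , ≤-reflexive (≈-sym (e-arc (symmetric a∈) a))
        , bound
        , ≤-reflexive (≈-sym (weight-split q b r)) , tt)
      where
      open Cut (cut a∈)
      x~y : comp x ≡ comp y
      x~y = within x-in
      y~v : comp y ≡ comp v
      y~v = trans (sym (sameTree a∈)) u~v
      q≤m : arcs q ℕ.≤ m
      q≤m = ℕ.≤-trans (subst (arcs q ℕ.≤_) (sym (arcs-◅◅ q (b ◅ r))) (ℕ.m≤m+n _ _)) p≤m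
      r≤m : arcs r ℕ.≤ m
      r≤m = ℕ.≤-trans (subst (arcs r ℕ.≤_) (sym (arcs-◅◅ q (b ◅ r)))
                          (ℕ.≤-trans (ℕ.n≤1+n _) (ℕ.m≤n+m _ (arcs q)))) p≤m
      b∉ : (x , y′) ∉ E
      b∉ b∈ = All.lookup u∉ (∈-after q b r sp (start∈ r))
                (sym (proj₂ (crossing b∈ x-in (notTrue (All.lookup ¬in (start∈ r))))))
      br-simple : Unique (vertices (b ◅ r))
      br-simple = All.tabulate (λ { z∈ refl → simple-disjoint q b r sp (end∈ q) z∈ }) ∷ simpleʳ q b r sp
      open Return (return light b r b∉ r≤m br-simple (trans (sym y~v) (sym x~y)))
      z-out : side z ≡ false
      z-out = notTrue (All.lookup ¬in z∈p)

    -- Mutual induction on the number of arcs: tree walks of at most `suc m` arcs need routes for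
    -- detours of at most `m` arcs, while routes for walks of at most `m` arcs need tree walks of at
    -- most `m` arcs.
    treeLight : ∀ m {u v} (p : Walk u v) → arcs p ℕ.≤ m → Unique (vertices p) → comp u ≡ comp v → - e v u ≤ weight p
    routeLight : ∀ m → Light m

    treeLight m ε _ _ _ = linear (e _ _ ∷ []) ((𝟘 ≼ #0) ∷ []) (⊝ #0 ≼ 𝟘) refl (e-0≤ , tt)
    treeLight (suc m) (a ◅ p) (s≤s p≤m) = tree≤ m (routeLight m) (treeLight m) a p p≤m

    routeLight m {S} {s} {t} p p≤m up S< free with lastIn (λ z → comp z ≟ comp s) p
    ... | never ¬T  = ⊥-elim (All.lookup ¬T (start∈ p) refl)
    ... | atEnd t~s = _ , route-mono (s≤s z≤n) (move {j = 0} t~s (stop (free (end∈ p))))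
      , linear (e t s ∷ weight p ∷ []) ((⊝ #0 ≼ #1) ∷ []) (𝟘 ⊟ #0 ≼ #1) refl (treeLight m p p≤m up (sym t~s) , tt)
    -- Up to its last vertex `b` in the tree of `s` the walk is replaced by a tree path; afterwards
    -- it avoids that tree, as the enlarged set demands.
    ... | midway (mkSplit {b} {y} q a r refl) b~s ¬T = found m p≤m
      where
      qar = arcs-◅◅ q (a ◅ r)
      found : ∀ m → arcs (q ◅◅ (a ◅ r)) ℕ.≤ m →
              ∃ λ w → Route (suc (arcs (q ◅◅ (a ◅ r)))) S s t w × w ≤ weight (q ◅◅ (a ◅ r))
      found m le with subst (ℕ._≤ m) (trans qar (ℕ.+-suc (arcs q) (arcs r))) le
      found (suc m) le | s≤s le′ =
        _ , route-mono (s≤s (subst (suc (arcs r) ℕ.≤_) (sym qar) (ℕ.m≤n+m _ (arcs q))))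
              (move b~s (leave b-free a (proj₁ (proj₂ rest))))
          , linear (e b s ∷ c a ∷ weight q ∷ weight r ∷ weight (q ◅◅ (a ◅ r)) ∷ proj₁ rest ∷ [])
              ((⊝ #0 ≼ #2) ∷ (#5 ≼ #3) ∷ (#2 ⊞ (#1 ⊞ #3) ≼ #4) ∷ []) (#1 ⊞ #5 ⊟ #0 ≼ #4) refl
              ( treeLight (suc m) q (ℕ.≤-trans (ℕ.m≤m+n _ _) (ℕ.≤-trans le′ (ℕ.n≤1+n m))) (simpleˡ q a r up) (sym b~s)
              , proj₂ (proj₂ rest) , ≤-reflexive (≈-sym (weight-split q a r)) , tt)
        where
        b-free : blocked S (comp b) ≡ false
        b-free = free (∈-before q a r up (end∈ q))
        rest : ∃ λ w → Route (suc (arcs r)) (S ℕ.+ bit (comp b)) y t w × w ≤ weight r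
        rest = routeLight m r (ℕ.≤-trans (ℕ.m≤n+m _ (arcs q)) le′) (simpleʳ q a r up) (add-< S< b-free)
          λ z∈ → trans (add-other S< b-free (λ eq → All.lookup ¬T z∈ (trans eq b~s)))
                   (free (∈-after q a r up z∈))

    routeBelow : ∀ {s t} (p : Walk s t) → Unique (vertices p) → ∃ λ w → Route n 0 s t w × w ≤ weight p
    routeBelow p up with routeLight (arcs p) p ℕ.≤-refl up 0<size (λ _ → blocked-0 _)
    ... | w , r , le = w , route-mono (arcs<n p up) r , le

    closing≥0 : ∀ {s x} (p : Walk s x) → Unique (vertices p) → (a : Arc x s) → (x , s) ∉ E → 0# ≤ c a + weight p
    closing≥0 p up a a∉ with routeBelow p up
    ... | w , r , le = linear (w ∷ c a ∷ weight p ∷ []) ((𝟘 ≼ #0 ⊞ #1) ∷ (#0 ≼ #2) ∷ []) (𝟘 ≼ #1 ⊞ #2) refl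
      (check a (λ ne → a∉ (allNegative ne)) r , le , tt)

    closedWalk : ∀ {v} (p : Walk v v) → Unique (vertices p) → arcs p ≡ 0
    closedWalk ε       _        = refl
    closedWalk (a ◅ p) (v∉ ∷ _) = ⊥-elim (All.lookup v∉ (end∈ p) refl)

    -- A cycle that uses an edge of the forest leaves the cut of that
    -- edge through some other arc, which is not in the forest.
    nearlyConservative : NearlyConservative c
    nearlyConservative record { start = s ; end = x ; path = record { walk = p ; simple = up } ; closing = a } neg
      with (x , s) ∈? E
    ... | no a∉ = ⊥-elim (<⇒≱ neg (closing≥0 p up a a∉))
    ... | yes a∈ with lastIn (λ z → Cut.side (cut (symmetric a∈)) z Bool.≟ false) p
    ...   | never ¬out   = ⊥-elim (All.lookup ¬out (start∈ p) (Cut.tail-out (cut (symmetric a∈))))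
    ...   | atEnd x-out  with () ← trans (sym x-out) (Cut.head-in (cut (symmetric a∈)))
    ...   | midway (mkSplit {g} {h} q b r refl) g-out ¬out with (g , h) ∈? E
    -- The cycle is rotated so that `b`, which lies outside the forest, becomes its closing arc.
    ...     | no b∉ = ⊥-elim (<⇒≱ neg (linear (c a ∷ c b ∷ weight q ∷ weight r ∷ weight (q ◅◅ (b ◅ r)) ∷ weight (r ◅◅ (a ◅ q)) ∷ [])
        ((𝟘 ≼ #1 ⊞ #5) ∷ (#5 ≼ #3 ⊞ (#0 ⊞ #2)) ∷ (#2 ⊞ (#1 ⊞ #3) ≼ #4) ∷ []) (𝟘 ≼ #0 ⊞ #4) refl
        ( closing≥0 (r ◅◅ (a ◅ q))
            (simple-◅◅ r a q (simpleʳ q b r up) (simpleˡ q b r up) (λ z∈r z∈q → simple-disjoint q b r up z∈q z∈r)) b b∉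
        , ≤-reflexive (weight-split r a q) , ≤-reflexive (≈-sym (weight-split q b r)) , tt)))
    ...     | yes b∈ with Cut.crossing (cut (symmetric a∈)) (symmetric b∈) (Bool.¬-not (All.lookup ¬out (start∈ r))) g-out
    -- The only forest edge across the cut is that of `a`, so `b` runs from `s` back to `x`. Then
    -- `q` and `r` are closed simple walks, hence empty, and the cycle has two arcs.
    ...       | refl , refl = s≤s (ℕ.≤-reflexive (trans (arcs-◅◅ q (b ◅ r))
        (trans (cong (ℕ._+ suc (arcs r)) (closedWalk q (simpleˡ q b r up)))
               (cong suc (closedWalk r (simpleʳ q b r up))))))

-- Soundness: finite table entries bound the weights of simple paths

module Soundness
  (ℝ : RealNumbers) {n : ℕ} (D : Digraph n) (c : Weighted.WeightFunction ℝ D)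
  {E : Weights.Edges ℝ D c} {comp : Fin n → Fin n} {e : Fin n → Fin n → RealNumbers.Carrier ℝ}
  (F : Weights.Forest ℝ D c E comp e)
  {nontrivial : Fin n → Bool}
  (negative⇒nontrivial : ∀ {u v} → Weighted.NegativeEdge ℝ D c u v → nontrivial (comp u) ≡ true)
  (enc : Encoding n nontrivial)
  where
  open RealNumbers ℝ
  open LinearArithmetic ℝ
  open Digraph D
  open Weighted ℝ D
  open WalkLemmas D
  open Weights ℝ D c
  open Weights.Forest F
  open Encoding enc
  open DecMembership (_≟_ {n}) using (_∈?_)

  -- Only vertices of trees that can be forbidden are kept from recurring; other repetitions are cut
  -- out by `shorten`.
  Good : ∀ {u v} → Walk u v → Set
  Good         ε       = ⊤
  Good {u = u} (a ◅ p) = (nontrivial (comp u) ≡ true → u ∉ vertices p) × Good p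

  record GoodWalk (S : ℕ) (s t : Fin n) (d : Carrier) : Set where
    constructor goodWalk
    field
      walk  : Walk s t
      good  : Good walk
      free  : ∀ {z} → z ∈ vertices walk → blocked S (comp z) ≡ false
      light : weight walk ≤ d

  record GoodExit (S : ℕ) (s t : Fin n) (d : Carrier) : Set where
    constructor goodExit
    field
      walk   : Walk s t
      good   : Good walk
      free   : ∀ {z} → z ∈ vertices walk → blocked S (comp z) ≡ false
      -- Ensures that a path of a nontrivial tree put in front by `goodMove` meets the walk only in
      -- `s`.
      leaves : nontrivial (comp s) ≡ true → ∀ {z} → z ∈ vertices walk → z ≡ s ⊎ comp z ≢ comp s
      light  : weight walk ≤ d

  goodStop : ∀ {S t d} → blocked S (comp t) ≡ false → 0# ≤ d → GoodExit S t t d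
  goodStop b 0≤d = goodExit ε tt (λ { (here refl) → b }) (λ { _ (here eq) → inj₁ eq }) 0≤d

  goodLeave : ∀ {S b y t w d} → S ℕ.< size → blocked S (comp b) ≡ false → (a : Arc b y) →
              GoodWalk (S ℕ.+ bit (comp b)) y t w → c a + w ≤ d → GoodExit S b t d
  goodLeave {S} {b} {w = w} {d} S< b-free a (goodWalk p good free light) le =
    goodExit (a ◅ p) ((λ nt b∈ → elsewhere nt b∈ refl) , good)
      (λ { (here refl) → b-free ; (there z∈) → free′ (free z∈) })
      (λ { nt (here eq) → inj₁ eq ; nt (there z∈) → inj₂ (elsewhere nt z∈) })
      (linear (c a ∷ weight p ∷ w ∷ d ∷ []) ((#1 ≼ #2) ∷ (#0 ⊞ #2 ≼ #3) ∷ []) (#0 ⊞ #1 ≼ #3) refl (light , le , tt))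
    where
    elsewhere : nontrivial (comp b) ≡ true → ∀ {z} → z ∈ vertices p → comp z ≢ comp b
    elsewhere nt z∈ eq with () ← trans (sym (add-self S< b-free nt)) (subst (λ r → blocked (S ℕ.+ bit (comp b)) r ≡ false) eq (free z∈))
    free′ : ∀ {r} → blocked (S ℕ.+ bit (comp b)) r ≡ false → blocked S r ≡ false
    free′ {r} f with r ≟ comp b
    ... | yes refl = b-free
    ... | no r≢    = trans (sym (add-other S< b-free r≢)) f

  goodMove : ∀ {S s b t w d} → comp b ≡ comp s → GoodExit S b t w → w - e b s ≤ d → GoodWalk S s t d
  goodMove {S} {s} {b} {w = w} {d} b~s (goodExit q good free leaves light) le =
    goodWalk (p ◅◅ q) (good-◅◅ p (Path.simple path) (λ z∈ → trans (inside z∈) (sym b~s)))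
      (λ z∈ → free′ (∈-◅◅⁻ p q z∈))
      (≤-trans (≤-reflexive (weight-◅◅ p q))
        (linear (weight p ∷ weight q ∷ w ∷ e b s ∷ d ∷ []) ((#0 ≼ ⊝ #3) ∷ (#1 ≼ #2) ∷ (#2 ⊟ #3 ≼ #4) ∷ [])
          (#0 ⊞ #1 ≼ #4) refl (light′ , light , le , tt)))
    where
    open TreePath (treePath (sym b~s)) renaming (light to light′)
    p = Path.walk path
    free′ : ∀ {z} → z ∈ vertices p ⊎ z ∈ vertices q → blocked S (comp z) ≡ false
    free′ (inj₁ z∈) = subst (λ r → blocked S r ≡ false) (trans b~s (sym (inside z∈))) (free (start∈ q))
    free′ (inj₂ z∈) = free z∈
    good-◅◅ : ∀ {x} (p : Walk x b) → Unique (vertices p) → (∀ {z} → z ∈ vertices p → comp z ≡ comp b) → Good (p ◅◅ q)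
    good-◅◅ ε       _         _  = good
    good-◅◅ (a ◅ p) (x∉ ∷ up) ~b = (λ nt x∈ → fresh nt (∈-◅◅⁻ p q x∈)) , good-◅◅ p up (λ z∈ → ~b (there z∈))
      where
      fresh : nontrivial (comp _) ≡ true → ¬ (_ ∈ vertices p ⊎ _ ∈ vertices q)
      fresh nt (inj₁ x∈) = All.lookup x∉ x∈ refl
      fresh nt (inj₂ x∈) with leaves (subst (λ r → nontrivial r ≡ true) (~b (here refl)) nt) x∈
      ... | inj₁ refl = All.lookup x∉ (end∈ p) refl
      ... | inj₂ x≁b  = x≁b (~b (here refl))

  module _ (nc : NearlyConservative c) where

    closing≥0 : ∀ {s x} (q : Walk s x) → Unique (vertices q) → (a : Arc x s) → ¬ NegativeEdge c x s → 0# ≤ c a + weight q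
    closing≥0 ε           _ a _   = ⊥-elim (noLoops a)
    closing≥0 (b ◅ ε)     _ a ¬ne = linear (c a ∷ c b ∷ []) ((𝟘 ≼ #0 ⊞ #1) ∷ []) (𝟘 ≼ #0 ⊞ (#1 ⊞ 𝟘)) refl
                                      (≮⇒≥ (λ neg → ¬ne (a , b , neg)) , tt)
    closing≥0 q@(_ ◅ _ ◅ _) u a _ = longCycle≥0 nc (record { walk = q ; simple = u }) a λ { (s≤s ()) }

    record Shortened {u v} (p : Walk u v) : Set where
      constructor shortened
      field
        walk   : Walk u v
        simple : Unique (vertices walk)
        light  : weight walk ≤ weight p
        ⊆p     : ∀ {z} → z ∈ vertices walk → z ∈ vertices p

    -- Repetitions are removed from the back, so that the rest is already simple. If `u` recurs, it
    -- is on no negative edge; the closed walk to be dropped is then a nonnegative cycle, by near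
    -- conservativity if it has more than two arcs, and because its arcs form no negative edge if it
    -- has two.
    shorten : ∀ {u v} (p : Walk u v) → Good p → Shortened p
    shorten ε _ = shortened ε ([] ∷ []) ≤-refl (λ z∈ → z∈)
    shorten {u} (a ◅ p) (fresh , good) with shorten p good
    ... | shortened q uq q≤p q⊆p with u ∈? vertices q
    ...   | no u∉ = shortened (a ◅ q) (∉⇒All≢ u∉ ∷ uq) (+-monoʳ-≤ (c a) q≤p)
                      (λ { (here eq) → here eq ; (there z∈) → there (q⊆p z∈) })
    ...   | yes u∈ with suffixFrom q uq u∈
    ...     | q₁ , r , refl , u₁ , ur , _ , r⊆q = shortened r ur
      (linear (c a ∷ weight p ∷ weight q₁ ∷ weight r ∷ weight (q₁ ◅◅ r) ∷ [])
        ((𝟘 ≼ #0 ⊞ #2) ∷ (#4 ≼ #1) ∷ (#2 ⊞ #3 ≼ #4) ∷ []) (#3 ≼ #0 ⊞ #1) refl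
        ( closing≥0 q₁ u₁ a (λ ne → fresh (negative⇒nontrivial ne) (q⊆p u∈)) , q≤p
        , ≤-reflexive (≈-sym (weight-◅◅ q₁ r)) , tt))
      (λ z∈ → there (q⊆p (r⊆q z∈)))

    soundPath : ∀ {S s t d} → GoodWalk S s t d → ∃ λ (p : Path s t) → pathWeight c p ≤ d
    soundPath (goodWalk p good _ light) = let open Shortened (shorten p good) renaming (light to lighter) in
      record { walk = walk ; simple = simple } , ≤-trans lighter light

    -- Used contrapositively: an arc that fails the check refutes near conservativity.
    soundCheck : ∀ {S s x d} → GoodWalk S s x d → (a : Arc x s) → ¬ NegativeEdge c x s → 0# ≤ d + c a
    soundCheck {d = d} g a ¬ne with soundPath g
    ... | p , p≤d = linear (c a ∷ d ∷ pathWeight c p ∷ []) ((𝟘 ≼ #0 ⊞ #2) ∷ (#2 ≼ #1) ∷ []) (𝟘 ≼ #1 ⊞ #0) refl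
      (closing≥0 (Path.walk p) (Path.simple p) a ¬ne , p≤d , tt)

-- Numbering the sets of trees

T⇒≡ : ∀ {b} → T b → b ≡ true
T⇒≡ {true} _ = refl

¬T⇒≡ : ∀ {b} → ¬ T b → b ≡ false
¬T⇒≡ {true}  ¬t = ⊥-elim (¬t tt)
¬T⇒≡ {false} _  = refl

≡⇒T : ∀ {b} → b ≡ true → T b
≡⇒T refl = tt

≤ᵇ-true : ∀ {m n} → m ℕ.≤ n → (m ≤ᵇ n) ≡ true
≤ᵇ-true m≤n = T⇒≡ (ℕ.≤⇒≤ᵇ m≤n)

≤ᵇ-false : ∀ {m n} → n ℕ.< m → (m ≤ᵇ n) ≡ false
≤ᵇ-false {m} {n} n<m = ¬T⇒≡ λ t → ℕ.<⇒≱ n<m (ℕ.≤ᵇ⇒≤ m n t)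

≤ᵇ-true⁻ : ∀ {m n} → (m ≤ᵇ n) ≡ true → m ℕ.≤ n
≤ᵇ-true⁻ {m} {n} eq = ℕ.≤ᵇ⇒≤ m n (≡⇒T eq)

≤ᵇ-false⁻ : ∀ {m n} → (m ≤ᵇ n) ≡ false → n ℕ.< m
≤ᵇ-false⁻ {m} {n} eq = ℕ.≰⇒> λ m≤n → case (trans (sym (≤ᵇ-true m≤n)) eq)
  where
  case : ¬ true ≡ false
  case ()

≡ᵇ-refl : ∀ m → (m ≡ᵇ m) ≡ true
≡ᵇ-refl m = T⇒≡ (ℕ.≡⇒≡ᵇ m m refl)

≡ᵇ-false : ∀ {m n} → m ≢ n → (m ≡ᵇ n) ≡ false
≡ᵇ-false {m} {n} m≢n = ¬T⇒≡ λ t → m≢n (ℕ.≡ᵇ⇒≡ m n t)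

-- Binary notation in which label r has a digit, of weight bit r, only
-- if it is selected.
module Binary (selected : ℕ → Bool) where

  total : ℕ → ℕ
  bit   : ℕ → ℕ
  total zero    = 1
  total (suc m) = total m ℕ.+ bit m
  bit m = if selected m then total m else 0

  -- The first test excludes unselected labels, whose `bit m` is 0 and thus at most every `v`. The
  -- formula mirrors the guard of `decodeBody`.
  digit : ℕ → ℕ → Bool
  digit m v = (1 ≤ᵇ bit m) ∧ (bit m ≤ᵇ v)

  remainder : ℕ → ℕ → ℕ
  remainder m v = if digit m v then v ∸ bit m else v

  digits : ℕ → ℕ → ℕ → Bool
  digits zero    v r = false
  digits (suc m) v r = if r ≡ᵇ m then digit m v else digits m (remainder m v) r

  total-positive : ∀ m → 1 ℕ.≤ total m
  total-positive zero    = s≤s z≤n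
  total-positive (suc m) = ℕ.≤-trans (total-positive m) (ℕ.m≤m+n _ _)

  bit-selected : ∀ {m} → selected m ≡ true → bit m ≡ total m
  bit-selected eq rewrite eq = refl

  bit-unselected : ∀ {m} → selected m ≡ false → bit m ≡ 0
  bit-unselected eq rewrite eq = refl

  digit-true : ∀ {m v} → selected m ≡ true → bit m ℕ.≤ v → digit m v ≡ true
  digit-true {m} sel le
    rewrite ≤ᵇ-true le | Bool.∧-identityʳ (1 ≤ᵇ bit m) | bit-selected sel = ≤ᵇ-true (total-positive m)

  digit-true⁻ : ∀ {m v} → digit m v ≡ true → selected m ≡ true × bit m ℕ.≤ v
  digit-true⁻ {m} {v} eq with selected m
  ... | true with total m ≤ᵇ v in le
  ...   | true  = refl , ≤ᵇ-true⁻ le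
  ...   | false with () ← trans (sym eq) (Bool.∧-zeroʳ (1 ≤ᵇ total m))

  digit-false : ∀ {m v} → v ℕ.< total m → digit m v ≡ false
  digit-false {m} {v} lt with selected m
  ... | false = refl
  ... | true  = trans (cong ((1 ≤ᵇ total m) ∧_) (≤ᵇ-false lt)) (Bool.∧-zeroʳ _)

  digit-false⁻ : ∀ {m v} → digit m v ≡ false → v ℕ.< total (suc m) → v ℕ.< total m
  digit-false⁻ {m} {v} eq lt with selected m in sel
  ... | false = subst (v ℕ.<_) (ℕ.+-identityʳ (total m)) lt
  ... | true with total m ℕ.≤? v
  ...   | no  ¬le = ℕ.≰⇒> ¬le
  ...   | yes le with () ← trans (sym eq) (trans (cong (_∧ (total m ≤ᵇ v)) (≤ᵇ-true (total-positive m))) (≤ᵇ-true le))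

  remainder-true : ∀ {m v} → digit m v ≡ true → remainder m v ≡ v ∸ bit m
  remainder-true eq rewrite eq = refl

  remainder-false : ∀ {m v} → digit m v ≡ false → remainder m v ≡ v
  remainder-false eq rewrite eq = refl

  digits-here : ∀ m v → digits (suc m) v m ≡ digit m v
  digits-here m v rewrite ≡ᵇ-refl m = refl

  digits-below : ∀ {m r} v → r ≢ m → digits (suc m) v r ≡ digits m (remainder m v) r
  digits-below {m} {r} v r≢m rewrite ≡ᵇ-false r≢m = refl

  digits-0 : ∀ m r → digits m 0 r ≡ false
  digits-0 zero    r = refl
  digits-0 (suc m) r with r ≡ᵇ m
  ... | true  = digit-false {m} (total-positive m)
  ... | false rewrite remainder-false {m} {0} (digit-false {m} (total-positive m)) = digits-0 m r

  digits≡ : ∀ m {v v′ r} → v ≡ v′ → digits m v r ≡ digits m v′ r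
  digits≡ m refl = refl

  digits-cong : ∀ {m v v′ r} → digit m v ≡ digit m v′ → digits m (remainder m v) r ≡ digits m (remainder m v′) r →
                digits (suc m) v r ≡ digits (suc m) v′ r
  digits-cong {m} {r = r} top below with r ≡ᵇ m
  ... | true  = top
  ... | false = below

  record Added (m v r : ℕ) : Set where
    field
      bounded : v ℕ.+ bit r ℕ.< total m
      others  : ∀ {r′} → r′ ≢ r → digits m (v ℕ.+ bit r) r′ ≡ digits m v r′
      itself  : digits m (v ℕ.+ bit r) r ≡ true

  -- Digits are read greedily from the top. Setting a digit that was 0 causes no carry: the part of
  -- the number below place `m` stays under `total m`, so the digit at `m` is unaffected.
  added : ∀ m {v r} → selected r ≡ true → v ℕ.< total m → r ℕ.< m → digits m v r ≡ false → Added m v r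
  added (suc m) {v} {r} sel v< r< unset with r ℕ.≟ m
  ... | yes refl = record
    { bounded = ℕ.+-monoˡ-< (bit m) v<m
    ; others  = λ {r′} r′≢m → trans (digits-below {m} (v ℕ.+ bit m) r′≢m)
        (trans (cong (λ w → digits m w r′) (trans (remainder-true top) (ℕ.m+n∸n≡m v (bit m))))
        (sym (trans (digits-below {m} v r′≢m) (cong (λ w → digits m w r′) (remainder-false {m} d)))))
    ; itself  = trans (digits-here m _) top }
    where
    d : digit m v ≡ false
    d = trans (sym (digits-here m v)) unset
    v<m : v ℕ.< total m
    v<m = digit-false⁻ {m} d v<
    top : digit m (v ℕ.+ bit m) ≡ true
    top = digit-true {m} sel (ℕ.m≤n+m (bit m) v)
  ... | no r≢m with Bool.T? (digit m v)
  ...   | no ¬d = record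
    { bounded = ℕ.≤-trans bounded (ℕ.m≤m+n _ _)
    ; others  = λ r′≢r → digits-cong {m} (trans d′ (sym d))
        (trans (digits≡ m (remainder-false {m} d′)) (trans (others r′≢r) (sym (digits≡ m (remainder-false {m} d)))))
    ; itself  = trans (digits-below {m} _ r≢m) (trans (digits≡ m (remainder-false {m} d′)) itself) }
    where
    d : digit m v ≡ false
    d = ¬T⇒≡ ¬d
    open Added (added m sel (digit-false⁻ {m} d v<) (ℕ.≤∧≢⇒< (ℕ.≤-pred r<) r≢m)
                 (trans (sym (trans (digits-below {m} v r≢m) (digits≡ m (remainder-false {m} d)))) unset))
    d′ : digit m (v ℕ.+ bit r) ≡ false
    d′ = digit-false {m} bounded
  ...   | yes t = record
    { bounded = subst (ℕ._< total (suc m)) (sym shift) (ℕ.+-monoˡ-< (bit m) bounded)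
    ; others  = λ r′≢r → digits-cong {m} (trans d′ (sym d))
        (trans (digits≡ m rem′) (trans (others r′≢r) (sym (digits≡ m (remainder-true {m} d)))))
    ; itself  = trans (digits-below {m} _ r≢m) (trans (digits≡ m rem′) itself) }
    where
    d : digit m v ≡ true
    d = T⇒≡ t
    m≤v : bit m ℕ.≤ v
    m≤v = proj₂ (digit-true⁻ {m} d)
    q< : v ∸ bit m ℕ.< total m
    q< = ℕ.+-cancelʳ-< (bit m) _ _ (subst (ℕ._< total (suc m)) (sym (ℕ.m∸n+n≡m m≤v)) v<)
    open Added (added m sel q< (ℕ.≤∧≢⇒< (ℕ.≤-pred r<) r≢m)
                 (trans (sym (trans (digits-below {m} v r≢m) (digits≡ m (remainder-true {m} d)))) unset))
    shift : v ℕ.+ bit r ≡ v ∸ bit m ℕ.+ bit r ℕ.+ bit m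
    shift = trans (cong (ℕ._+ bit r) (sym (ℕ.m∸n+n≡m m≤v)))
              (trans (ℕ.+-assoc (v ∸ bit m) (bit m) (bit r))
              (trans (cong (v ∸ bit m ℕ.+_) (ℕ.+-comm (bit m) (bit r))) (sym (ℕ.+-assoc (v ∸ bit m) (bit r) (bit m)))))
    d′ : digit m (v ℕ.+ bit r) ≡ true
    d′ = digit-true {m} (proj₁ (digit-true⁻ {m} d)) (ℕ.≤-trans m≤v (ℕ.m≤m+n v (bit r)))
    rem′ : remainder m (v ℕ.+ bit r) ≡ v ∸ bit m ℕ.+ bit r
    rem′ = trans (remainder-true {m} d′) (trans (cong (_∸ bit m) shift) (ℕ.m+n∸n≡m _ (bit m)))

  encoding : ∀ n → Encoding n (λ r → selected (toℕ r))
  encoding n = record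
    { size        = total n
    ; bit         = λ r → bit (toℕ r)
    ; blocked     = λ S r → digits n S (toℕ r)
    ; 0<size      = total-positive n
    ; blocked-0   = λ r → digits-0 n (toℕ r)
    ; add-<       = λ {S} {r} S< free → add-<′ r S< free (Bool.T? (selected (toℕ r)))
    ; add-other   = λ {S} {r} S< free r′≢r → add-other′ r S< free (λ eq → r′≢r (toℕ-injective eq)) (Bool.T? (selected (toℕ r)))
    ; add-self    = λ {S} {r} S< free sel → Added.itself (added n sel S< (toℕ<n r) free)
    }
    where
    unchanged : ∀ {S r} → ¬ T (selected r) → S ℕ.+ bit r ≡ S
    unchanged {S} {r} ¬sel = trans (cong (S ℕ.+_) (bit-unselected {r} (¬T⇒≡ ¬sel))) (ℕ.+-identityʳ S)
    add-<′ : ∀ {S} (r : Fin n) → S ℕ.< total n → digits n S (toℕ r) ≡ false → Dec (T (selected (toℕ r))) → S ℕ.+ bit (toℕ r) ℕ.< total n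
    add-<′ r S< free (yes sel) = Added.bounded (added n (T⇒≡ sel) S< (toℕ<n r) free)
    add-<′ r S< free (no ¬sel) = subst (ℕ._< total n) (sym (unchanged {r = toℕ r} ¬sel)) S<
    add-other′ : ∀ {S r′} (r : Fin n) → S ℕ.< total n → digits n S (toℕ r) ≡ false → r′ ≢ toℕ r → Dec (T (selected (toℕ r))) →
                 digits n (S ℕ.+ bit (toℕ r)) r′ ≡ digits n S r′
    add-other′ r S< free r′≢r (yes sel) = Added.others (added n (T⇒≡ sel) S< (toℕ<n r) free) r′≢r
    add-other′ r S< free r′≢r (no ¬sel) = cong (λ S → digits n S _) (unchanged {r = toℕ r} ¬sel)

-- There are at most `2 ^ k₀` sets of trees

module Counting
  (ℝ : RealNumbers) {n : ℕ} (D : Digraph n) (c : Weighted.WeightFunction ℝ D) (comp : Fin n → Fin n)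
  (sameTree : ∀ {u v} → Weighted.NegativeEdge ℝ D c u v → comp u ≡ comp v)
  (selected : ℕ → Bool)
  (witness : ∀ r → selected (toℕ r) ≡ true → ∃ λ v → comp v ≡ r × ∃ (Weighted.NegativeEdge ℝ D c v))
  where
  open Weighted ℝ D
  open Binary selected

  connected : ∀ {u v} → EqClosure.EqClosure (NegativeEdge c) u v → comp u ≡ comp v
  connected = EqClosure.gfold isEquivalence comp sameTree

  module _ {k} (trees : HasNegativeTrees c k) where
    open Inverse trees

    label : Fin k → ℕ
    label i = toℕ (comp (proj₁ (to i)))

    record Listed (m : ℕ) : Set where
      field
        list   : List (Fin k)
        unique : Unique list
        power  : total m ≡ 2 ℕ.^ length list
        below  : ∀ {i} → i ∈ list → label i ℕ.< m

    -- A selected label is the label of some index of the given enumeration, namely of the tree of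
    -- its witness. Labels grow along the construction, so the indices are distinct, and `total`
    -- doubles once for each of them.
    listed : ∀ m → m ℕ.≤ n → Listed m
    listed zero    _  = record { list = [] ; unique = [] ; power = refl ; below = λ () }
    listed (suc m) m< with Bool.T? (selected m)
    ... | no ¬sel = record
      { list = list ; unique = unique ; below = λ i∈ → ℕ.m≤n⇒m≤1+n (below i∈)
      ; power = trans (trans (cong (total m ℕ.+_) (bit-unselected {m} (¬T⇒≡ ¬sel))) (ℕ.+-identityʳ _)) power }
      where open Listed (listed m (ℕ.<⇒≤ m<))
    ... | yes sel = record
      { list   = i ∷ list
      ; unique = ∉⇒All≢ (λ i∈ → ℕ.<-irrefl label≡ (below i∈)) ∷ unique
      ; power  = trans (cong (total m ℕ.+_) (bit-selected {m} (T⇒≡ sel)))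
                   (trans (cong (λ t → t ℕ.+ t) power) (cong (2 ℕ.^ length list ℕ.+_) (sym (ℕ.+-identityʳ _))))
      ; below  = λ { (here refl) → ℕ.≤-reflexive (cong suc label≡) ; (there i∈) → ℕ.m≤n⇒m≤1+n (below i∈) } }
      where
      open Listed (listed m (ℕ.<⇒≤ m<))
      r = fromℕ< m<
      w = witness r (trans (cong selected (toℕ-fromℕ< m<)) (T⇒≡ sel))
      i = from (proj₁ w , proj₂ (proj₂ w))
      label≡ : label i ≡ m
      label≡ = trans (cong toℕ (trans (connected (strictlyInverseˡ (proj₁ w , proj₂ (proj₂ w)))) (proj₁ (proj₂ w)))) (toℕ-fromℕ< m<)

    total≤ : total n ℕ.≤ 2 ℕ.^ k
    total≤ = subst (ℕ._≤ 2 ℕ.^ k) (sym power) (ℕ.^-monoʳ-≤ 2 (unique⇒length≤ unique))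
      where open Listed (listed n ℕ.≤-refl)

-- A program logic with running times

select-same : ∀ {A : Set} i {x y : A} → (if i ≡ᵇ i then x else y) ≡ x
select-same i rewrite ≡ᵇ-refl i = refl

select-other : ∀ {A : Set} {i j} {x y : A} → i ≢ j → (if i ≡ᵇ j then x else y) ≡ y
select-other i≢j rewrite ≡ᵇ-false i≢j = refl

-- Bounds the time of a program whose loops are run once; running times
-- are multiples of it.
cost : Program → ℕ
cost skip         = 1
cost (setℕ a i e) = 1 ℕ.+ natCost i ℕ.+ natCost e
cost (setℝ a i e) = 1 ℕ.+ natCost i ℕ.+ realCost e
cost (p ⨾ q)      = cost p ℕ.+ cost q
cost (ifᵖ b p q)  = 1 ℕ.+ boolCost b ℕ.+ (cost p ℕ.+ cost q)
cost (while b p)  = (1 ℕ.+ boolCost b) ℕ.+ (1 ℕ.+ boolCost b) ℕ.+ cost p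

writesℕ : Program → ℕ → Bool
writesℕ skip         x = false
writesℕ (setℕ a i e) x = a ≡ᵇ x
writesℕ (setℝ a i e) x = false
writesℕ (p ⨾ q)      x = writesℕ p x ∨ writesℕ q x
writesℕ (ifᵖ b p q)  x = writesℕ p x ∨ writesℕ q x
writesℕ (while b p)  x = writesℕ p x

writesℝ : Program → ℕ → Bool
writesℝ skip         x = false
writesℝ (setℕ a i e) x = false
writesℝ (setℝ a i e) x = a ≡ᵇ x
writesℝ (p ⨾ q)      x = writesℝ p x ∨ writesℝ q x
writesℝ (ifᵖ b p q)  x = writesℝ p x ∨ writesℝ q x
writesℝ (while b p)  x = writesℝ p x

scalar : ℕ → NatExp
scalar a = getℕ a (lit 0)

for : ℕ → ℕ → Program → Program
for i b p = setℕ i (lit 0) (lit 0) ⨾ while ((lit 1 ⊕ scalar i) ≤ⁿ scalar b) (p ⨾ setℕ i (lit 0) (scalar i ⊕ lit 1))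

∨-falseˡ : ∀ {a b} → a ∨ b ≡ false → a ≡ false
∨-falseˡ {false} _ = refl

∨-falseʳ : ∀ {a b} → a ∨ b ≡ false → b ≡ false
∨-falseʳ {false} eq = eq

module ProgramLogic (ℝ : RealNumbers) where
  open RealNumbers ℝ using (Carrier)
  open Machine ℝ

  -- The frame rule. `writesℕ` and `writesℝ` compute on concrete programs, so its side conditions
  -- are proved by `refl`.
  record Agree (p : Program) (σ τ : State) : Set where
    constructor agree
    field
      nat  : ∀ a → writesℕ p a ≡ false → ∀ i → natMem τ a i ≡ natMem σ a i
      real : ∀ a → writesℝ p a ≡ false → ∀ i → realMem τ a i ≡ realMem σ a i

  agree-refl : ∀ {p σ} → Agree p σ σ
  agree-refl = agree (λ _ _ _ → refl) (λ _ _ _ → refl)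

  agree-trans : ∀ {p σ τ υ} → Agree p σ τ → Agree p τ υ → Agree p σ υ
  agree-trans (agree n r) (agree n′ r′) =
    agree (λ a w i → trans (n′ a w i) (n a w i)) (λ a w i → trans (r′ a w i) (r a w i))

  agree-seqˡ : ∀ {p q σ τ} → Agree p σ τ → Agree (p ⨾ q) σ τ
  agree-seqˡ (agree n r) = agree (λ a w → n a (∨-falseˡ w)) (λ a w → r a (∨-falseˡ w))

  agree-seqʳ : ∀ {p q σ τ} → Agree q σ τ → Agree (p ⨾ q) σ τ
  agree-seqʳ {p} (agree n r) =
    agree (λ a w → n a (∨-falseʳ {writesℕ p a} w)) (λ a w → r a (∨-falseʳ {writesℝ p a} w))

  agree-loop : ∀ {p b σ τ} → Agree p σ τ → Agree (while b p) σ τ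
  agree-loop (agree n r) = agree n r

  agree-run : ∀ {p σ t τ} → p , σ ⇓[ t ] τ → Agree p σ τ
  agree-run ⇓skip = agree-refl
  agree-run (⇓setℕ {a} {i} {e} {σ}) =
    agree (λ b w j → cong (λ t → if t ∧ (evalℕ i σ ≡ᵇ j) then evalℕ e σ else natMem σ b j) w) (λ _ _ _ → refl)
  agree-run (⇓setℝ {a} {i} {e} {σ}) =
    agree (λ _ _ _ → refl) (λ b w j → cong (λ t → if t ∧ (evalℕ i σ ≡ᵇ j) then evalℝ e σ else realMem σ b j) w)
  agree-run (⇓seq r s) = agree-trans (agree-seqˡ (agree-run r)) (agree-seqʳ (agree-run s))
  agree-run (⇓if-true {p = p} {q} _ r) with agree-run r
  ... | agree n r = agree (λ a w → n a (∨-falseˡ w)) (λ a w → r a (∨-falseˡ w))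
  agree-run (⇓if-false {p = p} {q} _ r) with agree-run r
  ... | agree n r = agree (λ a w → n a (∨-falseʳ {writesℕ p a} w)) (λ a w → r a (∨-falseʳ {writesℝ p a} w))
  agree-run (⇓while-true {b} {p} _ r s) with agree-run r | agree-run s
  ... | agree n r | agree n′ r′ = agree (λ a w i → trans (n′ a w i) (n a w i)) (λ a w i → trans (r′ a w i) (r a w i))
  agree-run (⇓while-false _) = agree-refl

  -- Time is bounded by a multiple `X` of the static `cost`. Sequencing and branching keep `X`, and
  -- only loops multiply it, so all constants are collected in `cost apsp`.
  record Exec (p : Program) (σ : State) (X : ℕ) (Q : State → Set) : Set where
    constructor exec
    field
      {steps} : ℕ
      {final} : State
      run     : p , σ ⇓[ steps ] final
      time    : steps ℕ.≤ cost p ℕ.* X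
      post    : Q final

  module _ {X : ℕ} where

    scale : ∀ k → 1 ℕ.≤ X → k ℕ.≤ k ℕ.* X
    scale k 1≤X = subst (ℕ._≤ k ℕ.* X) (ℕ.*-identityʳ k) (ℕ.*-monoʳ-≤ k 1≤X)

    skipE : ∀ {σ Q} → 1 ℕ.≤ X → Q σ → Exec skip σ X Q
    skipE 1≤X q = exec ⇓skip (scale 1 1≤X) q

    setℕE : ∀ {a i e σ Q} → 1 ℕ.≤ X → Q (writeℕ a (evalℕ i σ) (evalℕ e σ) σ) → Exec (setℕ a i e) σ X Q
    setℕE {a} {i} {e} 1≤X q = exec ⇓setℕ (scale (cost (setℕ a i e)) 1≤X) q

    setℝE : ∀ {a i e σ Q} → 1 ℕ.≤ X → Q (writeℝ a (evalℕ i σ) (evalℝ e σ) σ) → Exec (setℝ a i e) σ X Q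
    setℝE {a} {i} {e} 1≤X q = exec ⇓setℝ (scale (cost (setℝ a i e)) 1≤X) q

    seqE : ∀ {p q σ Q R} → Exec p σ X Q → (∀ τ → Agree p σ τ → Q τ → Exec q τ X R) → Exec (p ⨾ q) σ X R
    seqE {p} {q} (exec r t≤ post) next with next _ (agree-run r) post
    ... | exec s u≤ post′ = exec (⇓seq r s)
      (ℕ.≤-trans (ℕ.+-mono-≤ t≤ u≤) (ℕ.≤-reflexive (sym (ℕ.*-distribʳ-+ X (cost p) (cost q))))) post′

    setℕ⨾ : ∀ {a i e q σ R} → 1 ℕ.≤ X → Exec q (writeℕ a (evalℕ i σ) (evalℕ e σ) σ) X R → Exec (setℕ a i e ⨾ q) σ X R
    setℕ⨾ {a} {i} {e} {σ = σ} 1≤X x = seqE (setℕE {Q = _≡ writeℕ a (evalℕ i σ) (evalℕ e σ) σ} 1≤X refl) λ { _ _ refl → x }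

    setℝ⨾ : ∀ {a i e q σ R} → 1 ℕ.≤ X → Exec q (writeℝ a (evalℕ i σ) (evalℝ e σ) σ) X R → Exec (setℝ a i e ⨾ q) σ X R
    setℝ⨾ {a} {i} {e} {σ = σ} 1≤X x = seqE (setℝE {Q = _≡ writeℝ a (evalℕ i σ) (evalℝ e σ) σ} 1≤X refl) λ { _ _ refl → x }

    private
      branch : ∀ b {p q t k} → 1 ℕ.≤ X → t ℕ.≤ k ℕ.* X → k ℕ.≤ p ℕ.+ q → 1 ℕ.+ b ℕ.+ t ℕ.≤ (1 ℕ.+ b ℕ.+ (p ℕ.+ q)) ℕ.* X
      branch b {p} {q} {t} {k} 1≤X t≤ k≤ = subst (1 ℕ.+ b ℕ.+ t ℕ.≤_) (sym (ℕ.*-distribʳ-+ X (1 ℕ.+ b) (p ℕ.+ q)))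
        (ℕ.+-mono-≤ (scale (1 ℕ.+ b) 1≤X) (ℕ.≤-trans t≤ (ℕ.*-monoˡ-≤ X k≤)))

    ifE : ∀ {b p q σ Q} → 1 ℕ.≤ X → (evalB b σ ≡ true → Exec p σ X Q) → (evalB b σ ≡ false → Exec q σ X Q) →
          Exec (ifᵖ b p q) σ X Q
    ifE {b} {p} {q} {σ} 1≤X then else with evalB b σ in eq
    ... | true with then refl
    ...   | exec r t≤ post = exec (⇓if-true eq r) (branch (boolCost b) {cost p} {cost q} {k = cost p} 1≤X t≤ (ℕ.m≤m+n _ _)) post
    ifE {b} {p} {q} {σ} 1≤X then else | false with else refl
    ...   | exec r t≤ post = exec (⇓if-false eq r) (branch (boolCost b) {cost p} {cost q} {k = cost q} 1≤X t≤ (ℕ.m≤n+m _ (cost p))) post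

    mapE : ∀ {p σ Q R} → Exec p σ X Q → (∀ τ → Agree p σ τ → Q τ → R τ) → Exec p σ X R
    mapE (exec r t≤ post) f = exec r t≤ (f _ (agree-run r) post)

    weakenE : ∀ {p σ Y Q} → X ℕ.≤ Y → Exec p σ X Q → Exec p σ Y Q
    weakenE {p} X≤Y (exec r t≤ post) = exec r (ℕ.≤-trans t≤ (ℕ.*-monoʳ-≤ (cost p) X≤Y)) post

  -- The rule for counted loops, the only loops of the program. Time is multiplied by `M` instead of
  -- the number `m` of iterations, because an empty loop still initialises its counter and evaluates
  -- its guard; `1≤M` pays for that.
  module _ {i b : ℕ} {body : Program} {σ : State} {X M m : ℕ} (1≤X : 1 ℕ.≤ X) (1≤M : 1 ℕ.≤ M) (m≤M : m ℕ.≤ M)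
           (bound : natMem σ b 0 ≡ m)
           (keeps-i : writesℕ body i ≡ false) (keeps-b : writesℕ body b ≡ false) (i≢b : (i ≡ᵇ b) ≡ false) where
    private
      guard = (lit 1 ⊕ scalar i) ≤ⁿ scalar b
      step  = body ⨾ setℕ i (lit 0) (scalar i ⊕ lit 1)
      g     = 1 ℕ.+ boolCost guard
      inc   = cost (setℕ i (lit 0) (scalar i ⊕ lit 1))

      keeps-b′ : writesℕ (for i b body) b ≡ false
      keeps-b′ rewrite i≢b | keeps-b = refl

      counter : ∀ x τ → natMem (writeℕ i 0 x τ) i 0 ≡ x
      counter x τ rewrite ≡ᵇ-refl i = refl

    module _ (I : ℕ → State → Set) (I₀ : I 0 (writeℕ i 0 0 σ))
             (each : ∀ (k : Fin m) τ → Agree (for i b body) σ τ → natMem τ i 0 ≡ toℕ k → I (toℕ k) τ →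
                     Exec body τ X (λ υ → I (suc (toℕ k)) (writeℕ i 0 (suc (toℕ k)) υ))) where
      private
        record Loop (d : ℕ) (τ : State) : Set where
          field
            {steps} : ℕ
            {final} : State
            run     : while guard step , τ ⇓[ steps ] final
            time    : steps ℕ.≤ d ℕ.* (g ℕ.+ cost step ℕ.* X) ℕ.+ g
            post    : I m final

        loop : ∀ d k τ → k ℕ.+ d ≡ m → natMem τ i 0 ≡ k → Agree (for i b body) σ τ → I k τ → Loop d τ
        loop zero k τ eq ctr ag Ik = record
          { run = ⇓while-false (≤ᵇ-false (ℕ.≤-reflexive (cong suc (trans (trans (Agree.nat ag b keeps-b′ 0) bound)
              (trans (sym eq) (trans (ℕ.+-identityʳ k) (sym ctr)))))))
          ; time = ℕ.≤-refl
          ; post = subst (λ k → I k τ) (trans (sym (ℕ.+-identityʳ k)) eq) Ik }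
        loop (suc d) k τ eq ctr ag Ik = record
          { run = ⇓while-true enter (⇓seq run ⇓setℕ) (Loop.run next)
          ; time = ℕ.≤-trans (ℕ.+-mono-≤ (ℕ.+-monoʳ-≤ g once) (Loop.time next))
                     (ℕ.≤-reflexive (sym (ℕ.+-assoc (g ℕ.+ cost step ℕ.* X) _ g)))
          ; post = Loop.post next }
          where
          k<m : k ℕ.< m
          k<m = subst (k ℕ.<_) eq (subst (k ℕ.<_) (sym (ℕ.+-suc k d)) (s≤s (ℕ.m≤m+n k d)))
          f = fromℕ< k<m
          f≡k : toℕ f ≡ k
          f≡k = toℕ-fromℕ< k<m
          enter : evalB guard τ ≡ true
          enter = ≤ᵇ-true (ℕ.≤-trans (ℕ.≤-reflexive (cong suc ctr))
                    (ℕ.≤-trans k<m (ℕ.≤-reflexive (sym (trans (Agree.nat ag b keeps-b′ 0) bound)))))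
          open Exec (each f τ ag (trans ctr (sym f≡k)) (subst (λ k → I k τ) (sym f≡k) Ik)) renaming (final to υ)
          υ-ctr : natMem υ i 0 ℕ.+ 1 ≡ suc k
          υ-ctr = trans (cong (ℕ._+ 1) (trans (Agree.nat (agree-run run) i keeps-i 0) ctr)) (ℕ.+-comm k 1)
          υ′ = writeℕ i 0 (natMem υ i 0 ℕ.+ 1) υ
          next : Loop d υ′
          next = loop d (suc k) υ′ (trans (sym (ℕ.+-suc k d)) eq) (trans (counter _ υ) υ-ctr)
            (agree-trans ag (agree-seqʳ {setℕ i (lit 0) (lit 0)} (agree-loop (agree-run (⇓seq run (⇓setℕ {i} {lit 0} {scalar i ⊕ lit 1}))))))
            (subst (λ x → I (suc k) (writeℕ i 0 x υ)) (sym υ-ctr) (subst (λ k → I (suc k) (writeℕ i 0 (suc k) υ)) f≡k post))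
          once : steps ℕ.+ inc ℕ.≤ cost step ℕ.* X
          once = subst (steps ℕ.+ inc ℕ.≤_) (sym (ℕ.*-distribʳ-+ X (cost body) inc)) (ℕ.+-mono-≤ time (scale inc 1≤X))

      forE : Exec (for i b body) σ (M ℕ.* X) (I m)
      forE = exec (⇓seq ⇓setℕ run) total post
        where
        open Loop (loop m 0 (writeℕ i 0 0 σ) refl (counter 0 σ)
          (agree-seqˡ (agree-run (⇓setℕ {i} {lit 0} {lit 0}))) I₀)
        MX = M ℕ.* X
        1≤MX : 1 ℕ.≤ MX
        1≤MX = ℕ.*-mono-≤ 1≤M 1≤X
        total : 3 ℕ.+ steps ℕ.≤ cost (for i b body) ℕ.* MX
        total = begin
          3 ℕ.+ steps ≤⟨ ℕ.+-monoʳ-≤ 3 time ⟩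
          3 ℕ.+ (m ℕ.* (g ℕ.+ cost step ℕ.* X) ℕ.+ g)
            ≤⟨ ℕ.+-mono-≤ (scale {MX} 3 1≤MX) (ℕ.+-mono-≤ iterations (scale {MX} g 1≤MX)) ⟩
          3 ℕ.* MX ℕ.+ ((g ℕ.* MX ℕ.+ cost step ℕ.* MX) ℕ.+ g ℕ.* MX)
            ≡⟨ cong (3 ℕ.* MX ℕ.+_) (trans (ℕ.+-comm _ (g ℕ.* MX)) (trans (sym (ℕ.+-assoc (g ℕ.* MX) (g ℕ.* MX) _))
                 (trans (cong (ℕ._+ cost step ℕ.* MX) (sym (ℕ.*-distribʳ-+ MX g g))) (sym (ℕ.*-distribʳ-+ MX (g ℕ.+ g) (cost step)))))) ⟩
          3 ℕ.* MX ℕ.+ (g ℕ.+ g ℕ.+ cost step) ℕ.* MX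
            ≡⟨ ℕ.*-distribʳ-+ MX 3 (g ℕ.+ g ℕ.+ cost step) ⟨
          cost (for i b body) ℕ.* MX ∎
          where
          open ℕ.≤-Reasoning
          iterations : m ℕ.* (g ℕ.+ cost step ℕ.* X) ℕ.≤ g ℕ.* MX ℕ.+ cost step ℕ.* MX
          iterations = begin
            m ℕ.* (g ℕ.+ cost step ℕ.* X) ≤⟨ ℕ.*-mono-≤ m≤M (ℕ.+-monoˡ-≤ (cost step ℕ.* X) (scale {X} g 1≤X)) ⟩
            M ℕ.* (g ℕ.* X ℕ.+ cost step ℕ.* X) ≡⟨ ℕ.*-distribˡ-+ M (g ℕ.* X) (cost step ℕ.* X) ⟩
            M ℕ.* (g ℕ.* X) ℕ.+ M ℕ.* (cost step ℕ.* X) ≡⟨ cong₂ ℕ._+_ (exchange g) (exchange (cost step)) ⟩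
            g ℕ.* MX ℕ.+ cost step ℕ.* MX ∎
            where
            exchange : ∀ h → M ℕ.* (h ℕ.* X) ≡ h ℕ.* MX
            exchange h = trans (sym (ℕ.*-assoc M h X)) (trans (cong (ℕ._* X) (ℕ.*-comm M h)) (ℕ.*-assoc h M X))

    -- The pattern of most loops: iteration `k` establishes `Fact k`, and the others change the
    -- state only along `⇝`, which preserves facts. For relaxation, `⇝` says that bounds once
    -- reached persist.
    forallE : (J : State → Set) (_⇝_ : State → State → Set) (Fact : Fin m → State → Set) →
              (∀ τ x → J τ → J (writeℕ i 0 x τ)) →
              (∀ τ x → τ ⇝ writeℕ i 0 x τ) → (∀ τ υ φ → τ ⇝ υ → υ ⇝ φ → τ ⇝ φ) →
              (∀ k τ υ → τ ⇝ υ → Fact k τ → Fact k υ) →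
              J σ →
              (∀ (k : Fin m) τ → Agree (for i b body) σ τ → natMem τ i 0 ≡ toℕ k → σ ⇝ τ → J τ →
               Exec body τ X (λ υ → J υ × τ ⇝ υ × Fact k υ)) →
              Exec (for i b body) σ (M ℕ.* X) (λ τ → J τ × σ ⇝ τ × (∀ k → Fact k τ))
    forallE J _⇝_ Fact J-ctr ⇝-ctr ⇝-trans mono Jσ each = mapE
      (forE (λ j τ → J τ × σ ⇝ τ × (∀ k → toℕ k ℕ.< j → Fact k τ)) (J-ctr σ 0 Jσ , ⇝-ctr σ 0 , λ _ ())
        λ k τ ag ctr (Jτ , στ , facts) → mapE (each k τ ag ctr στ Jτ) λ υ _ (Jυ , τυ , fact) →
          J-ctr υ _ Jυ , ⇝-trans _ _ _ στ (⇝-trans _ _ _ τυ (⇝-ctr υ _))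
          , λ l l< → mono l υ _ (⇝-ctr υ _) (extend k l (ℕ.≤-pred l<) facts τυ fact))
      λ τ _ (Jτ , στ , facts) → Jτ , στ , λ k → facts k (toℕ<n k)
      where
      extend : ∀ k l {τ υ} → toℕ l ℕ.≤ toℕ k → (∀ l → toℕ l ℕ.< toℕ k → Fact l τ) → τ ⇝ υ → Fact k υ → Fact l υ
      extend k l l≤k facts τυ fact with ℕ.m≤n⇒m<n∨m≡n l≤k
      ... | inj₁ l<k = mono l _ _ τυ (facts l l<k)
      ... | inj₂ l≡k with refl ← toℕ-injective l≡k = fact

-- The program

-- Arrays 0 to 3 of naturals and 0 and 1 of reals are prescribed by
-- HoldsInput and HoldsSolution.  For a set S of forbidden trees, distᵃ
-- holds the least weight found so far of a walk from s to t avoiding S,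
-- finᵃ tells whether there is one, and distExitᵃ and finExitᵃ are the
-- same for walks that leave the tree of s at once.  The empty set has
-- number 0, so its part of finᵃ and distᵃ is the output.
pattern sizeᵃ    = 0
pattern adjᵃ     = 1
pattern verdictᵃ = 2
pattern finᵃ     = 3
pattern rowᵃ     = 4
pattern compᵃ    = 5
pattern treeᵃ    = 6
pattern bitᵃ     = 7
pattern offsetᵃ  = 8
pattern finExitᵃ = 9
pattern blockedᵃ = 10
pattern squareᵃ  = 11
pattern setsᵃ    = 12
pattern volumeᵃ  = 13
pattern baseᵃ    = 14
pattern restᵃ    = 15
pattern cyclicᵃ  = 16
pattern leftᵃ    = 17
pattern rightᵃ   = 18
pattern i₁ᵃ      = 19
pattern i₂ᵃ      = 20
pattern i₃ᵃ      = 21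
pattern i₄ᵃ      = 22
pattern i₅ᵃ      = 23

pattern weightᵃ   = 0
pattern distᵃ     = 1
pattern eᵃ        = 2
pattern distExitᵃ = 3

i₁ i₂ i₃ i₄ i₅ : NatExp
i₁ = scalar i₁ᵃ
i₂ = scalar i₂ᵃ
i₃ = scalar i₃ᵃ
i₄ = scalar i₄ᵃ
i₅ = scalar i₅ᵃ

-- The machine cannot multiply, so `init` tabulates the row offsets `u * n`; likewise `offsetᵃ`
-- holds the table offsets `bit r * (n * n)`, found by doubling.
at : NatExp → NatExp → NatExp
at x y = getℕ rowᵃ x ⊕ y

cell : NatExp → NatExp → NatExp → NatExp
cell b x y = b ⊕ at x y

base : NatExp
base = scalar baseᵃ

_:=_ : ℕ → NatExp → Program
a := e = setℕ a (lit 0) e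

_[_]:=_ : ℕ → NatExp → NatExp → Program
a [ i ]:= e = setℕ a i e

eqᵇ : NatExp → NatExp → BoolExp
eqᵇ d e = (d ≤ⁿ e) ∧ᵇ (e ≤ⁿ d)

arcᵇ negᵇ : NatExp → NatExp → BoolExp
arcᵇ x y = lit 1 ≤ⁿ getℕ adjᵃ (at x y)
negᵇ x y = arcᵇ x y ∧ᵇ (arcᵇ y x ∧ᵇ notᵇ (zeroʳ ≤ʳ (getℝ weightᵃ (at x y) ⊕ʳ getℝ weightᵃ (at y x))))

-- The flag in array `f` takes the place of an infinite weight: a real cell has no meaning until its
-- flag is set.
relax : ℕ → ℕ → NatExp → RealExp → Program
relax f r i v = ifᵖ ((lit 1 ≤ⁿ getℕ f i) ∧ᵇ (getℝ r i ≤ʳ v)) skip (setℝ r i v ⨾ setℕ f i (lit 1))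

initBody init : Program
initBody = rowᵃ [ i₁ ]:= scalar squareᵃ
         ⨾ squareᵃ := (scalar squareᵃ ⊕ scalar sizeᵃ)
         ⨾ compᵃ [ i₁ ]:= i₁
         ⨾ treeᵃ [ i₁ ]:= lit 0
         ⨾ setℝ eᵃ (at i₁ i₁) zeroʳ
init = squareᵃ := lit 0 ⨾ for i₁ᵃ sizeᵃ initBody

joinCell relabel merge growBody grow : Program
joinCell =
  ifᵖ (eqᵇ (getℕ compᵃ i₃) (scalar leftᵃ) ∧ᵇ eqᵇ (getℕ compᵃ i₄) (scalar rightᵃ))
    (setℝ eᵃ (at i₃ i₄) ((getℝ eᵃ (at i₃ i₁) ⊖ʳ getℝ weightᵃ (at i₂ i₁)) ⊕ʳ getℝ eᵃ (at i₂ i₄)))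
  (ifᵖ (eqᵇ (getℕ compᵃ i₃) (scalar rightᵃ) ∧ᵇ eqᵇ (getℕ compᵃ i₄) (scalar leftᵃ))
    (setℝ eᵃ (at i₃ i₄) ((getℝ eᵃ (at i₃ i₂) ⊖ʳ getℝ weightᵃ (at i₁ i₂)) ⊕ʳ getℝ eᵃ (at i₁ i₄)))
    skip)
relabel = ifᵖ (eqᵇ (getℕ compᵃ i₃) (scalar rightᵃ)) (compᵃ [ i₃ ]:= scalar leftᵃ) skip
merge = for i₃ᵃ sizeᵃ (for i₄ᵃ sizeᵃ joinCell)
      ⨾ treeᵃ [ scalar leftᵃ ]:= lit 1
      -- The label `right` dies out in the relabelling. Clearing its mark leaves one marked label
      -- per tree, on which the factor `2 ^ k₀` depends.
      ⨾ treeᵃ [ scalar rightᵃ ]:= lit 0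
      ⨾ for i₃ᵃ sizeᵃ relabel
growBody =
  -- Each unordered pair is tested once; otherwise the reverse of an accepted edge would be taken
  -- for a cycle.
  ifᵖ (((lit 1 ⊕ i₁) ≤ⁿ i₂) ∧ᵇ negᵇ i₁ i₂)
    (leftᵃ := getℕ compᵃ i₁
    ⨾ rightᵃ := getℕ compᵃ i₂
    ⨾ ifᵖ (eqᵇ (scalar leftᵃ) (scalar rightᵃ)) (cyclicᵃ := lit 1) merge)
    skip
grow = cyclicᵃ := lit 0 ⨾ for i₁ᵃ sizeᵃ (for i₂ᵃ sizeᵃ growBody)

bitsBody bits clearBody clear : Program
bitsBody =
  ifᵖ (lit 1 ≤ⁿ getℕ treeᵃ i₁)
    (bitᵃ [ i₁ ]:= scalar setsᵃ
    ⨾ offsetᵃ [ i₁ ]:= scalar volumeᵃ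
    ⨾ setsᵃ := (scalar setsᵃ ⊕ scalar setsᵃ)
    ⨾ volumeᵃ := (scalar volumeᵃ ⊕ scalar volumeᵃ))
    (bitᵃ [ i₁ ]:= lit 0 ⨾ offsetᵃ [ i₁ ]:= lit 0)
bits = setsᵃ := lit 1 ⨾ volumeᵃ := scalar squareᵃ ⨾ for i₁ᵃ sizeᵃ bitsBody
clearBody = finᵃ [ cell base i₂ i₃ ]:= lit 0 ⨾ finExitᵃ [ cell base i₂ i₃ ]:= lit 0
clear = baseᵃ := lit 0
      ⨾ for i₁ᵃ setsᵃ (for i₂ᵃ sizeᵃ (for i₃ᵃ sizeᵃ clearBody)
                      ⨾ baseᵃ := (base ⊕ scalar squareᵃ))

-- The counter ascends, whereas greedy decoding takes the labels from the top.
label : NatExp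
label = scalar sizeᵃ ⊖ (lit 1 ⊕ i₃)

decodeBody decode exitBody exits moveBody moves stage rounds : Program
decodeBody =
  ifᵖ ((lit 1 ≤ⁿ getℕ bitᵃ label) ∧ᵇ (getℕ bitᵃ label ≤ⁿ scalar restᵃ))
    (blockedᵃ [ label ]:= lit 1 ⨾ restᵃ := (scalar restᵃ ⊖ getℕ bitᵃ label))
    (blockedᵃ [ label ]:= lit 0)
decode = restᵃ := i₂ ⨾ for i₃ᵃ sizeᵃ decodeBody

-- The cell belongs to the set that forbids the tree of `i₃` in addition.
next : NatExp
next = cell (base ⊕ getℕ offsetᵃ (getℕ compᵃ i₃)) i₄ i₅

exitBody =
  ifᵖ (arcᵇ i₃ i₄ ∧ᵇ (lit 1 ≤ⁿ getℕ finᵃ next))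
    (relax finExitᵃ distExitᵃ (cell base i₃ i₅) (getℝ weightᵃ (at i₃ i₄) ⊕ʳ getℝ distᵃ next))
    skip
exits = for i₃ᵃ sizeᵃ
  (ifᵖ (getℕ blockedᵃ (getℕ compᵃ i₃) ≤ⁿ lit 0)
    (relax finExitᵃ distExitᵃ (cell base i₃ i₃) zeroʳ
    ⨾ for i₄ᵃ sizeᵃ (for i₅ᵃ sizeᵃ exitBody))
    skip)
moveBody =
  ifᵖ (lit 1 ≤ⁿ getℕ finExitᵃ (cell base i₄ i₅))
    (relax finᵃ distᵃ (cell base i₃ i₅) (getℝ distExitᵃ (cell base i₄ i₅) ⊖ʳ getℝ eᵃ (at i₄ i₃)))
    skip
moves = for i₃ᵃ sizeᵃ (for i₄ᵃ sizeᵃ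
  (ifᵖ (eqᵇ (getℕ compᵃ i₄) (getℕ compᵃ i₃)) (for i₅ᵃ sizeᵃ moveBody) skip))
stage = decode ⨾ exits ⨾ moves ⨾ baseᵃ := (base ⊕ scalar squareᵃ)
rounds = for i₁ᵃ sizeᵃ (baseᵃ := lit 0 ⨾ for i₂ᵃ setsᵃ stage)

checkBody check solve apsp : Program
checkBody =
  ifᵖ ((arcᵇ i₁ i₂ ∧ᵇ notᵇ (negᵇ i₁ i₂)) ∧ᵇ
       ((lit 1 ≤ⁿ getℕ finᵃ (at i₂ i₁)) ∧ᵇ
        notᵇ (zeroʳ ≤ʳ (getℝ distᵃ (at i₂ i₁) ⊕ʳ getℝ weightᵃ (at i₁ i₂)))))
    (verdictᵃ := lit 0)
    skip
check = verdictᵃ := lit 1 ⨾ for i₁ᵃ sizeᵃ (for i₂ᵃ sizeᵃ checkBody)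
solve = bits ⨾ clear ⨾ rounds ⨾ check
apsp = init ⨾ grow ⨾ ifᵖ (lit 1 ≤ⁿ scalar cyclicᵃ) (verdictᵃ := lit 0) solve

-- Verification: initialisation

updated : ∀ {A : Set} {i j} {x y z : A} → (i ≡ j → x ≡ z) → (i ≢ j → y ≡ z) → (if i ≡ᵇ j then x else y) ≡ z
updated {i = i} {j} same other with i ℕ.≟ j
... | yes refl = trans (select-same i) (same refl)
... | no i≢j   = trans (select-other i≢j) (other i≢j)

∧-true : ∀ {a b} → a ∧ b ≡ true → a ≡ true × b ≡ true
∧-true {true} eq = refl , eq

not-true : ∀ {b} → not b ≡ true → b ≡ false
not-true {false} _ = refl

not-false : ∀ {b} → not b ≡ false → b ≡ true
not-false {true} _ = refl

module Common (ℝ : RealNumbers) {n : ℕ} (D : Digraph n) (c : Weighted.WeightFunction ℝ D) where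
  open RealNumbers ℝ
  open LinearArithmetic ℝ
  open Digraph D
  open Weighted ℝ D
  open Machine ℝ
  open APSP ℝ D c
  open ProgramLogic ℝ
  open Weights ℝ D c

  entry-injective : ∀ x y x′ y′ → entry x y ≡ entry x′ y′ → x ≡ x′ × y ≡ y′
  entry-injective x y x′ y′ eq = combine-injective x y x′ y′
    (toℕ-injective (trans (as-entry x y) (trans eq (sym (as-entry x′ y′)))))
    where
    as-entry : ∀ x y → toℕ (combine x y) ≡ entry x y
    as-entry x y = trans (toℕ-combine x y) (cong (ℕ._+ toℕ y) (ℕ.*-comm n (toℕ x)))

  record Basic (σ : State) : Set where
    field
      size≡    : natMem σ sizeᵃ 0 ≡ n
      adj≡     : ∀ u v → natMem σ adjᵃ (entry u v) ≡ (if arc u v then 1 else 0)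
      row≡     : ∀ u → natMem σ rowᵃ (toℕ u) ≡ toℕ u ℕ.* n
      weights≈ : ∀ {u v} (a : Arc u v) → realMem σ weightᵃ (entry u v) ≈ c a

    at≡ : ∀ {X Y x y} → evalℕ X σ ≡ toℕ x → evalℕ Y σ ≡ toℕ y → evalℕ (at X Y) σ ≡ entry x y
    at≡ {x = x} X≡ Y≡ = cong₂ ℕ._+_ (trans (cong (natMem σ rowᵃ) X≡) (row≡ x)) Y≡

    arcᵇ≡ : ∀ {X Y x y} → evalℕ X σ ≡ toℕ x → evalℕ Y σ ≡ toℕ y → evalB (arcᵇ X Y) σ ≡ arc x y
    arcᵇ≡ {X} {Y} {x} {y} X≡ Y≡ =
      trans (cong (λ i → 1 ≤ᵇ natMem σ adjᵃ i) (at≡ {X} {Y} X≡ Y≡)) (trans (cong (1 ≤ᵇ_) (adj≡ x y)) (flag (arc x y)))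
      where
      flag : ∀ b → (1 ≤ᵇ (if b then 1 else 0)) ≡ b
      flag true  = refl
      flag false = refl

    private
      sum≈ : ∀ {X Y x y} → evalℕ X σ ≡ toℕ x → evalℕ Y σ ≡ toℕ y → (a : Arc x y) (b : Arc y x) →
             evalℝ (getℝ weightᵃ (at X Y) ⊕ʳ getℝ weightᵃ (at Y X)) σ ≈ c a + c b
      sum≈ {X} {Y} X≡ Y≡ a b = +-cong
        (≈-trans (≡⇒≈ (cong (realMem σ weightᵃ) (at≡ {X} {Y} X≡ Y≡))) (weights≈ a))
        (≈-trans (≡⇒≈ (cong (realMem σ weightᵃ) (at≡ {Y} {X} Y≡ X≡))) (weights≈ b))

    negᵇ-true : ∀ {X Y x y} → evalℕ X σ ≡ toℕ x → evalℕ Y σ ≡ toℕ y →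
                evalB (negᵇ X Y) σ ≡ true → NegativeEdge c x y
    negᵇ-true {X} {Y} {x} {y} X≡ Y≡ eq with ∧-true eq
    ... | eq₁ , eq₂ with ∧-true eq₂
    ...   | eq₃ , eq₄ = a , b , ≰⇒> λ 0≤ → ≤?-false (not-true eq₄) (≤-trans 0≤ (≤-reflexive (≈-sym (sum≈ {X} {Y} X≡ Y≡ a b))))
      where
      a : Arc x y
      a = ≡⇒T (trans (sym (arcᵇ≡ {X} {Y} X≡ Y≡)) eq₁)
      b : Arc y x
      b = ≡⇒T (trans (sym (arcᵇ≡ {Y} {X} Y≡ X≡)) eq₃)

    negᵇ-false : ∀ {X Y x y} → evalℕ X σ ≡ toℕ x → evalℕ Y σ ≡ toℕ y →
                 evalB (negᵇ X Y) σ ≡ false → ¬ NegativeEdge c x y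
    negᵇ-false {X} {Y} {x} {y} X≡ Y≡ eq (a , b , neg)
      with evalB (arcᵇ X Y) σ | arcᵇ≡ {X} {Y} X≡ Y≡ | evalB (arcᵇ Y X) σ | arcᵇ≡ {Y} {X} Y≡ X≡
    ... | false | eq₁ | _     | _   = subst T (sym eq₁) a
    ... | true  | _   | false | eq₂ = subst T (sym eq₂) b
    ... | true  | _   | true  | _   =
      <⇒≱ neg (≤-trans (≤?-true (not-false eq)) (≤-reflexive (sum≈ {X} {Y} X≡ Y≡ a b)))

  keepBasic : ∀ {p σ τ} → Agree p σ τ → writesℕ p sizeᵃ ≡ false → writesℕ p adjᵃ ≡ false → writesℕ p rowᵃ ≡ false →
              writesℝ p weightᵃ ≡ false → Basic σ → Basic τ
  keepBasic (agree nat real) s a r w B = record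
    { size≡    = trans (nat sizeᵃ s 0) size≡
    ; adj≡     = λ u v → trans (nat adjᵃ a _) (adj≡ u v)
    ; row≡     = λ u → trans (nat rowᵃ r _) (row≡ u)
    ; weights≈ = λ b → ≈-trans (≡⇒≈ (real weightᵃ w _)) (weights≈ b)
    }
    where open Basic B

  -- Not n, so that time budgets are positive for the empty digraph.
  N : ℕ
  N = suc n

  -- The time of `d` nested loops over the vertices.
  Level : ℕ → ℕ
  Level zero    = 1
  Level (suc d) = N ℕ.* Level d

  1≤Level : ∀ d → 1 ℕ.≤ Level d
  1≤Level zero    = s≤s z≤n
  1≤Level (suc d) = ℕ.≤-trans (1≤Level d) (ℕ.m≤m+n _ _)

  Level≤ : ∀ d → Level d ℕ.≤ Level (suc d)
  Level≤ d = ℕ.m≤m+n _ _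

  1≤N : 1 ℕ.≤ N
  1≤N = s≤s z≤n

  n≤N : n ℕ.≤ N
  n≤N = ℕ.n≤1+n n

  record Initial (σ : State) : Set where
    field
      basic  : Basic σ
      comp≡  : ∀ (v : Fin n) → natMem σ compᵃ (toℕ v) ≡ toℕ v
      tree≡  : ∀ (v : Fin n) → natMem σ treeᵃ (toℕ v) ≡ 0
      e≡     : ∀ v → realMem σ eᵃ (entry v v) ≡ 0#
      square≡ : natMem σ squareᵃ 0 ≡ n ℕ.* n

  initE : ∀ {σ} → HoldsInput σ → Exec init σ (Level 1) Initial
  initE {σ} input = setℕ⨾ (1≤Level 1) (mapE
    (forE {m = n} (1≤Level 0) 1≤N n≤N size refl refl refl
      (λ j τ → natMem τ squareᵃ 0 ≡ j ℕ.* n × (∀ u → toℕ u ℕ.< j → Row u τ))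
      (refl , λ u ())
      body)
    λ τ ag (sq , rows) → record
      { basic = record
          { size≡    = trans (Agree.nat ag sizeᵃ refl 0) size
          ; adj≡     = λ u v → trans (Agree.nat ag adjᵃ refl _) (adjacency u v)
          ; row≡     = λ u → proj₁ (rows u (toℕ<n u))
          ; weights≈ = λ a → ≈-trans (≡⇒≈ (Agree.real ag weightᵃ refl _)) (weights a) }
      ; comp≡ = λ u → proj₁ (proj₂ (rows u (toℕ<n u)))
      ; tree≡ = λ u → proj₁ (proj₂ (proj₂ (rows u (toℕ<n u))))
      ; e≡    = λ u → proj₂ (proj₂ (proj₂ (rows u (toℕ<n u))))
      ; square≡ = sq })
    where
    open HoldsInput input
    Row : Fin n → State → Set
    Row u τ = natMem τ rowᵃ (toℕ u) ≡ toℕ u ℕ.* n × natMem τ compᵃ (toℕ u) ≡ toℕ u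
            × natMem τ treeᵃ (toℕ u) ≡ 0 × realMem τ eᵃ (entry u u) ≡ 0#
    body : ∀ (k : Fin n) τ → Agree (for i₁ᵃ sizeᵃ initBody) (writeℕ squareᵃ 0 0 σ) τ → natMem τ i₁ᵃ 0 ≡ toℕ k →
           natMem τ squareᵃ 0 ≡ toℕ k ℕ.* n × (∀ u → toℕ u ℕ.< toℕ k → Row u τ) →
           Exec initBody τ (Level 0) (λ υ → natMem υ squareᵃ 0 ≡ suc (toℕ k) ℕ.* n × (∀ u → toℕ u ℕ.< suc (toℕ k) → Row u υ))
    body k τ ag i≡ (sq , rows) =
      setℕ⨾ (1≤Level 0) (setℕ⨾ (1≤Level 0) (setℕ⨾ (1≤Level 0) (setℕ⨾ (1≤Level 0) (setℝE (1≤Level 0)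
        ( trans (cong₂ ℕ._+_ sq (trans (Agree.nat ag sizeᵃ refl 0) size)) (ℕ.+-comm (toℕ k ℕ.* n) n)
        , λ u u≤k → row u u≤k)))))
      where
      old : ∀ {u} → toℕ u ℕ.< suc (toℕ k) → natMem τ i₁ᵃ 0 ≢ toℕ u → Row u τ
      old u≤k k≢u = rows _ (ℕ.≤∧≢⇒< (ℕ.≤-pred u≤k) (λ u≡k → k≢u (trans i≡ (sym u≡k))))
      index : (if natMem τ i₁ᵃ 0 ≡ᵇ natMem τ i₁ᵃ 0 then natMem τ squareᵃ 0 else natMem τ rowᵃ (natMem τ i₁ᵃ 0)) ℕ.+ natMem τ i₁ᵃ 0
              ≡ entry k k
      index = cong₂ ℕ._+_ (trans (select-same (natMem τ i₁ᵃ 0)) sq) i≡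
      τ₁ = writeℕ rowᵃ (evalℕ i₁ τ) (evalℕ (scalar squareᵃ) τ) τ
      τ₂ = writeℕ squareᵃ 0 (evalℕ (scalar squareᵃ ⊕ scalar sizeᵃ) τ₁) τ₁
      τ₃ = writeℕ compᵃ (evalℕ i₁ τ₂) (evalℕ i₁ τ₂) τ₂
      τ₄ = writeℕ treeᵃ (evalℕ i₁ τ₃) 0 τ₃
      τ₅ = writeℝ eᵃ (evalℕ (at i₁ i₁) τ₄) 0# τ₄
      row : ∀ u → toℕ u ℕ.< suc (toℕ k) → Row u τ₅
      row u u≤k = updated (λ k≡u → trans sq (cong (ℕ._* n) (trans (sym i≡) k≡u))) (λ k≢u → proj₁ (old u≤k k≢u))
        , updated (λ k≡u → k≡u) (λ k≢u → proj₁ (proj₂ (old u≤k k≢u)))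
        , updated (λ _ → refl) (λ k≢u → proj₁ (proj₂ (proj₂ (old u≤k k≢u))))
        , updated (λ _ → refl) (λ e≢ → proj₂ (proj₂ (proj₂ (old u≤k λ k≡u →
            e≢ (trans index (cong₂ entry (toℕ-injective (trans (sym i≡) k≡u)) (toℕ-injective (trans (sym i≡) k≡u))))))))

-- Verification: the forest

sameᵇ : ℕ → ℕ → Bool
sameᵇ a b = (a ≤ᵇ b) ∧ (b ≤ᵇ a)

sameᵇ-true : ∀ {a b} → a ≡ b → sameᵇ a b ≡ true
sameᵇ-true {a} refl rewrite ≤ᵇ-true (ℕ.≤-refl {a}) = refl

sameᵇ-true⁻ : ∀ {a b} → sameᵇ a b ≡ true → a ≡ b
sameᵇ-true⁻ eq = let p , q = ∧-true eq in ℕ.≤-antisym (≤ᵇ-true⁻ p) (≤ᵇ-true⁻ q)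

sameᵇ-false : ∀ {a b} → a ≢ b → sameᵇ a b ≡ false
sameᵇ-false a≢b = ¬T⇒≡ λ t → a≢b (sameᵇ-true⁻ (T⇒≡ t))

sameᵇ-false⁻ : ∀ {a b} → sameᵇ a b ≡ false → a ≢ b
sameᵇ-false⁻ eq a≡b with () ← trans (sym eq) (sameᵇ-true a≡b)

module Growing (ℝ : RealNumbers) {n : ℕ} (D : Digraph n) (c : Weighted.WeightFunction ℝ D) where
  open RealNumbers ℝ
  open LinearArithmetic ℝ
  open Digraph D
  open Weighted ℝ D
  open Machine ℝ
  open APSP ℝ D c
  open ProgramLogic ℝ
  open Weights ℝ D c
  open Common ℝ D c

  eOf : State → Fin n → Fin n → Carrier
  eOf σ x z = realMem σ eᵃ (entry x z)

  module Merging {σ₀ : State} (basic : Basic σ₀) {comp : Fin n → Fin n}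
                 (comp≡ : ∀ v → natMem σ₀ compᵃ (toℕ v) ≡ toℕ (comp v))
                 {u v : Fin n} (neg : NegativeEdge c u v) (distinct : comp u ≢ comp v)
                 (i₁≡ : natMem σ₀ i₁ᵃ 0 ≡ toℕ u) (i₂≡ : natMem σ₀ i₂ᵃ 0 ≡ toℕ v)
                 (left≡ : natMem σ₀ leftᵃ 0 ≡ toℕ (comp u)) (right≡ : natMem σ₀ rightᵃ 0 ≡ toℕ (comp v)) where
    open Basic

    e : Fin n → Fin n → Carrier
    e = eOf σ₀

    w : Fin n → Fin n → Carrier
    w x z = realMem σ₀ weightᵃ (entry x z)

    in-tree : Fin n → Fin n → Bool
    in-tree x t = sameᵇ (toℕ (comp x)) (toℕ (comp t))

    joined : Fin n → Fin n → Carrier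
    joined x z =
      if in-tree x u ∧ in-tree z v then (e x u - w v u) + e v z
      else if in-tree x v ∧ in-tree z u then (e x v - w u v) + e u z
      else e x z

    in-true : ∀ {x t} → comp x ≡ comp t → in-tree x t ≡ true
    in-true eq = sameᵇ-true (cong toℕ eq)

    in-false : ∀ {x t} → comp x ≢ comp t → in-tree x t ≡ false
    in-false neq = sameᵇ-false λ eq → neq (toℕ-injective eq)

    joined-uv : ∀ {x z} → comp x ≡ comp u → comp z ≡ comp v → joined x z ≡ (e x u - w v u) + e v z
    joined-uv {x} {z} xu zv rewrite in-true {x} {u} xu | in-true {z} {v} zv = refl

    joined-vu : ∀ {x z} → comp x ≡ comp v → comp z ≡ comp u → joined x z ≡ (e x v - w u v) + e u z
    joined-vu {x} {z} xv zu
      rewrite in-false {x} {u} (λ xu → distinct (trans (sym xu) xv)) | in-true {x} {v} xv | in-true {z} {u} zu = refl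

    joined-same : ∀ {x z} → comp x ≡ comp z → joined x z ≡ e x z
    joined-same {x} {z} xz with comp x ≟ comp u | comp x ≟ comp v
    ... | yes xu | _
      rewrite in-true {x} {u} xu | in-false {z} {v} (λ zv → distinct (trans (sym xu) (trans xz zv)))
            | in-false {x} {v} (λ xv → distinct (trans (sym xu) xv)) = refl
    ... | no ¬xu | yes xv
      rewrite in-false {x} {u} ¬xu | in-true {x} {v} xv | in-false {z} {u} (λ zu → ¬xu (trans xz zu)) = refl
    ... | no ¬xu | no ¬xv rewrite in-false {x} {u} ¬xu | in-false {x} {v} ¬xv = refl

    Partly : State → Set
    Partly τ = ∀ x z → eOf τ x z ≡ e x z ⊎ eOf τ x z ≡ joined x z

    _⇝_ : State → State → Set
    τ ⇝ υ = ∀ x z → eOf τ x z ≡ joined x z → eOf υ x z ≡ joined x z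

    -- Why updating `eᵃ` in place is safe: the values read belong to pairs within one old tree, on
    -- which the old and the new matrix agree.
    steady : ∀ τ {x z} → Partly τ → comp x ≡ comp z → eOf τ x z ≡ e x z
    steady τ {x} {z} part xz with part x z
    ... | inj₁ eq = eq
    ... | inj₂ eq = trans eq (joined-same xz)

    Joined : Fin n → Fin n → State → Set
    Joined x z τ = eOf τ x z ≡ joined x z

    write : ∀ τ {a r} x z → Partly τ → a ≡ entry x z → r ≡ joined x z →
            let υ = writeℝ eᵃ a r τ in Partly υ × τ ⇝ υ × Joined x z υ
    write τ {a} {r} x z part refl refl = partly , keeps , select-same (entry x z)
      where
      keeps : τ ⇝ writeℝ eᵃ a r τ
      keeps x′ z′ eq = updated (λ same → cong₂ joined (proj₁ (entry-injective x z x′ z′ same)) (proj₂ (entry-injective x z x′ z′ same))) (λ _ → eq)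
      partly : Partly (writeℝ eᵃ a r τ)
      partly x′ z′ with entry x z ℕ.≟ entry x′ z′
      ... | yes same = inj₂ (trans (cong (λ i → if i ≡ᵇ entry x′ z′ then joined x z else eOf τ x′ z′) same) (trans (select-same (entry x′ z′))
              (cong₂ joined (proj₁ (entry-injective x z x′ z′ same)) (proj₂ (entry-injective x z x′ z′ same)))))
      ... | no other with part x′ z′
      ...   | inj₁ eq = inj₁ (trans (select-other other) eq)
      ...   | inj₂ eq = inj₂ (trans (select-other other) eq)

    cellE : ∀ {τ} x z → Agree merge σ₀ τ → (∀ y → natMem τ compᵃ (toℕ y) ≡ toℕ (comp y)) → Partly τ →
            natMem τ i₃ᵃ 0 ≡ toℕ x → natMem τ i₄ᵃ 0 ≡ toℕ z →
            Exec joinCell τ 1 (λ υ → Partly υ × τ ⇝ υ × Joined x z υ)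
    cellE {τ} x z ag compτ≡ part i₃≡ i₄≡ = ifE ℕ.≤-refl
      (λ eq → let xu , zv = both eq in setℝE ℕ.≤-refl (write τ x z part (at≡ B {i₃} {i₄} i₃≡ i₄≡)
        (trans (cong₂ _+_ (cong₂ _-_ (e≡ i₃ i₁ i₃≡ i₁τ≡ xu) (w≡ i₂ i₁ i₂τ≡ i₁τ≡)) (e≡ i₂ i₄ i₂τ≡ i₄≡ (sym zv)))
               (sym (joined-uv xu zv)))))
      λ ¬uv → ifE ℕ.≤-refl
      (λ eq → let xv , zu = both′ eq in setℝE ℕ.≤-refl (write τ x z part (at≡ B {i₃} {i₄} i₃≡ i₄≡)
        (trans (cong₂ _+_ (cong₂ _-_ (e≡ i₃ i₂ i₃≡ i₂τ≡ xv) (w≡ i₁ i₂ i₁τ≡ i₂τ≡)) (e≡ i₁ i₄ i₁τ≡ i₄≡ (sym zu)))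
               (sym (joined-vu xv zu)))))
      λ ¬vu → skipE ℕ.≤-refl (part , (λ _ _ eq → eq) , unchanged (part x z) (outside ¬uv ¬vu))
      where
      B : Basic τ
      B = keepBasic ag refl refl refl refl basic
      i₁τ≡ = trans (Agree.nat ag i₁ᵃ refl 0) i₁≡
      i₂τ≡ = trans (Agree.nat ag i₂ᵃ refl 0) i₂≡
      left  = trans (Agree.nat ag leftᵃ refl 0) left≡
      right = trans (Agree.nat ag rightᵃ refl 0) right≡
      x≡ = trans (cong (natMem τ compᵃ) i₃≡) (compτ≡ x)
      z≡ = trans (cong (natMem τ compᵃ) i₄≡) (compτ≡ z)
      e≡ : ∀ X Y {x y} → evalℕ X τ ≡ toℕ x → evalℕ Y τ ≡ toℕ y → comp x ≡ comp y → realMem τ eᵃ (evalℕ (at X Y) τ) ≡ e x y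
      e≡ X Y X≡ Y≡ xy = trans (cong (realMem τ eᵃ) (at≡ B {X} {Y} X≡ Y≡)) (steady τ part xy)
      w≡ : ∀ X Y {x y} → evalℕ X τ ≡ toℕ x → evalℕ Y τ ≡ toℕ y → realMem τ weightᵃ (evalℕ (at X Y) τ) ≡ w x y
      w≡ X Y X≡ Y≡ = trans (cong (realMem τ weightᵃ) (at≡ B {X} {Y} X≡ Y≡)) (Agree.real ag weightᵃ refl _)
      equal : ∀ {y t a b} → a ≡ toℕ (comp y) → b ≡ toℕ (comp t) → sameᵇ a b ≡ true → comp y ≡ comp t
      equal refl refl eq = toℕ-injective (sameᵇ-true⁻ eq)
      both : evalB (eqᵇ (getℕ compᵃ i₃) (scalar leftᵃ) ∧ᵇ eqᵇ (getℕ compᵃ i₄) (scalar rightᵃ)) τ ≡ true →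
             comp x ≡ comp u × comp z ≡ comp v
      both eq = let p , q = ∧-true eq in equal x≡ left p , equal z≡ right q
      both′ : evalB (eqᵇ (getℕ compᵃ i₃) (scalar rightᵃ) ∧ᵇ eqᵇ (getℕ compᵃ i₄) (scalar leftᵃ)) τ ≡ true →
              comp x ≡ comp v × comp z ≡ comp u
      both′ eq = let p , q = ∧-true eq in equal x≡ right p , equal z≡ left q
      outside : evalB (eqᵇ (getℕ compᵃ i₃) (scalar leftᵃ) ∧ᵇ eqᵇ (getℕ compᵃ i₄) (scalar rightᵃ)) τ ≡ false →
                evalB (eqᵇ (getℕ compᵃ i₃) (scalar rightᵃ) ∧ᵇ eqᵇ (getℕ compᵃ i₄) (scalar leftᵃ)) τ ≡ false →
                joined x z ≡ e x z
      outside p q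
        rewrite trans (sym (cong₂ _∧_ (cong₂ sameᵇ x≡ left) (cong₂ sameᵇ z≡ right))) p
              | trans (sym (cong₂ _∧_ (cong₂ sameᵇ x≡ right) (cong₂ sameᵇ z≡ left))) q = refl
      unchanged : eOf τ x z ≡ e x z ⊎ eOf τ x z ≡ joined x z → joined x z ≡ e x z → eOf τ x z ≡ joined x z
      unchanged (inj₁ eq) j = trans eq (sym j)
      unchanged (inj₂ eq) _ = eq

    cellsE : Exec (for i₃ᵃ sizeᵃ (for i₄ᵃ sizeᵃ joinCell)) σ₀ (Level 2) (λ τ → ∀ x z → Joined x z τ)
    cellsE = mapE (forallE {m = n} (1≤Level 1) 1≤N n≤N (size≡ basic) refl refl refl
        Partly _⇝_ (λ x τ → ∀ z → Joined x z τ) (λ _ _ p → p) (λ _ _ _ _ eq → eq) (λ _ _ _ p q x z eq → q x z (p x z eq))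
        (λ x _ _ p J z → p x z (J z)) (λ _ _ → inj₁ refl)
        λ x τ₁ ag₁ i₃≡ _ part₁ →
          forallE {m = n} (1≤Level 0) 1≤N n≤N (trans (Agree.nat ag₁ sizeᵃ refl 0) (size≡ basic)) refl refl refl
            Partly _⇝_ (λ z τ → Joined x z τ) (λ _ _ p → p) (λ _ _ _ _ eq → eq) (λ _ _ _ p q x z eq → q x z (p x z eq))
            (λ z _ _ p J → p x z J) part₁
            λ z τ₂ ag₂ i₄≡ _ part₂ → let ag = agree-trans ag₁ (widen ag₂) in
              cellE x z (agree-seqˡ ag) (λ y → trans (Agree.nat ag compᵃ refl _) (comp≡ y)) part₂
                (trans (Agree.nat ag₂ i₃ᵃ refl 0) i₃≡) i₄≡)
      λ τ _ (_ , _ , facts) → facts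
      where
      widen : ∀ {τ υ} → Agree (for i₄ᵃ sizeᵃ joinCell) τ υ → Agree (for i₃ᵃ sizeᵃ (for i₄ᵃ sizeᵃ joinCell)) τ υ
      widen ag = agree-seqʳ {setℕ i₃ᵃ (lit 0) (lit 0)} (agree-loop (agree-seqˡ ag))

    comp′ : Fin n → Fin n
    comp′ x = if ⌊ comp x ≟ comp v ⌋ then comp u else comp x

    comp′-v : ∀ {x} → comp x ≡ comp v → comp′ x ≡ comp u
    comp′-v {x} xv with comp x ≟ comp v
    ... | yes _  = refl
    ... | no ¬xv = ⊥-elim (¬xv xv)

    comp′-other : ∀ {x} → comp x ≢ comp v → comp′ x ≡ comp x
    comp′-other {x} ¬xv with comp x ≟ comp v
    ... | yes xv = ⊥-elim (¬xv xv)
    ... | no _   = refl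

    Label : Fin n → State → Set
    Label x τ = natMem τ compᵃ (toℕ x) ≡ toℕ (comp′ x)

    relabelE : ∀ {σ₁} → Agree merge σ₀ σ₁ → (∀ y → natMem σ₁ compᵃ (toℕ y) ≡ toℕ (comp y)) →
               Exec (for i₃ᵃ sizeᵃ relabel) σ₁ (Level 1) (λ τ → ∀ x → Label x τ)
    relabelE {σ₁} ag comp₁≡ = mapE
      (forallE {m = n} (1≤Level 0) 1≤N n≤N (trans (Agree.nat ag sizeᵃ refl 0) (size≡ basic)) refl refl refl
        Half′ (λ τ υ → ∀ x → Label x τ → Label x υ) Label (λ _ _ p → p) (λ _ _ _ eq → eq) (λ _ _ _ p q x eq → q x (p x eq))
        (λ x _ _ p → p x) (λ x → inj₁ (comp₁≡ x))
        λ x τ ag′ i₃≡ _ half → ifE ℕ.≤-refl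
          (λ eq → setℕE ℕ.≤-refl (rename τ x i₃≡ (left ag′) half
            (hit x (half x) (trans (cong (natMem τ compᵃ) (sym i₃≡)) (trans (sameᵇ-true⁻ eq) (right ag′))))))
          (λ eq → skipE ℕ.≤-refl (half , (λ _ eq → eq) ,
            miss x (half x) (λ same → sameᵇ-false⁻ eq (trans (cong (natMem τ compᵃ) i₃≡) (trans same (sym (right ag′))))))))
      λ τ _ (_ , _ , facts) → facts
      where
      Half′ : State → Set
      Half′ τ = ∀ x → natMem τ compᵃ (toℕ x) ≡ toℕ (comp x) ⊎ Label x τ
      left : ∀ {τ} → Agree (for i₃ᵃ sizeᵃ relabel) σ₁ τ → natMem τ leftᵃ 0 ≡ toℕ (comp u)
      left ag′ = trans (Agree.nat ag′ leftᵃ refl 0) (trans (Agree.nat ag leftᵃ refl 0) left≡)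
      right : ∀ {τ} → Agree (for i₃ᵃ sizeᵃ relabel) σ₁ τ → natMem τ rightᵃ 0 ≡ toℕ (comp v)
      right ag′ = trans (Agree.nat ag′ rightᵃ refl 0) (trans (Agree.nat ag rightᵃ refl 0) right≡)
      hit : ∀ x {l} → l ≡ toℕ (comp x) ⊎ l ≡ toℕ (comp′ x) → l ≡ toℕ (comp v) → comp′ x ≡ comp u
      hit x (inj₁ p) q = comp′-v (toℕ-injective (trans (sym p) q))
      hit x (inj₂ p) q with comp x ≟ comp v
      ... | yes _  = refl
      ... | no ¬xv = ⊥-elim (¬xv (toℕ-injective (trans (sym p) q)))
      miss : ∀ x {l} → l ≡ toℕ (comp x) ⊎ l ≡ toℕ (comp′ x) → l ≢ toℕ (comp v) → l ≡ toℕ (comp′ x)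
      miss x (inj₁ p) q = trans p (cong toℕ (sym (comp′-other λ xv → q (trans p (cong toℕ xv)))))
      miss x (inj₂ p) q = p
      rename : ∀ τ {a l} x → a ≡ toℕ x → l ≡ toℕ (comp u) → Half′ τ → comp′ x ≡ comp u →
               let υ = writeℕ compᵃ a l τ in Half′ υ × (∀ y → Label y τ → Label y υ) × Label x υ
      rename τ x refl refl half x′ = half′ , (λ y eq → updated (λ x≡y → cong toℕ (fresh y x≡y)) (λ _ → eq))
        , trans (select-same (toℕ x)) (cong toℕ (sym x′))
        where
        fresh : ∀ y → toℕ x ≡ toℕ y → comp u ≡ comp′ y
        fresh y x≡y with refl ← toℕ-injective x≡y = sym x′
        half′ : Half′ (writeℕ compᵃ (toℕ x) (toℕ (comp u)) τ)
        half′ y with toℕ x ℕ.≟ toℕ y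
        ... | yes x≡y = inj₂ (updated (λ x≡y → cong toℕ (fresh y x≡y)) (λ x≢y → ⊥-elim (x≢y x≡y)))
        ... | no x≢y with half y
        ...   | inj₁ eq = inj₁ (trans (select-other x≢y) eq)
        ...   | inj₂ eq = inj₂ (trans (select-other x≢y) eq)

    joins : ∀ {τ} → (∀ x z → Joined x z τ) → Joins u v comp comp′ e (eOf τ)
    joins {τ} J = record
      { distinct = distinct
      ; keep     = keep
      ; join     = λ xu yv → trans (trans (comp′-other λ xv → distinct (trans (sym xu) xv)) xu) (sym (comp′-v yv))
      ; split    = split
      ; e-keep   = λ {x} {y} xy → ≡⇒≈ (trans (J x y) (joined-same xy))
      ; e-join   = λ {x} {y} xu yv a → ≈-trans (≡⇒≈ (trans (J x y) (joined-uv xu yv)))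
                     (+-cong (+-cong ≈-refl (-‿cong (weights≈ basic a))) ≈-refl)
      ; e-join′  = λ {x} {y} xv yu a → ≈-trans (≡⇒≈ (trans (J x y) (joined-vu xv yu)))
                     (+-cong (+-cong ≈-refl (-‿cong (weights≈ basic a))) ≈-refl)
      }
      where
      keep : ∀ {x y} → comp x ≡ comp y → comp′ x ≡ comp′ y
      keep eq = cong (λ r → if ⌊ r ≟ comp v ⌋ then comp u else r) eq
      split : ∀ {x y} → comp′ x ≡ comp′ y →
              comp x ≡ comp y ⊎ (comp x ≡ comp u × comp y ≡ comp v) ⊎ (comp x ≡ comp v × comp y ≡ comp u)
      split {x} {y} eq with comp x ≟ comp v | comp y ≟ comp v
      ... | yes xv | yes yv = inj₁ (trans xv (sym yv))
      ... | yes xv | no _   = inj₂ (inj₂ (xv , sym eq))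
      ... | no _   | yes yv = inj₂ (inj₁ (eq , yv))
      ... | no _   | no _   = inj₁ eq

    record Merged (τ : State) : Set where
      field
        labels : ∀ x → Label x τ
        lengths : ∀ x z → Joined x z τ
        trees  : ∀ r → natMem τ treeᵃ r ≡
                   (if toℕ (comp v) ≡ᵇ r then 0 else if toℕ (comp u) ≡ᵇ r then 1 else natMem σ₀ treeᵃ r)

    mergeE : Exec merge σ₀ (Level 2) Merged
    mergeE = seqE cellsE λ τ₁ ag₁ J → setℕ⨾ (1≤Level 2) (setℕ⨾ (1≤Level 2) (let
        τ₂ = writeℕ treeᵃ (natMem τ₁ leftᵃ 0) 1 τ₁
        τ₃ = writeℕ treeᵃ (natMem τ₂ rightᵃ 0) 0 τ₂
        ag₂ : Agree (treeᵃ [ scalar leftᵃ ]:= lit 1) τ₁ τ₂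
        ag₂ = agree-run (⇓setℕ {treeᵃ} {scalar leftᵃ} {lit 1})
        ag₃ : Agree (treeᵃ [ scalar rightᵃ ]:= lit 0) τ₂ τ₃
        ag₃ = agree-run (⇓setℕ {treeᵃ} {scalar rightᵃ} {lit 0})
        whole : Agree merge σ₀ τ₃
        whole = agree-trans (agree-seqˡ ag₁) (agree-seqʳ {for i₃ᵃ sizeᵃ (for i₄ᵃ sizeᵃ joinCell)}
                  (agree-trans (agree-seqˡ ag₂) (agree-seqʳ {treeᵃ [ scalar leftᵃ ]:= lit 1} (agree-seqˡ ag₃))))
      in weakenE (Level≤ 1) (mapE (relabelE whole (λ y → trans (Agree.nat ag₁ compᵃ refl _) (comp≡ y)))
        λ τ₄ ag₄ labels → record
          { labels = labels
          ; lengths = λ x z → trans (Agree.real ag₄ eᵃ refl _) (J x z)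
          ; trees = λ r → trans (Agree.nat ag₄ treeᵃ refl r)
              (trans (cong₂ (λ a b → if a ≡ᵇ r then 0 else if b ≡ᵇ r then 1 else natMem τ₁ treeᵃ r)
                        (trans (Agree.nat ag₁ rightᵃ refl 0) right≡) (trans (Agree.nat ag₁ leftᵃ refl 0) left≡))
                     (cong (λ t → if toℕ (comp v) ≡ᵇ r then 0 else if toℕ (comp u) ≡ᵇ r then 1 else t) (Agree.nat ag₁ treeᵃ refl r))) })))

module GrowingForest (ℝ : RealNumbers) {n : ℕ} (D : Digraph n) (c : Weighted.WeightFunction ℝ D) where
  open RealNumbers ℝ
  open LinearArithmetic ℝ
  open Digraph D
  open Weighted ℝ D
  open Machine ℝ
  open APSP ℝ D c
  open ProgramLogic ℝ
  open Weights ℝ D c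
  open Common ℝ D c
  open Growing ℝ D c

  -- Indexed by the contents of compᵃ, treeᵃ, eᵃ and cyclicᵃ instead of the
  -- state, so that it is definitionally unaffected by writing other cells.
  record Grown (labels trees : ℕ → ℕ) (e : Fin n → Fin n → Carrier) (cyclic : ℕ) (Done : Fin n → Fin n → Set) : Set where
    field
      {E}      : Edges
      {comp}   : Fin n → Fin n
      labels≡  : ∀ v → labels (toℕ v) ≡ toℕ (comp v)
      forest   : Forest E comp e
      noCycle  : NearlyConservative c → cyclic ≡ 0
      examined : cyclic ≡ 0 → ∀ {x z} → toℕ x ℕ.< toℕ z → Done x z → NegativeEdge c x z → (x , z) ∈ E
      only     : ∀ {x z} → (x , z) ∈ E → toℕ x ℕ.< toℕ z → Done x z
      marked   : ∀ {x z} → (x , z) ∈ E → 1 ℕ.≤ trees (toℕ (comp x))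
      witness  : ∀ r → 1 ℕ.≤ trees (toℕ r) → ∃ λ v → comp v ≡ r × ∃ (NegativeEdge c v)

  GrownAt : State → (Fin n → Fin n → Set) → Set
  GrownAt τ = Grown (natMem τ compᵃ) (natMem τ treeᵃ) (eOf τ) (natMem τ cyclicᵃ 0)

  regard : ∀ {l t e b} {Done Done′ : Fin n → Fin n → Set} → (∀ {x z} → Done x z → Done′ x z) →
           (∀ {x z} → Done′ x z → Done x z) → Grown l t e b Done → Grown l t e b Done′
  regard to from G = record
    { labels≡ = labels≡ ; forest = forest ; noCycle = noCycle
    ; examined = λ b lt d → examined b lt (from d)
    ; only = λ m lt → to (only m lt)
    ; marked = marked ; witness = witness }
    where open Grown G

  -- A negative edge inside one tree cannot be in `E`, because its pair has not been examined yet,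
  -- so `Forest.cyclic` refutes near conservativity. The loops go on after that; hence `examined`
  -- promises something only while `cyclicᵃ` is 0.
  growBodyE : ∀ {τ Done} u v → Basic τ → natMem τ i₁ᵃ 0 ≡ toℕ u → natMem τ i₂ᵃ 0 ≡ toℕ v → ¬ Done u v → GrownAt τ Done →
              Exec growBody τ (Level 2) (λ υ → GrownAt υ (λ x z → Done x z ⊎ (x ≡ u × z ≡ v)))
  growBodyE {τ} {Done} u v B i₁≡ i₂≡ new G = ifE (1≤Level 2)
    (λ eq → let lt , ne = ∧-true eq ; u<v = u<v lt ; neg = negᵇ-true {i₁} {i₂} i₁≡ i₂≡ ne in
      setℕ⨾ (1≤Level 2) (setℕ⨾ (1≤Level 2) (ifE (1≤Level 2)
        (λ same → setℕE (1≤Level 2) (found u<v neg (sameLabel same)))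
        (λ differ → mapE (Merging.mergeE {σ₀ = τ₂} (B₂) labels≡ neg (differentLabel differ) i₁≡ i₂≡ left≡ right≡)
          λ υ ag m → joined u<v neg (differentLabel differ) υ ag m))))
    (λ eq → skipE (1≤Level 2) (skipped eq))
    where
    open Basic B
    open Grown G
    τ₁ = writeℕ leftᵃ 0 (natMem τ compᵃ (natMem τ i₁ᵃ 0)) τ
    τ₂ = writeℕ rightᵃ 0 (natMem τ compᵃ (natMem τ i₂ᵃ 0)) τ₁
    B₂ : Basic τ₂
    B₂ = record { size≡ = size≡ ; adj≡ = adj≡ ; row≡ = row≡ ; weights≈ = weights≈ }
    left≡ : natMem τ compᵃ (natMem τ i₁ᵃ 0) ≡ toℕ (comp u)
    left≡ = trans (cong (natMem τ compᵃ) i₁≡) (labels≡ u)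
    right≡ : natMem τ compᵃ (natMem τ i₂ᵃ 0) ≡ toℕ (comp v)
    right≡ = trans (cong (natMem τ compᵃ) i₂≡) (labels≡ v)
    u<v : evalB ((lit 1 ⊕ i₁) ≤ⁿ i₂) τ ≡ true → toℕ u ℕ.< toℕ v
    u<v lt = subst (ℕ._≤ toℕ v) (cong suc i₁≡) (subst (suc (natMem τ i₁ᵃ 0) ℕ.≤_) i₂≡ (≤ᵇ-true⁻ lt))
    sameLabel : sameᵇ (natMem τ compᵃ (natMem τ i₁ᵃ 0)) (natMem τ compᵃ (natMem τ i₂ᵃ 0)) ≡ true → comp u ≡ comp v
    sameLabel eq = toℕ-injective (trans (sym left≡) (trans (sameᵇ-true⁻ eq) right≡))
    differentLabel : sameᵇ (natMem τ compᵃ (natMem τ i₁ᵃ 0)) (natMem τ compᵃ (natMem τ i₂ᵃ 0)) ≡ false → comp u ≢ comp v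
    differentLabel eq uv = sameᵇ-false⁻ eq (trans left≡ (trans (cong toℕ uv) (sym right≡)))
    Done′ : Fin n → Fin n → Set
    Done′ x z = Done x z ⊎ (x ≡ u × z ≡ v)

    skipped : evalB (((lit 1 ⊕ i₁) ≤ⁿ i₂) ∧ᵇ negᵇ i₁ i₂) τ ≡ false → GrownAt τ Done′
    skipped eq = record
      { labels≡ = labels≡ ; forest = forest ; noCycle = noCycle
      ; examined = λ { b lt (inj₁ d) ne → examined b lt d ne ; b lt (inj₂ (refl , refl)) ne → ⊥-elim (absurd lt ne) }
      ; only = λ m lt → inj₁ (only m lt)
      ; marked = marked ; witness = witness }
      where
      absurd : toℕ u ℕ.< toℕ v → ¬ NegativeEdge c u v
      absurd lt = negᵇ-false {i₁} {i₂} i₁≡ i₂≡ (trans (sym (cong (_∧ evalB (negᵇ i₁ i₂) τ)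
        (≤ᵇ-true (ℕ.≤-trans (ℕ.≤-reflexive (cong suc i₁≡)) (ℕ.≤-trans lt (ℕ.≤-reflexive (sym i₂≡))))))) eq)

    found : toℕ u ℕ.< toℕ v → NegativeEdge c u v → comp u ≡ comp v →
            Grown (natMem τ compᵃ) (natMem τ treeᵃ) (eOf τ) 1 Done′
    found lt neg same = record
      { labels≡ = labels≡ ; forest = forest
      ; noCycle = λ nc → ⊥-elim (Forest.cyclic forest neg same (λ m → new (only m lt)) nc)
      ; examined = λ ()
      ; only = λ m lt → inj₁ (only m lt)
      ; marked = marked ; witness = witness }

    joined : toℕ u ℕ.< toℕ v → (neg : NegativeEdge c u v) (distinct : comp u ≢ comp v) → ∀ υ → Agree merge τ₂ υ →
             Merging.Merged {σ₀ = τ₂} B₂ labels≡ neg distinct i₁≡ i₂≡ left≡ right≡ υ → GrownAt υ Done′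
    joined lt neg distinct υ ag m = record
      { E = (u , v) ∷ (v , u) ∷ E
      ; comp = comp′
      ; labels≡ = labels
      ; forest = joinedForest forest J neg
      ; noCycle = λ nc → trans (Agree.nat ag cyclicᵃ refl 0) (noCycle nc)
      ; examined = λ { b lt (inj₁ d) ne → there (there (examined (trans (sym (Agree.nat ag cyclicᵃ refl 0)) b) lt d ne))
                     ; b lt (inj₂ (refl , refl)) ne → here refl }
      ; only = λ { (here refl) _ → inj₂ (refl , refl)
                 ; (there (here refl)) lt′ → ⊥-elim (ℕ.<-asym lt lt′)
                 ; (there (there m)) lt → inj₁ (only m lt) }
      ; marked = λ { (here refl) → marked-u u (comp′-other distinct)
                   ; (there (here refl)) → marked-u v (comp′-v refl)
                   ; (there (there m)) → marked-old _ (marked m) (_ ≟ _) (_ ≟ _) }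
      ; witness = λ r mr → witness′ r (subst (1 ℕ.≤_) (trees (toℕ r)) mr) (_ ≟ _) (_ ≟ _)
      }
      where
      open Merging {σ₀ = τ₂} B₂ labels≡ neg distinct i₁≡ i₂≡ left≡ right≡
      open Merged m
      J : Joins u v comp comp′ (eOf τ₂) (eOf υ)
      J = joins {τ = υ} lengths
      Tree : ℕ → ℕ
      Tree r = if toℕ (comp v) ≡ᵇ r then 0 else if toℕ (comp u) ≡ᵇ r then 1 else natMem τ treeᵃ r
      marked-u : ∀ x → comp′ x ≡ comp u → 1 ℕ.≤ natMem υ treeᵃ (toℕ (comp′ x))
      marked-u x eq = ℕ.≤-reflexive (sym (trans (cong (λ r → natMem υ treeᵃ (toℕ r)) eq) (trans (trees _)
        (trans (select-other (λ vu → distinct (sym (toℕ-injective vu)))) (select-same (toℕ (comp u)))))))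
      marked-old : ∀ x → 1 ℕ.≤ natMem τ treeᵃ (toℕ (comp x)) → Dec (comp x ≡ comp v) → Dec (comp x ≡ comp u) →
                   1 ℕ.≤ natMem υ treeᵃ (toℕ (comp′ x))
      marked-old x mx (yes xv) _ = marked-u x (comp′-v xv)
      marked-old x mx (no ¬xv) (yes xu) = marked-u x (trans (comp′-other ¬xv) xu)
      marked-old x mx (no ¬xv) (no ¬xu) = subst (1 ℕ.≤_)
        (sym (trans (cong (λ r → natMem υ treeᵃ (toℕ r)) (comp′-other ¬xv))
        (trans (trees _) (trans (select-other (λ vx → ¬xv (sym (toℕ-injective vx))))
                                (select-other (λ ux → ¬xu (sym (toℕ-injective ux)))))))) mx
      witness′ : ∀ r → 1 ℕ.≤ Tree (toℕ r) → Dec (comp v ≡ r) → Dec (comp u ≡ r) → ∃ λ x → comp′ x ≡ r × ∃ (NegativeEdge c x)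
      witness′ r mr (yes refl) _ with () ← subst (1 ℕ.≤_) (select-same (toℕ (comp v))) mr
      witness′ r mr (no ¬v) (yes refl) = u , comp′-other distinct , v , neg
      witness′ r mr (no ¬v) (no ¬u) =
        let x , xr , ne = witness r (subst (1 ℕ.≤_) (trans (select-other (λ eq → ¬v (toℕ-injective eq)))
                                                           (select-other (λ eq → ¬u (toℕ-injective eq)))) mr)
        in x , trans (comp′-other (λ xv → ¬v (trans (sym xv) xr))) xr , ne

  -- The lexicographic order in which the two loops visit the pairs.
  Before : ℕ → ℕ → Fin n → Fin n → Set
  Before j k x z = toℕ x ℕ.< j ⊎ (toℕ x ≡ j × toℕ z ℕ.< k)

  -- Charging a whole merge, two nested loops, to every pair gives `n ^ 4` in total. In the
  -- conclusion `Fin n` is merely an inhabited type: it stands for a condition satisfied by all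
  -- pairs.
  growE : ∀ {σ} → Initial σ → Exec grow σ (Level 4) (λ τ → GrownAt τ (λ _ _ → Fin n))
  growE {σ} init = setℕ⨾ (1≤Level 4) (mapE
    (forE {m = n} (1≤Level 3) 1≤N n≤N size≡ refl refl refl (λ j τ → GrownAt τ (Before j 0)) start
      λ u τ₁ ag₁ i₁≡ G₁ → let B₁ = keepBasic ag₁ refl refl refl refl basic₀ in mapE
        (forE {m = n} (1≤Level 2) 1≤N n≤N (Basic.size≡ B₁) refl refl refl (λ k τ → GrownAt τ (Before (toℕ u) k)) G₁
          λ v τ₂ ag₂ i₂≡ G₂ → mapE
            (growBodyE u v (keepBasic ag₂ refl refl refl refl B₁) (trans (Agree.nat ag₂ i₁ᵃ refl 0) i₁≡) i₂≡ (fresh u v) G₂)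
            λ τ₃ _ → regard (one u v) (one⁻ u v))
        λ τ₂ _ → regard (row u) (row⁻ u))
    λ τ _ → regard (λ {x} _ → x) (λ {x} _ → inj₁ (toℕ<n x)))
    where
    open Initial init
    open Basic basic
    basic₀ : Basic (writeℕ cyclicᵃ 0 0 σ)
    basic₀ = record { size≡ = size≡ ; adj≡ = adj≡ ; row≡ = row≡ ; weights≈ = weights≈ }
    unmarked : ∀ {A : Set} (r : Fin n) → 1 ℕ.≤ natMem σ treeᵃ (toℕ r) → A
    unmarked r m with () ← subst (1 ℕ.≤_) (tree≡ r) m
    start : GrownAt (writeℕ cyclicᵃ 0 0 σ) (Before 0 0)
    start = record
      { labels≡ = comp≡
      ; forest = emptyForest (λ {x} → ≡⇒≈ (e≡ x))
      ; noCycle = λ _ → refl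
      ; examined = λ { _ _ (inj₁ ()) ; _ _ (inj₂ (_ , ())) }
      ; only = λ ()
      ; marked = λ ()
      ; witness = λ r m → unmarked r m }
    fresh : ∀ u v → ¬ Before (toℕ u) (toℕ v) u v
    fresh u v (inj₁ lt)       = ℕ.<-irrefl refl lt
    fresh u v (inj₂ (_ , lt)) = ℕ.<-irrefl refl lt
    one : ∀ u v {x z} → Before (toℕ u) (toℕ v) x z ⊎ (x ≡ u × z ≡ v) → Before (toℕ u) (suc (toℕ v)) x z
    one u v (inj₁ (inj₁ lt))       = inj₁ lt
    one u v (inj₁ (inj₂ (e , lt))) = inj₂ (e , ℕ.m≤n⇒m≤1+n lt)
    one u v (inj₂ (refl , refl))   = inj₂ (refl , ℕ.≤-refl)
    one⁻ : ∀ u v {x z} → Before (toℕ u) (suc (toℕ v)) x z → Before (toℕ u) (toℕ v) x z ⊎ (x ≡ u × z ≡ v)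
    one⁻ u v (inj₁ lt) = inj₁ (inj₁ lt)
    one⁻ u v {x} {z} (inj₂ (e , lt)) with ℕ.m≤n⇒m<n∨m≡n (ℕ.≤-pred lt)
    ... | inj₁ z<v = inj₁ (inj₂ (e , z<v))
    ... | inj₂ z≡v = inj₂ (toℕ-injective e , toℕ-injective z≡v)
    row : ∀ u {x z} → Before (toℕ u) n x z → Before (suc (toℕ u)) 0 x z
    row u (inj₁ lt)      = inj₁ (ℕ.m≤n⇒m≤1+n lt)
    row u (inj₂ (e , _)) = inj₁ (ℕ.≤-reflexive (cong suc e))
    row⁻ : ∀ u {x z} → Before (suc (toℕ u)) 0 x z → Before (toℕ u) n x z
    row⁻ u {x} {z} (inj₁ lt) with ℕ.m≤n⇒m<n∨m≡n (ℕ.≤-pred lt)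
    ... | inj₁ x<u = inj₁ x<u
    ... | inj₂ x≡u = inj₂ (x≡u , toℕ<n z)

-- Verification: dynamic programming

any-false : ∀ {A : Set} (f : A → Bool) {xs x} → any f xs ≡ false → x ∈ xs → f x ≡ false
any-false f eq (here refl) = ∨-falseˡ eq
any-false f {y ∷ xs} eq (there x∈) = any-false f (∨-falseʳ {f y} eq) x∈

module Tables (ℝ : RealNumbers) {n : ℕ} (D : Digraph n) (c : Weighted.WeightFunction ℝ D)
              (comp : Fin n → Fin n) (e : Fin n → Fin n → RealNumbers.Carrier ℝ) (selected : ℕ → Bool) where
  open RealNumbers ℝ using (Carrier)
  open Machine ℝ
  open APSP ℝ D c
  open ProgramLogic ℝ
  open Common ℝ D c
  open Binary selected

  sq : ℕ
  sq = n ℕ.* n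

  address : ℕ → Fin n → Fin n → ℕ
  address S x z = S ℕ.* sq ℕ.+ entry x z

  record Ready (τ : State) : Set where
    field
      basic   : Basic τ
      comp≡   : ∀ v → natMem τ compᵃ (toℕ v) ≡ toℕ (comp v)
      e≡      : ∀ x z → realMem τ eᵃ (entry x z) ≡ e x z
      square≡ : natMem τ squareᵃ 0 ≡ sq
      sets≡   : natMem τ setsᵃ 0 ≡ total n
      bit≡    : ∀ (r : Fin n) → natMem τ bitᵃ (toℕ r) ≡ bit (toℕ r)
      offset≡ : ∀ (r : Fin n) → natMem τ offsetᵃ (toℕ r) ≡ bit (toℕ r) ℕ.* sq
    open Basic basic public

    cell≡ : ∀ {B X Y S x y} → evalℕ B τ ≡ S ℕ.* sq → evalℕ X τ ≡ toℕ x → evalℕ Y τ ≡ toℕ y →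
            evalℕ (cell B X Y) τ ≡ address S x y
    cell≡ {B} {X} {Y} B≡ X≡ Y≡ = cong₂ ℕ._+_ B≡ (at≡ {X} {Y} X≡ Y≡)

  -- The arrays on which `Ready` depends, listed so that a single `refl` per kind of memory shows
  -- that a program spares them all.
  keptℕ keptℝ : List ℕ
  keptℕ = sizeᵃ ∷ adjᵃ ∷ rowᵃ ∷ compᵃ ∷ squareᵃ ∷ setsᵃ ∷ bitᵃ ∷ offsetᵃ ∷ []
  keptℝ = weightᵃ ∷ eᵃ ∷ []

  keepReady : ∀ {p σ τ} → Agree p σ τ → any (writesℕ p) keptℕ ≡ false → any (writesℝ p) keptℝ ≡ false →
              Ready σ → Ready τ
  keepReady {p} ag nats reals R = record
    { basic = keepBasic ag (n∉ (here refl)) (n∉ (there (here refl))) (n∉ (there (there (here refl)))) (r∉ (here refl)) basic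
    ; comp≡ = λ v → trans (Agree.nat ag compᵃ (n∉ (there (there (there (here refl))))) _) (comp≡ v)
    ; e≡ = λ x z → trans (Agree.real ag eᵃ (r∉ (there (here refl))) _) (e≡ x z)
    ; square≡ = trans (Agree.nat ag squareᵃ (n∉ (there (there (there (there (here refl)))))) 0) square≡
    ; sets≡ = trans (Agree.nat ag setsᵃ (n∉ (there (there (there (there (there (here refl))))))) 0) sets≡
    ; bit≡ = λ r → trans (Agree.nat ag bitᵃ (n∉ (there (there (there (there (there (there (here refl)))))))) _) (bit≡ r)
    ; offset≡ = λ r → trans (Agree.nat ag offsetᵃ (n∉ (there (there (there (there (there (there (there (here refl))))))))) _) (offset≡ r)
    }
    where
    open Ready R
    n∉ : ∀ {a} → a ∈ keptℕ → writesℕ p a ≡ false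
    n∉ = any-false (writesℕ p) nats
    r∉ : ∀ {a} → a ∈ keptℝ → writesℝ p a ≡ false
    r∉ = any-false (writesℝ p) reals

  bitsE : ∀ {σ} → Basic σ → (∀ v → natMem σ compᵃ (toℕ v) ≡ toℕ (comp v)) → (∀ x z → realMem σ eᵃ (entry x z) ≡ e x z) →
          natMem σ squareᵃ 0 ≡ sq → (∀ r → (1 ≤ᵇ natMem σ treeᵃ r) ≡ selected r) → Exec bits σ (Level 1) Ready
  bitsE {σ} B comp≡ e≡ square≡ tree≡ = setℕ⨾ (1≤Level 1) (setℕ⨾ (1≤Level 1) (mapE
    (forE {m = n} (1≤Level 0) 1≤N n≤N (Basic.size≡ B) refl refl refl Bits
      (refl , trans square≡ (sym (ℕ.+-identityʳ sq)) , λ _ ())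
      λ k τ ag i≡ (sets , volume , rows) → ifE ℕ.≤-refl
        (λ eq → setℕ⨾ ℕ.≤-refl (setℕ⨾ ℕ.≤-refl (setℕ⨾ ℕ.≤-refl (setℕE ℕ.≤-refl
          (let sel = trans (sym (guard k τ ag i≡)) eq in
             trans (cong₂ ℕ._+_ sets sets) (cong (total (toℕ k) ℕ.+_) (sym (bit-selected sel)))
           , trans (cong₂ ℕ._+_ volume volume) (trans (sym (ℕ.*-distribʳ-+ sq (total (toℕ k)) (total (toℕ k))))
               (cong (λ b → (total (toℕ k) ℕ.+ b) ℕ.* sq) (sym (bit-selected sel))))
           , λ r r≤k → extend k (natMem τ bitᵃ) (natMem τ offsetᵃ) i≡ rows (trans sets (sym (bit-selected sel)))
                         (trans volume (cong (ℕ._* sq) (sym (bit-selected sel)))) r r≤k)))))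
        (λ eq → setℕ⨾ ℕ.≤-refl (setℕE ℕ.≤-refl
          (let unsel = trans (sym (guard k τ ag i≡)) eq ; same = sym (trans (cong (total (toℕ k) ℕ.+_) (bit-unselected {toℕ k} unsel)) (ℕ.+-identityʳ _)) in
             trans sets same , trans volume (cong (ℕ._* sq) same)
           , λ r r≤k → extend k (natMem τ bitᵃ) (natMem τ offsetᵃ) i≡ rows (sym (bit-unselected {toℕ k} unsel)) (cong (ℕ._* sq) (sym (bit-unselected {toℕ k} unsel))) r r≤k))))
    λ τ ag (sets , _ , rows) → record
      { basic = keepBasic ag refl refl refl refl B₀
      ; comp≡ = λ v → trans (Agree.nat ag compᵃ refl _) (comp≡ v)
      ; e≡ = λ x z → trans (Agree.real ag eᵃ refl _) (e≡ x z)
      ; square≡ = trans (Agree.nat ag squareᵃ refl 0) square≡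
      ; sets≡ = sets
      ; bit≡ = λ r → proj₁ (rows r (toℕ<n r))
      ; offset≡ = λ r → proj₂ (rows r (toℕ<n r)) }))
    where
    σ₀ = writeℕ volumeᵃ 0 (natMem σ squareᵃ 0) (writeℕ setsᵃ 0 1 σ)
    B₀ : Basic σ₀
    B₀ = record { Basic B }
    Bits : ℕ → State → Set
    Bits j τ = natMem τ setsᵃ 0 ≡ total j × natMem τ volumeᵃ 0 ≡ total j ℕ.* sq
             × (∀ (r : Fin n) → toℕ r ℕ.< j → natMem τ bitᵃ (toℕ r) ≡ bit (toℕ r) × natMem τ offsetᵃ (toℕ r) ≡ bit (toℕ r) ℕ.* sq)
    guard : ∀ k τ → Agree (for i₁ᵃ sizeᵃ bitsBody) σ₀ τ → natMem τ i₁ᵃ 0 ≡ toℕ k →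
            (1 ≤ᵇ natMem τ treeᵃ (natMem τ i₁ᵃ 0)) ≡ selected (toℕ k)
    guard k τ ag i≡ = trans (cong (1 ≤ᵇ_) (trans (Agree.nat ag treeᵃ refl _) (cong (natMem σ treeᵃ) i≡))) (tree≡ (toℕ k))
    extend : ∀ (k : Fin n) (B O : ℕ → ℕ) {i b o : ℕ} → i ≡ toℕ k →
             (∀ (r : Fin n) → toℕ r ℕ.< toℕ k → B (toℕ r) ≡ bit (toℕ r) × O (toℕ r) ≡ bit (toℕ r) ℕ.* sq) →
             b ≡ bit (toℕ k) → o ≡ bit (toℕ k) ℕ.* sq → ∀ (r : Fin n) → toℕ r ℕ.< suc (toℕ k) →
             (if i ≡ᵇ toℕ r then b else B (toℕ r)) ≡ bit (toℕ r) × (if i ≡ᵇ toℕ r then o else O (toℕ r)) ≡ bit (toℕ r) ℕ.* sq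
    extend k B O refl rows b≡ o≡ r r≤k =
        updated (λ k≡r → trans b≡ (cong bit k≡r)) (λ k≢r → proj₁ (old k≢r))
      , updated (λ k≡r → trans o≡ (cong (λ k → bit k ℕ.* sq) k≡r)) (λ k≢r → proj₂ (old k≢r))
      where
      old : toℕ k ≢ toℕ r → _
      old k≢r = rows r (ℕ.≤∧≢⇒< (ℕ.≤-pred r≤k) (λ r≡k → k≢r (sym r≡k)))

  Empty : ℕ → Fin n → Fin n → State → Set
  Empty S x z τ = natMem τ finᵃ (address S x z) ≡ 0 × natMem τ finExitᵃ (address S x z) ≡ 0

  Vanishing : State → State → Set
  Vanishing σ τ = ∀ i → (natMem σ finᵃ i ≡ 0 → natMem τ finᵃ i ≡ 0) × (natMem σ finExitᵃ i ≡ 0 → natMem τ finExitᵃ i ≡ 0)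

  vanishing-trans : ∀ σ τ υ → Vanishing σ τ → Vanishing τ υ → Vanishing σ υ
  vanishing-trans _ _ _ p q i = (λ z → proj₁ (q i) (proj₁ (p i) z)) , (λ z → proj₂ (q i) (proj₂ (p i) z))

  empty-mono : ∀ S x z σ τ → Vanishing σ τ → Empty S x z σ → Empty S x z τ
  empty-mono _ _ _ _ _ p (f , g) = proj₁ (p _) f , proj₂ (p _) g

  1≤setLoop : ∀ d → 1 ℕ.≤ total n ℕ.* Level d
  1≤setLoop d = ℕ.*-mono-≤ (total-positive n) (1≤Level d)

  clearE : ∀ {σ} → Ready σ → Exec clear σ (total n ℕ.* Level 2) (λ τ → ∀ S x z → S ℕ.< total n → Empty S x z τ)
  clearE {σ} R = setℕ⨾ (1≤setLoop 2) (mapE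
    (forE {m = total n} (1≤Level 2) (total-positive n) ℕ.≤-refl sets≡ refl refl refl
      (λ j τ → natMem τ baseᵃ 0 ≡ j ℕ.* sq × (∀ S x z → S ℕ.< j → Empty S x z τ))
      (refl , λ _ _ _ ())
      λ S τ₁ ag₁ _ (base≡ , empty) → let R₁ = keepReady ag₁ refl refl R₀ in seqE
        (forallE {m = n} (1≤Level 1) 1≤N n≤N (Ready.size≡ R₁) refl refl refl
          -- `n ≡ n` is the trivial invariant; the progress is carried by `Vanishing`, as cells once
          -- zeroed remain zero.
          (λ _ → n ≡ n) Vanishing (λ x τ → ∀ z → Empty (toℕ S) x z τ)
          (λ _ _ p → p) (λ _ _ _ → (λ p → p) , (λ p → p)) vanishing-trans
          (λ x σ τ p f z → empty-mono (toℕ S) x z σ τ p (f z)) refl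
          λ x τ₂ ag₂ i₂≡ _ _ → let R₂ = keepReady ag₂ refl refl R₁ in mapE
            (forallE {m = n} (1≤Level 0) 1≤N n≤N (Ready.size≡ R₂) refl refl refl
              (λ _ → n ≡ n) Vanishing (λ z τ → Empty (toℕ S) x z τ)
              (λ _ _ p → p) (λ _ _ _ → (λ p → p) , (λ p → p)) vanishing-trans
              (λ z σ τ p f → empty-mono (toℕ S) x z σ τ p f) refl
              λ z τ₃ ag₃ i₃≡ _ _ → let
                  R₃ = keepReady ag₃ refl refl R₂
                  base₃ = trans (Agree.nat ag₃ baseᵃ refl 0) (trans (Agree.nat ag₂ baseᵃ refl 0) base≡)
                  a≡ = Ready.cell≡ R₃ {base} {i₂} {i₃} {toℕ S} base₃ (trans (Agree.nat ag₃ i₂ᵃ refl 0) i₂≡) i₃≡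
                  a = evalℕ (cell base i₂ i₃) τ₃
                  zeroed : ∀ i {y} → y ≡ 0 → (if a ≡ᵇ i then 0 else y) ≡ 0
                  zeroed i e = updated {i = a} {i} (λ _ → refl) (λ _ → e)
                in setℕ⨾ ℕ.≤-refl (setℕE ℕ.≤-refl
                  ( refl
                  , (λ i → (λ e → zeroed i e) , (λ e → zeroed i e))
                  , updated {i = a} {address (toℕ S) x z} (λ _ → refl) (λ neq → ⊥-elim (neq a≡))
                  , updated {i = a} {address (toℕ S) x z} (λ _ → refl) (λ neq → ⊥-elim (neq a≡)))))
            λ _ _ p → p)
        λ τ₂ ag₂ (_ , van , facts) → setℕE (1≤Level 2)
          ( trans (cong₂ ℕ._+_ (trans (Agree.nat ag₂ baseᵃ refl 0) base≡) (Ready.square≡ (keepReady ag₂ refl refl R₁)))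
                  (ℕ.+-comm (toℕ S ℕ.* sq) sq)
          , λ S′ x z S′≤S → cases S S′ x z τ₁ τ₂ (ℕ.≤-pred S′≤S) empty van facts))
    λ τ ag (_ , empty) S x z S< → empty S x z S<)
    where
    open Ready R
    σ₀ = writeℕ baseᵃ 0 0 σ
    R₀ : Ready σ₀
    R₀ = keepReady (agree-run (⇓setℕ {baseᵃ} {lit 0} {lit 0})) refl refl R
    cases : ∀ (S : Fin (total n)) S′ x z τ₁ τ₂ → S′ ℕ.≤ toℕ S → (∀ S′ x z → S′ ℕ.< toℕ S → Empty S′ x z τ₁) → Vanishing τ₁ τ₂ →
            (∀ x z → Empty (toℕ S) x z τ₂) → Empty S′ x z τ₂
    cases S S′ x z τ₁ τ₂ le old van new with ℕ.m≤n⇒m<n∨m≡n le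
    ... | inj₁ lt   = empty-mono S′ x z τ₁ τ₂ van (old S′ x z lt)
    ... | inj₂ refl = new x z

∧-false : ∀ {a b} → a ∧ b ≡ false → a ≡ true → b ≡ false
∧-false eq refl = eq

-- Relaxation of table entries

module Relaxing (ℝ : RealNumbers) where
  open RealNumbers ℝ
  open LinearArithmetic ℝ
  open Machine ℝ
  open ProgramLogic ℝ

  Below : ℕ → ℕ → State → ℕ → Carrier → Set
  Below f r τ a w = 1 ℕ.≤ natMem τ f a × realMem τ r a ≤ w

  Mono : ℕ → ℕ → State → State → Set
  Mono f r σ τ = ∀ a w → Below f r σ a w → Below f r τ a w

  mono-trans : ∀ {f r} σ τ υ → Mono f r σ τ → Mono f r τ υ → Mono f r σ υ
  mono-trans _ _ _ p q a w b = q a w (p a w b)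

  record Relaxed (f r a : ℕ) (v : Carrier) (σ τ : State) : Set where
    field
      hit   : Below f r τ a v
      mono  : Mono f r σ τ
      cells : ∀ j → (natMem τ f j ≡ natMem σ f j × realMem τ r j ≡ realMem σ r j) ⊎ (j ≡ a × realMem τ r j ≡ v)

  -- `relax` evaluates its index twice, the second time after a real cell has been overwritten.
  evalℕ-writeℝ : ∀ e r a v σ → evalℕ e (writeℝ r a v σ) ≡ evalℕ e σ
  evalℕ-writeℝ (lit _) r a v σ = refl
  evalℕ-writeℝ (getℕ x i) r a v σ = cong (natMem σ x) (evalℕ-writeℝ i r a v σ)
  evalℕ-writeℝ (d ⊕ e) r a v σ = cong₂ ℕ._+_ (evalℕ-writeℝ d r a v σ) (evalℕ-writeℝ e r a v σ)
  evalℕ-writeℝ (d ⊖ e) r a v σ = cong₂ _∸_ (evalℕ-writeℝ d r a v σ) (evalℕ-writeℝ e r a v σ)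

  update-same : ∀ {A : Set} (m : ℕ → ℕ → A) x a v j → update m x a v x j ≡ (if a ≡ᵇ j then v else m x j)
  update-same m x a v j rewrite ≡ᵇ-refl x = refl

  relaxE : ∀ {f r i v σ X} → 1 ℕ.≤ X → Exec (relax f r i v) σ X (Relaxed f r (evalℕ i σ) (evalℝ v σ) σ)
  relaxE {f} {r} {i} {v} {σ} 1≤X = ifE 1≤X
    (λ eq → let fin , le = ∧-true eq in skipE 1≤X record
      { hit = ≤ᵇ-true⁻ fin , ≤?-true le ; mono = λ _ _ b → b ; cells = λ _ → inj₁ (refl , refl) })
    (λ eq → setℝ⨾ 1≤X (setℕE 1≤X (done eq)))
    where
    a = evalℕ i σ
    d = evalℝ v σ
    σ₁ = writeℝ r a d σ
    τ = writeℕ f (evalℕ i σ₁) 1 σ₁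
    fin≡ : ∀ j → natMem τ f j ≡ (if a ≡ᵇ j then 1 else natMem σ f j)
    fin≡ j = trans (update-same (natMem σ) f (evalℕ i σ₁) 1 j)
      (cong (λ k → if k ≡ᵇ j then 1 else natMem σ f j) (evalℕ-writeℝ i r a d σ))
    dist≡ : ∀ j → realMem τ r j ≡ (if a ≡ᵇ j then d else realMem σ r j)
    dist≡ j = update-same (realMem σ) r a d j
    fin-hit : natMem τ f a ≡ 1
    fin-hit = trans (fin≡ a) (select-same a)
    dist-hit : realMem τ r a ≡ d
    dist-hit = trans (dist≡ a) (select-same a)
    done : evalB ((lit 1 ≤ⁿ getℕ f i) ∧ᵇ (getℝ r i ≤ʳ v)) σ ≡ false → Relaxed f r a d σ τ
    done eq = record { hit = ℕ.≤-reflexive (sym fin-hit) , ≤-reflexive (≡⇒≈ dist-hit) ; mono = mono ; cells = cells }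
      where
      mono : Mono f r σ τ
      mono j w (fin , le) with a ℕ.≟ j
      ... | no a≢j = subst (1 ℕ.≤_) (sym (trans (fin≡ j) (select-other a≢j))) fin
                   , ≤-trans (≤-reflexive (≡⇒≈ (trans (dist≡ j) (select-other a≢j)))) le
      ... | yes refl = ℕ.≤-reflexive (sym fin-hit)
                   , ≤-trans (≤-reflexive (≡⇒≈ dist-hit)) (≤-trans (proj₁ (≰⇒> (≤?-false (∧-false eq (≤ᵇ-true fin))))) le)
      cells : ∀ j → (natMem τ f j ≡ natMem σ f j × realMem τ r j ≡ realMem σ r j) ⊎ (j ≡ a × realMem τ r j ≡ d)
      cells j with a ℕ.≟ j
      ... | no a≢j   = inj₁ (trans (fin≡ j) (select-other a≢j) , trans (dist≡ j) (select-other a≢j))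
      ... | yes refl = inj₂ (refl , dist-hit)

-- The tables during the rounds

module Dynamic
  (ℝ : RealNumbers) {n : ℕ} (D : Digraph n) (c : Weighted.WeightFunction ℝ D)
  {E : Weights.Edges ℝ D c} {comp : Fin n → Fin n} {e : Fin n → Fin n → RealNumbers.Carrier ℝ}
  (F : Weights.Forest ℝ D c E comp e) (selected : ℕ → Bool)
  (nontrivial : ∀ {u v} → Weighted.NegativeEdge ℝ D c u v → selected (toℕ (comp u)) ≡ true)
  where
  open RealNumbers ℝ
  open LinearArithmetic ℝ
  open Digraph D
  open Weighted ℝ D
  open Machine ℝ
  open APSP ℝ D c
  open ProgramLogic ℝ
  open Common ℝ D c
  open Binary selected
  open Tables ℝ D c comp e selected
  open Routes ℝ D c comp e (encoding n)
  open Soundness ℝ D c F nontrivial (encoding n)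
  open Relaxing ℝ
  open Encoding (encoding n) using (add-<)

  address-injective : ∀ S x z S′ x′ z′ → S ℕ.< total n → S′ ℕ.< total n → address S x z ≡ address S′ x′ z′ →
                      S ≡ S′ × x ≡ x′ × z ≡ z′
  address-injective S x z S′ x′ z′ S< S′< eq = numbers , combine-injective x z x′ z′ (proj₂ both)
    where
    as-address : ∀ {S} (S< : S ℕ.< total n) x z → toℕ (combine (fromℕ< S<) (combine x z)) ≡ address S x z
    as-address {S} S< x z = trans (toℕ-combine (fromℕ< S<) (combine x z))
      (cong₂ ℕ._+_ (trans (ℕ.*-comm sq _) (cong (ℕ._* sq) (toℕ-fromℕ< S<)))
                   (trans (toℕ-combine x z) (cong (ℕ._+ toℕ z) (ℕ.*-comm n (toℕ x)))))
    both : fromℕ< S< ≡ fromℕ< S′< × combine x z ≡ combine x′ z′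
    both = combine-injective (fromℕ< S<) (combine x z) (fromℕ< S′<) (combine x′ z′)
      (toℕ-injective (trans (as-address S< x z) (trans eq (sym (as-address S′< x′ z′)))))
    numbers : S ≡ S′
    numbers = trans (sym (toℕ-fromℕ< S<)) (trans (cong toℕ (proj₁ both)) (toℕ-fromℕ< S′<))

  Sound : (ℕ → Fin n → Fin n → Carrier → Set) → ℕ → ℕ → State → Set
  Sound G f r τ = ∀ S x z → S ℕ.< total n → 1 ℕ.≤ natMem τ f (address S x z) → G S x z (realMem τ r (address S x z))

  sound-relaxed : ∀ G {f r S x z v σ τ} → S ℕ.< total n → Relaxed f r (address S x z) v σ τ → G S x z v →
                  Sound G f r σ → Sound G f r τ
  sound-relaxed G {S = S} {x} {z} S< R good sound S′ x′ z′ S′< fin with Relaxed.cells R (address S′ x′ z′)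
  ... | inj₁ (f≡ , r≡) = subst (G S′ x′ z′) (sym r≡) (sound S′ x′ z′ S′< (subst (1 ℕ.≤_) f≡ fin))
  ... | inj₂ (a≡ , r≡) with address-injective S′ x′ z′ S x z S′< S< a≡
  ...   | refl , refl , refl = subst (G S x z) (sym r≡) good

  SoundWalks SoundExits : State → Set
  SoundWalks = Sound GoodWalk finᵃ distᵃ
  SoundExits = Sound GoodExit finExitᵃ distExitᵃ

  record AtSet (S : ℕ) (τ : State) : Set where
    field
      ready : Ready τ
      base≡ : natMem τ baseᵃ 0 ≡ S ℕ.* sq
    open Ready ready public

  keepAtSet : ∀ {p S σ τ} → Agree p σ τ → any (writesℕ p) keptℕ ≡ false → any (writesℝ p) keptℝ ≡ false →
              writesℕ p baseᵃ ≡ false → AtSet S σ → AtSet S τ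
  keepAtSet ag nats reals b A = record
    { ready = keepReady ag nats reals ready ; base≡ = trans (Agree.nat ag baseᵃ b 0) base≡ }
    where open AtSet A

  -- `exits` only reads the tables of walks, and `moves` only those of exits. What each of them
  -- finds can therefore be stated relative to the tables at its start.
  Frozen : ℕ → ℕ → State → State → Set
  Frozen f r σ τ = (∀ i → natMem τ f i ≡ natMem σ f i) × (∀ i → realMem τ r i ≡ realMem σ r i)

  keepFrozen : ∀ {f r p σ τ υ} → Agree p τ υ → writesℕ p f ≡ false → writesℝ p r ≡ false → Frozen f r σ τ → Frozen f r σ υ
  keepFrozen ag nf nr (f≡ , r≡) = (λ i → trans (Agree.nat ag _ nf i) (f≡ i)) , (λ i → trans (Agree.real ag _ nr i) (r≡ i))

  sound-frozen : ∀ G {f r σ τ} → Frozen f r σ τ → Sound G f r σ → Sound G f r τ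
  sound-frozen G (f≡ , r≡) sound S x z S< fin = subst (G S x z) (sym (r≡ _)) (sound S x z S< (subst (1 ℕ.≤_) (f≡ _) fin))

  flag : Bool → ℕ
  flag b = if b then 1 else 0

  Decoded : ℕ → State → Set
  Decoded S τ = ∀ (r : Fin n) → natMem τ blockedᵃ (toℕ r) ≡ flag (digits n S (toℕ r))

  -- After `j` iterations the top `j` labels are decoded, and the remaining digits of `S` are those
  -- of the number left in `restᵃ`.
  decodeE : ∀ {S σ} → AtSet S σ → natMem σ i₂ᵃ 0 ≡ S → Exec decode σ (Level 1) (Decoded S)
  decodeE {S} {σ} A i₂≡ = setℕ⨾ (1≤Level 1) (mapE
    (forE {m = n} ℕ.≤-refl 1≤N n≤N size≡ refl refl refl
      (λ j τ → (∀ r → r ℕ.< n ∸ j → digits n S r ≡ digits (n ∸ j) (natMem τ restᵃ 0) r)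
             × (∀ (r : Fin n) → n ∸ j ℕ.≤ toℕ r → natMem τ blockedᵃ (toℕ r) ≡ flag (digits n S (toℕ r))))
      ((λ r _ → cong (λ v → digits n v r) (sym i₂≡)) , λ r n≤r → ⊥-elim (ℕ.<⇒≱ (toℕ<n r) n≤r))
      step)
    λ τ ag (_ , decoded) r → decoded r (subst (ℕ._≤ toℕ r) (sym (ℕ.n∸n≡0 n)) z≤n))
    where
    open AtSet A
    step : ∀ (k : Fin n) τ → Agree (for i₃ᵃ sizeᵃ decodeBody) (writeℕ restᵃ 0 (natMem σ i₂ᵃ 0) σ) τ → natMem τ i₃ᵃ 0 ≡ toℕ k →
           (∀ r → r ℕ.< n ∸ toℕ k → digits n S r ≡ digits (n ∸ toℕ k) (natMem τ restᵃ 0) r)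
           × (∀ (r : Fin n) → n ∸ toℕ k ℕ.≤ toℕ r → natMem τ blockedᵃ (toℕ r) ≡ flag (digits n S (toℕ r))) →
           Exec decodeBody τ 1 (λ υ →
             (∀ r → r ℕ.< n ∸ suc (toℕ k) → digits n S r ≡ digits (n ∸ suc (toℕ k)) (natMem υ restᵃ 0) r)
             × (∀ (r : Fin n) → n ∸ suc (toℕ k) ℕ.≤ toℕ r → natMem υ blockedᵃ (toℕ r) ≡ flag (digits n S (toℕ r))))
    step k τ ag i≡ (below , above) = ifE ℕ.≤-refl
      (λ eq → let top = trans (sym digit≡) eq in setℕ⨾ ℕ.≤-refl (setℕE ℕ.≤-refl
        ( (λ r r<m → trans (lower r r<m) (cong (λ v → digits m v r)
            (trans (remainder-true {m} top) (cong (rest ∸_) (sym bit′)))))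
        , upper 1 (cong flag (sym (trans here′ top))))))
      (λ eq → let top = trans (sym digit≡) eq in setℕE ℕ.≤-refl
        ( (λ r r<m → trans (lower r r<m) (cong (λ v → digits m v r) (remainder-false {m} top)))
        , upper 0 (cong flag (sym (trans here′ top)))))
      where
      m    = n ∸ suc (toℕ k)
      rest = natMem τ restᵃ 0
      suc-m : n ∸ toℕ k ≡ suc m
      suc-m = ℕ.+-∸-assoc 1 (toℕ<n k)
      m<n : m ℕ.< n
      m<n = subst (ℕ._≤ n) suc-m (ℕ.m∸n≤m n (toℕ k))
      label≡ : evalℕ label τ ≡ m
      label≡ = cong₂ _∸_ (trans (Agree.nat ag sizeᵃ refl 0) size≡) (cong suc i≡)
      bit′ : natMem τ bitᵃ (evalℕ label τ) ≡ bit m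
      bit′ = trans (Agree.nat ag bitᵃ refl _) (trans (cong (natMem σ bitᵃ) (trans label≡ (sym (toℕ-fromℕ< m<n))))
               (trans (bit≡ (fromℕ< m<n)) (cong bit (toℕ-fromℕ< m<n))))
      digit≡ : evalB ((lit 1 ≤ⁿ getℕ bitᵃ label) ∧ᵇ (getℕ bitᵃ label ≤ⁿ scalar restᵃ)) τ ≡ digit m rest
      digit≡ = cong (λ b → (1 ≤ᵇ b) ∧ (b ≤ᵇ rest)) bit′
      below′ : ∀ r → r ℕ.< suc m → digits n S r ≡ digits (suc m) rest r
      below′ r r< = trans (below r (subst (r ℕ.<_) (sym suc-m) r<)) (cong (λ m → digits m rest r) suc-m)
      here′ : digits n S m ≡ digit m rest
      here′ = trans (below′ m ℕ.≤-refl) (digits-here m rest)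
      lower : ∀ r → r ℕ.< m → digits n S r ≡ digits m (remainder m rest) r
      lower r r<m = trans (below′ r (ℕ.m≤n⇒m≤1+n r<m)) (digits-below {m} rest (ℕ.<⇒≢ r<m))
      upper : ∀ b → b ≡ flag (digits n S m) → ∀ (r : Fin n) → m ℕ.≤ toℕ r →
              (if evalℕ label τ ≡ᵇ toℕ r then b else natMem τ blockedᵃ (toℕ r)) ≡ flag (digits n S (toℕ r))
      upper b b≡ r m≤r = updated {i = evalℕ label τ} {toℕ r}
        (λ eq → trans b≡ (cong (λ r → flag (digits n S r)) (trans (sym label≡) eq)))
        (λ neq → above r (subst (ℕ._≤ toℕ r) (sym suc-m) (ℕ.≤∧≢⇒< m≤r (λ m≡r → neq (trans label≡ m≡r)))))

  Blocked : ℕ → Fin n → Bool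
  Blocked S r = digits n S (toℕ r)

  ExitsFound : ℕ → State → Fin n → State → Set
  ExitsFound S σ b τ = Blocked S (comp b) ≡ false →
    Below finExitᵃ distExitᵃ τ (address S b b) 0#
    × (∀ y t (a : Arc b y) w → Below finᵃ distᵃ σ (address (S ℕ.+ bit (toℕ (comp b))) y t) w →
       Below finExitᵃ distExitᵃ τ (address S b t) (c a + w))

  exitE : ∀ {S σ τ} b y t → S ℕ.< total n → AtSet S τ → Frozen finᵃ distᵃ σ τ → SoundWalks σ → SoundExits τ →
          Blocked S (comp b) ≡ false →
          natMem τ i₃ᵃ 0 ≡ toℕ b → natMem τ i₄ᵃ 0 ≡ toℕ y → natMem τ i₅ᵃ 0 ≡ toℕ t →
          Exec exitBody τ 1 (λ υ → SoundExits υ × Mono finExitᵃ distExitᵃ τ υ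
            × (∀ (a : Arc b y) w → Below finᵃ distᵃ σ (address (S ℕ.+ bit (toℕ (comp b))) y t) w →
               Below finExitᵃ distExitᵃ υ (address S b t) (c a + w)))
  exitE {S} {σ} {τ} b y t S< A (fin≡ , dist≡) sound soundE free i₃≡ i₄≡ i₅≡ = ifE ℕ.≤-refl
    (λ eq → let arc-eq , fin-eq = ∧-true eq
                a = ≡⇒T (trans (sym (arcᵇ≡ {i₃} {i₄} i₃≡ i₄≡)) arc-eq) in
      mapE (relaxE ℕ.≤-refl) λ υ _ R → let R = subst (λ i → Relaxed finExitᵃ distExitᵃ i v τ υ) cell-eq R in
        sound-relaxed GoodExit S< R
          (goodLeave S< free a (sound S′ y t (add-< S< free) (subst (1 ℕ.≤_) fin-next (≤ᵇ-true⁻ fin-eq)))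
            (≤-reflexive (≈-sym (v≈ a)))) soundE
        , Relaxed.mono R
        , λ a′ w (_ , le) → proj₁ (Relaxed.hit R) , ≤-trans (proj₂ (Relaxed.hit R))
            (≤-trans (≤-reflexive (v≈ a′)) (+-monoʳ-≤ (c a′) le)))
    (λ eq → skipE ℕ.≤-refl (soundE , (λ _ _ p → p) , λ a w (fin , _) →
      ⊥-elim (absurd (trans (sym (cong₂ _∧_ (trans (arcᵇ≡ {i₃} {i₄} i₃≡ i₄≡) (T⇒≡ a))
        (≤ᵇ-true (subst (1 ℕ.≤_) (sym fin-next) fin)))) eq))))
    where
    open AtSet A
    S′ = S ℕ.+ bit (toℕ (comp b))
    v = evalℝ (getℝ weightᵃ (at i₃ i₄) ⊕ʳ getℝ distᵃ next) τ
    absurd : ¬ true ≡ false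
    absurd ()
    base′ : evalℕ (base ⊕ getℕ offsetᵃ (getℕ compᵃ i₃)) τ ≡ S′ ℕ.* sq
    base′ = trans (cong₂ ℕ._+_ base≡ (trans (cong (natMem τ offsetᵃ) (trans (cong (natMem τ compᵃ) i₃≡) (comp≡ b))) (offset≡ (comp b))))
                  (sym (ℕ.*-distribʳ-+ sq S _))
    next≡ : evalℕ next τ ≡ address S′ y t
    next≡ = cell≡ {base ⊕ getℕ offsetᵃ (getℕ compᵃ i₃)} {i₄} {i₅} {S′} base′ i₄≡ i₅≡
    cell-eq : evalℕ (cell base i₃ i₅) τ ≡ address S b t
    cell-eq = cell≡ {base} {i₃} {i₅} {S} base≡ i₃≡ i₅≡
    fin-next : natMem τ finᵃ (evalℕ next τ) ≡ natMem σ finᵃ (address S′ y t)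
    fin-next = trans (cong (natMem τ finᵃ) next≡) (fin≡ _)
    v≈ : ∀ (a : Arc b y) → v ≈ c a + realMem σ distᵃ (address S′ y t)
    v≈ a = +-cong (≈-trans (≡⇒≈ (cong (realMem τ weightᵃ) (at≡ {i₃} {i₄} i₃≡ i₄≡))) (weights≈ a))
                  (≡⇒≈ (trans (cong (realMem τ distᵃ) next≡) (dist≡ _)))

  exitsE : ∀ {S σ} → S ℕ.< total n → AtSet S σ → Decoded S σ → SoundWalks σ → SoundExits σ →
           Exec exits σ (Level 3) (λ τ → SoundExits τ × Mono finExitᵃ distExitᵃ σ τ × (∀ b → ExitsFound S σ b τ))
  exitsE {S} {σ} S< A decoded sound soundE =
    forallE {m = n} (1≤Level 2) 1≤N n≤N (AtSet.size≡ A) refl refl refl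
      SoundExits (Mono finExitᵃ distExitᵃ) (ExitsFound S σ)
      (λ _ _ p → p) (λ _ _ _ _ p → p) mono-trans
      (λ b τ υ mono found free → let p , q = found free in mono _ _ p
        , λ y t a w below → mono _ _ (q y t a w below)) soundE
      λ b τ₁ ag₁ i₃≡ _ sound₁ → let
          A₁ = keepAtSet ag₁ refl refl refl A
          F₁ = keepFrozen {finᵃ} {distᵃ} {σ = σ} ag₁ refl refl ((λ _ → refl) , (λ _ → refl))
          blocked≡ = trans (Agree.nat ag₁ blockedᵃ refl _) (trans (cong (natMem σ blockedᵃ)
                       (trans (cong (natMem τ₁ compᵃ) i₃≡) (AtSet.comp≡ A₁ b))) (decoded (comp b)))
        in ifE (1≤Level 2)
        (λ eq → let free = unflag (trans (cong (_≤ᵇ 0) (sym blocked≡)) eq) in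
          seqE (relaxE (1≤Level 2)) λ τ₂ ag₂ R → let
              R = subst (λ i → Relaxed finExitᵃ distExitᵃ i 0# τ₁ τ₂) (AtSet.cell≡ A₁ {base} {i₃} {i₃} {S} (AtSet.base≡ A₁) i₃≡ i₃≡) R
              A₂ = keepAtSet ag₂ refl refl refl A₁
              F₂ = keepFrozen {finᵃ} {distᵃ} {σ = σ} ag₂ refl refl F₁
            in mapE (forallE {m = n} (1≤Level 1) 1≤N n≤N (AtSet.size≡ A₂) refl refl refl
                 SoundExits (Mono finExitᵃ distExitᵃ)
                 (λ y τ → ∀ t (a : Arc b y) w → Below finᵃ distᵃ σ (address (S ℕ.+ bit (toℕ (comp b))) y t) w →
                   Below finExitᵃ distExitᵃ τ (address S b t) (c a + w))
                 (λ _ _ p → p) (λ _ _ _ _ p → p) mono-trans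
                 (λ y τ υ mono found t a w below → mono _ _ (found t a w below))
                 (sound-relaxed GoodExit S< R (goodStop free ≤-refl) sound₁)
                 λ y τ₃ ag₃ i₄≡ _ sound₃ → let
                     A₃ = keepAtSet ag₃ refl refl refl A₂
                     F₃ = keepFrozen {finᵃ} {distᵃ} {σ = σ} ag₃ refl refl F₂
                   in forallE {m = n} (1≤Level 0) 1≤N n≤N (AtSet.size≡ A₃) refl refl refl
                     SoundExits (Mono finExitᵃ distExitᵃ)
                     (λ t τ → ∀ (a : Arc b y) w → Below finᵃ distᵃ σ (address (S ℕ.+ bit (toℕ (comp b))) y t) w →
                       Below finExitᵃ distExitᵃ τ (address S b t) (c a + w))
                     (λ _ _ p → p) (λ _ _ _ _ p → p) mono-trans
                     (λ t τ υ mono found a w below → mono _ _ (found a w below)) sound₃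
                     λ t τ₄ ag₄ i₅≡ _ sound₄ → exitE {S} {σ} b y t S< (keepAtSet ag₄ refl refl refl A₃)
                       (keepFrozen {finᵃ} {distᵃ} {σ = σ} ag₄ refl refl F₃) sound sound₄ free
                       (trans (Agree.nat ag₄ i₃ᵃ refl 0) (trans (Agree.nat ag₃ i₃ᵃ refl 0) (trans (Agree.nat ag₂ i₃ᵃ refl 0) i₃≡)))
                       (trans (Agree.nat ag₄ i₄ᵃ refl 0) i₄≡) i₅≡)
            λ τ₃ _ (sound₃ , mono₃ , found) → sound₃ , mono-trans τ₁ τ₂ τ₃ (Relaxed.mono R) mono₃
              , λ _ → mono₃ _ _ (Relaxed.hit R) , found)
        (λ eq → skipE (1≤Level 2) (sound₁ , (λ _ _ p → p) , λ free →
          ⊥-elim (nonzero free (trans (cong (_≤ᵇ 0) (sym blocked≡)) eq))))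
    where
    unflag : ∀ {b} → (flag b ≤ᵇ 0) ≡ true → b ≡ false
    unflag {false} _ = refl
    nonzero : ∀ {b} → b ≡ false → ¬ (flag b ≤ᵇ 0) ≡ false
    nonzero refl ()

  MovesFound : ℕ → State → Fin n → Fin n → Fin n → State → Set
  MovesFound S σ s b t τ = comp b ≡ comp s → ∀ w → Below finExitᵃ distExitᵃ σ (address S b t) w →
    Below finᵃ distᵃ τ (address S s t) (w - e b s)

  moveE : ∀ {S σ τ} s b t → S ℕ.< total n → AtSet S τ → Frozen finExitᵃ distExitᵃ σ τ → SoundExits σ → SoundWalks τ →
          comp b ≡ comp s →
          natMem τ i₃ᵃ 0 ≡ toℕ s → natMem τ i₄ᵃ 0 ≡ toℕ b → natMem τ i₅ᵃ 0 ≡ toℕ t →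
          Exec moveBody τ 1 (λ υ → SoundWalks υ × Mono finᵃ distᵃ τ υ × MovesFound S σ s b t υ)
  moveE {S} {σ} {τ} s b t S< A (fin≡ , dist≡) soundE sound b~s i₃≡ i₄≡ i₅≡ = ifE ℕ.≤-refl
    (λ eq → mapE (relaxE ℕ.≤-refl) λ υ _ R → let R = subst (λ i → Relaxed finᵃ distᵃ i v τ υ) cell-eq R in
        sound-relaxed GoodWalk S< R
          (goodMove b~s (soundE S b t S< (subst (1 ℕ.≤_) fin-exit (≤ᵇ-true⁻ eq))) (≤-reflexive (≡⇒≈ (sym v≡)))) sound
        , Relaxed.mono R
        , λ _ w (_ , le) → proj₁ (Relaxed.hit R) , ≤-trans (proj₂ (Relaxed.hit R)) (≤-trans (≤-reflexive (≡⇒≈ v≡))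
            (linear (realMem σ distExitᵃ (address S b t) ∷ w ∷ e b s ∷ []) ((#0 ≼ #1) ∷ []) (#0 ⊟ #2 ≼ #1 ⊟ #2) refl (le , tt))))
    (λ eq → skipE ℕ.≤-refl (sound , (λ _ _ p → p) , λ _ w (fin , _) →
      ⊥-elim (absurd (trans (sym (≤ᵇ-true (subst (1 ℕ.≤_) (sym fin-exit) fin))) eq))))
    where
    open AtSet A
    v = evalℝ (getℝ distExitᵃ (cell base i₄ i₅) ⊖ʳ getℝ eᵃ (at i₄ i₃)) τ
    absurd : ¬ true ≡ false
    absurd ()
    exit≡ : evalℕ (cell base i₄ i₅) τ ≡ address S b t
    exit≡ = cell≡ {base} {i₄} {i₅} {S} base≡ i₄≡ i₅≡
    cell-eq : evalℕ (cell base i₃ i₅) τ ≡ address S s t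
    cell-eq = cell≡ {base} {i₃} {i₅} {S} base≡ i₃≡ i₅≡
    fin-exit : natMem τ finExitᵃ (evalℕ (cell base i₄ i₅) τ) ≡ natMem σ finExitᵃ (address S b t)
    fin-exit = trans (cong (natMem τ finExitᵃ) exit≡) (fin≡ _)
    v≡ : v ≡ realMem σ distExitᵃ (address S b t) - e b s
    v≡ = cong₂ _-_ (trans (cong (realMem τ distExitᵃ) exit≡) (dist≡ _))
                   (trans (cong (realMem τ eᵃ) (at≡ {i₄} {i₃} i₄≡ i₃≡)) (e≡ b s))

  movesE : ∀ {S σ} → S ℕ.< total n → AtSet S σ → SoundExits σ → SoundWalks σ →
           Exec moves σ (Level 3) (λ τ → SoundWalks τ × Mono finᵃ distᵃ σ τ × (∀ s b t → MovesFound S σ s b t τ))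
  movesE {S} {σ} S< A soundE sound =
    forallE {m = n} (1≤Level 2) 1≤N n≤N (AtSet.size≡ A) refl refl refl
      SoundWalks (Mono finᵃ distᵃ) (λ s τ → ∀ b t → MovesFound S σ s b t τ)
      (λ _ _ p → p) (λ _ _ _ _ p → p) mono-trans
      (λ s τ υ mono found b t b~s w below → mono _ _ (found b t b~s w below)) sound
      λ s τ₁ ag₁ i₃≡ _ sound₁ → let
          A₁ = keepAtSet ag₁ refl refl refl A
          F₁ = keepFrozen {finExitᵃ} {distExitᵃ} {σ = σ} ag₁ refl refl ((λ _ → refl) , (λ _ → refl))
        in forallE {m = n} (1≤Level 1) 1≤N n≤N (AtSet.size≡ A₁) refl refl refl
          SoundWalks (Mono finᵃ distᵃ) (λ b τ → ∀ t → MovesFound S σ s b t τ)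
          (λ _ _ p → p) (λ _ _ _ _ p → p) mono-trans
          (λ b τ υ mono found t b~s w below → mono _ _ (found t b~s w below)) sound₁
          λ b τ₂ ag₂ i₄≡ _ sound₂ → let
              A₂ = keepAtSet ag₂ refl refl refl A₁
              F₂ = keepFrozen {finExitᵃ} {distExitᵃ} {σ = σ} ag₂ refl refl F₁
              i₃₂ = trans (Agree.nat ag₂ i₃ᵃ refl 0) i₃≡
              cb = trans (cong (natMem τ₂ compᵃ) i₄≡) (AtSet.comp≡ A₂ b)
              cs = trans (cong (natMem τ₂ compᵃ) i₃₂) (AtSet.comp≡ A₂ s)
            in ifE (1≤Level 1)
            (λ eq → let b~s = toℕ-injective (trans (sym cb) (trans (sameᵇ-true⁻ eq) cs)) in
              forallE {m = n} (1≤Level 0) 1≤N n≤N (AtSet.size≡ A₂) refl refl refl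
                SoundWalks (Mono finᵃ distᵃ) (λ t τ → MovesFound S σ s b t τ)
                (λ _ _ p → p) (λ _ _ _ _ p → p) mono-trans
                (λ t τ υ mono found b~s w below → mono _ _ (found b~s w below)) sound₂
                λ t τ₃ ag₃ i₅≡ _ sound₃ → moveE {S} {σ} s b t S< (keepAtSet ag₃ refl refl refl A₂)
                  (keepFrozen {finExitᵃ} {distExitᵃ} {σ = σ} ag₃ refl refl F₂) soundE sound₃ b~s
                  (trans (Agree.nat ag₃ i₃ᵃ refl 0) i₃₂) (trans (Agree.nat ag₃ i₄ᵃ refl 0) i₄≡) i₅≡)
            (λ eq → skipE (1≤Level 1) (sound₂ , (λ _ _ p → p) , λ t b~s →
              ⊥-elim (sameᵇ-false⁻ eq (trans cb (trans (cong toℕ b~s) (sym cs))))))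

  -- The Bellman-Ford invariant: after `j` rounds all routes that meet at most `j` trees have been
  -- taken into account, for every set.
  Reaches : ℕ → State → Set
  Reaches j τ = ∀ S s t w → S ℕ.< total n → Route j S s t w → Below finᵃ distᵃ τ (address S s t) w

  below-frozen : ∀ f r σ τ → Frozen f r σ τ → Mono f r σ τ
  below-frozen f r σ τ (f≡ , r≡) a w (fin , le) = subst (1 ℕ.≤_) (sym (f≡ a)) fin , ≤-trans (≤-reflexive (≡⇒≈ (r≡ a))) le

  record Staged (S : ℕ) (σ τ : State) : Set where
    field
      base≡      : natMem τ baseᵃ 0 ≡ suc S ℕ.* sq
      soundWalks : SoundWalks τ
      soundExits : SoundExits τ
      mono       : Mono finᵃ distᵃ σ τ
      reached    : ∀ j → Reaches j σ → ∀ s t w → Route (suc j) S s t w → Below finᵃ distᵃ τ (address S s t) w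

  stageE : ∀ {S σ} → S ℕ.< total n → AtSet S σ → natMem σ i₂ᵃ 0 ≡ S → SoundWalks σ → SoundExits σ →
           Exec stage σ (Level 3) (Staged S σ)
  stageE {S} {σ} S< A i₂≡ sound soundE =
    seqE (weakenE (ℕ.≤-trans (Level≤ 1) (Level≤ 2)) (decodeE A i₂≡)) λ τ₁ ag₁ decoded → let
        A₁ = keepAtSet ag₁ refl refl refl A
        walks₁ = keepFrozen {finᵃ} {distᵃ} {σ = σ} ag₁ refl refl ((λ _ → refl) , (λ _ → refl))
        exits₁ = keepFrozen {finExitᵃ} {distExitᵃ} {σ = σ} ag₁ refl refl ((λ _ → refl) , (λ _ → refl))
        sound₁ = sound-frozen GoodWalk {finᵃ} {distᵃ} {σ} {τ₁} walks₁ sound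
        soundE₁ = sound-frozen GoodExit {finExitᵃ} {distExitᵃ} {σ} {τ₁} exits₁ soundE
      in seqE (exitsE S< A₁ decoded sound₁ soundE₁) λ τ₂ ag₂ (soundE₂ , _ , exitsFound) → let
        A₂ = keepAtSet ag₂ refl refl refl A₁
        walks₂ = keepFrozen {finᵃ} {distᵃ} {σ = σ} ag₂ refl refl walks₁
        sound₂ = sound-frozen GoodWalk {finᵃ} {distᵃ} {σ} {τ₂} walks₂ sound
      in seqE (movesE S< A₂ soundE₂ sound₂) λ τ₃ ag₃ (sound₃ , mono₃ , movesFound) → let
        A₃ = keepAtSet ag₃ refl refl refl A₂
        exits₃ = keepFrozen {finExitᵃ} {distExitᵃ} {σ = τ₂} ag₃ refl refl ((λ _ → refl) , (λ _ → refl))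
      in setℕE (1≤Level 3) record
        { base≡ = trans (cong₂ ℕ._+_ (AtSet.base≡ A₃) (AtSet.square≡ A₃)) (ℕ.+-comm (S ℕ.* sq) sq)
        ; soundWalks = sound₃
        ; soundExits = sound-frozen GoodExit {finExitᵃ} {distExitᵃ} {τ₂} {τ₃} exits₃ soundE₂
        ; mono = λ a w b → mono₃ a w (below-frozen finᵃ distᵃ σ τ₂ walks₂ a w b)
        ; reached = λ j reaches → λ
            { s t _ (move b~s (stop free)) → movesFound s t t b~s 0# (proj₁ (exitsFound t free))
            -- The continuation is a route for `S` with the bit added, which is `S` itself if the
            -- tree is a single vertex. `reaches` covers both cases, because it speaks of the
            -- previous round and of all sets.
            ; s t _ (move {b = b} b~s (leave {y = y} {w = w} free a r)) →
                movesFound s b t b~s (c a + w) (proj₂ (exitsFound b free) y t a w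
                  (below-frozen finᵃ distᵃ σ τ₁ walks₁ _ w (reaches _ y t w (add-< S< free) r))) }
        }

  -- Rounds times sets times three nested loops, the latter for `exits` as well as for `moves`.
  Budget : ℕ
  Budget = N ℕ.* (total n ℕ.* Level 3)

  1≤Budget : 1 ℕ.≤ Budget
  1≤Budget = ℕ.*-mono-≤ 1≤N (1≤setLoop 3)

  -- Within a round the tables of different sets are overwritten at different times. Since bounds
  -- once reached persist, those of the previous round remain available throughout.
  roundsE : ∀ {σ} → Ready σ → (∀ S x z → S ℕ.< total n → Empty S x z σ) →
            Exec rounds σ Budget (λ τ → SoundWalks τ × Reaches n τ)
  roundsE {σ} R empty = mapE
    (forE {m = n} (1≤setLoop 3) 1≤N n≤N (Ready.size≡ R) refl refl refl
      (λ j τ → SoundWalks τ × SoundExits τ × Reaches j τ)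
      ( (λ S x z S< fin → ⊥-elim (positive (subst (1 ℕ.≤_) (proj₁ (empty S x z S<)) fin)))
      , (λ S x z S< fin → ⊥-elim (positive (subst (1 ℕ.≤_) (proj₂ (empty S x z S<)) fin)))
      , λ S s t w S< ())
      λ j τ₁ ag₁ _ (sound₁ , soundE₁ , reaches₁) → let
          R₁ = keepReady ag₁ refl refl R
          A₁ : AtSet 0 (writeℕ baseᵃ 0 0 τ₁)
          A₁ = record { ready = keepReady (agree-run (⇓setℕ {baseᵃ} {lit 0} {lit 0})) refl refl R₁ ; base≡ = refl }
        in setℕ⨾ (1≤setLoop 3) (mapE
          (forE {m = total n} (1≤Level 3) (total-positive n) ℕ.≤-refl (AtSet.sets≡ A₁) refl refl refl
            (λ k τ → natMem τ baseᵃ 0 ≡ k ℕ.* sq × SoundWalks τ × SoundExits τ × Reaches (toℕ j) τ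
              × (∀ S s t w → S ℕ.< k → Route (suc (toℕ j)) S s t w → Below finᵃ distᵃ τ (address S s t) w))
            (refl , sound₁ , soundE₁ , reaches₁ , λ S s t w ())
            λ S τ₂ ag₂ i₂≡ (base₂ , sound₂ , soundE₂ , reaches₂ , done₂) → mapE
              (stageE (toℕ<n S) (record { ready = keepReady ag₂ refl refl (AtSet.ready A₁) ; base≡ = base₂ }) i₂≡ sound₂ soundE₂)
              λ τ₃ _ staged → let open Staged staged in
                base≡ , soundWalks , soundExits
                , (λ S′ s t w S′< r → mono _ _ (reaches₂ S′ s t w S′< r))
                , λ S′ s t w S′≤S r → case (ℕ.m≤n⇒m<n∨m≡n (ℕ.≤-pred S′≤S))
                    (λ S′<S → mono _ _ (done₂ S′ s t w S′<S r))
                    (λ { refl → reached (toℕ j) reaches₂ s t w r }))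
          λ τ₂ _ (_ , sound₂ , soundE₂ , _ , done₂) → sound₂ , soundE₂ , done₂))
    λ τ _ (sound , _ , reaches) → sound , reaches
    where
    positive : ¬ 1 ℕ.≤ 0
    positive ()
    case : ∀ {A B C : Set} → A ⊎ B → (A → C) → (B → C) → C
    case (inj₁ a) f g = f a
    case (inj₂ b) f g = g b

-- Verification: the final check

module Checking (ℝ : RealNumbers) {n : ℕ} (D : Digraph n) (c : Weighted.WeightFunction ℝ D) where
  open RealNumbers ℝ
  open LinearArithmetic ℝ
  open Digraph D
  open Weighted ℝ D
  open Machine ℝ
  open APSP ℝ D c
  open ProgramLogic ℝ
  open Common ℝ D c

  Passes : State → Fin n → Fin n → Set
  Passes σ x s = (a : Arc x s) → ¬ NegativeEdge c x s → 1 ℕ.≤ natMem σ finᵃ (entry s x) →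
                 0# ≤ realMem σ distᵃ (entry s x) + c a

  record Violation (σ : State) : Set where
    field
      {x s} : Fin n
      arc′  : Arc x s
      plain : ¬ NegativeEdge c x s
      found : 1 ℕ.≤ natMem σ finᵃ (entry s x)
      light : ¬ 0# ≤ realMem σ distᵃ (entry s x) + c arc′

  Undecided : State → State → Set
  Undecided σ τ = natMem τ verdictᵃ 0 ≡ 1 ⊎ (natMem τ verdictᵃ 0 ≡ 0 × Violation σ)

  Checked : State → Fin n → Fin n → State → Set
  Checked σ x s τ = natMem τ verdictᵃ 0 ≡ 0 ⊎ Passes σ x s

  checkBodyE : ∀ {σ τ} x s → Basic τ → (∀ i → natMem τ finᵃ i ≡ natMem σ finᵃ i) → (∀ i → realMem τ distᵃ i ≡ realMem σ distᵃ i) →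
               natMem τ i₁ᵃ 0 ≡ toℕ x → natMem τ i₂ᵃ 0 ≡ toℕ s → Undecided σ τ →
               Exec checkBody τ 1 (λ υ → Undecided σ υ × (natMem τ verdictᵃ 0 ≡ 0 → natMem υ verdictᵃ 0 ≡ 0) × Checked σ x s υ)
  checkBodyE {σ} {τ} x s B fin≡ dist≡ i₁≡ i₂≡ und = ifE ℕ.≤-refl
    (λ eq → let p , q = ∧-true eq ; arc-eq , neg-eq = ∧-true p ; fin-eq , light-eq = ∧-true q
                a = ≡⇒T (trans (sym (arcᵇ≡ {i₁} {i₂} i₁≡ i₂≡)) arc-eq) in
      setℕE ℕ.≤-refl (inj₂ (refl , record
        { arc′ = a
        ; plain = negᵇ-false {i₁} {i₂} i₁≡ i₂≡ (not-true neg-eq)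
        ; found = subst (1 ℕ.≤_) fin-at (≤ᵇ-true⁻ fin-eq)
        ; light = λ 0≤ → ≤?-false (not-true light-eq) (≤-trans 0≤ (≤-reflexive (≈-sym (sum≈ a))))
        }) , (λ _ → refl) , inj₁ refl))
    (λ eq → skipE ℕ.≤-refl (und , (λ z → z) , inj₂ λ a plain fin → ≤-trans
      (≤?-true (not-false (∧-false (∧-false eq (cong₂ _∧_ (trans (arcᵇ≡ {i₁} {i₂} i₁≡ i₂≡) (T⇒≡ a))
          (cong not (¬T⇒≡ λ t → plain (negᵇ-true {i₁} {i₂} i₁≡ i₂≡ (T⇒≡ t))))))
        (≤ᵇ-true (subst (1 ℕ.≤_) (sym fin-at) fin)))))
      (≤-reflexive (sum≈ a))))
    where
    open Basic B
    at-eq : evalℕ (at i₂ i₁) τ ≡ entry s x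
    at-eq = at≡ {i₂} {i₁} i₂≡ i₁≡
    fin-at : natMem τ finᵃ (evalℕ (at i₂ i₁) τ) ≡ natMem σ finᵃ (entry s x)
    fin-at = trans (cong (natMem τ finᵃ) at-eq) (fin≡ _)
    sum≈ : (a : Arc x s) → evalℝ (getℝ distᵃ (at i₂ i₁) ⊕ʳ getℝ weightᵃ (at i₁ i₂)) τ ≈ realMem σ distᵃ (entry s x) + c a
    sum≈ a = +-cong (≡⇒≈ (trans (cong (realMem τ distᵃ) at-eq) (dist≡ _)))
                    (≈-trans (≡⇒≈ (cong (realMem τ weightᵃ) (at≡ {i₁} {i₂} i₁≡ i₂≡))) (weights≈ a))

  checkE : ∀ {σ} → Basic σ → Exec check σ (Level 2) (λ τ →
             (natMem τ verdictᵃ 0 ≡ 1 × (∀ x s → Passes σ x s)) ⊎ (natMem τ verdictᵃ 0 ≡ 0 × Violation σ))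
  checkE {σ} B = setℕ⨾ (1≤Level 2) (mapE
    (forallE {m = n} (1≤Level 1) 1≤N n≤N (Basic.size≡ B) refl refl refl
      (Undecided σ) _⇝_ (λ x τ → ∀ s → Checked σ x s τ)
      (λ _ _ u → u) (λ _ _ z → z) (λ _ _ _ p q z → q (p z)) (λ x τ υ p ch s → kept x s τ υ p (ch s)) (inj₁ refl)
      λ x τ₁ ag₁ i₁≡ _ und₁ → let B₁ = keepBasic ag₁ refl refl refl refl B₀ in
        forallE {m = n} (1≤Level 0) 1≤N n≤N (Basic.size≡ B₁) refl refl refl
          (Undecided σ) _⇝_ (λ s τ → Checked σ x s τ)
          (λ _ _ u → u) (λ _ _ z → z) (λ _ _ _ p q z → q (p z)) (λ s τ υ p ch → kept x s τ υ p ch) und₁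
          λ s τ₂ ag₂ i₂≡ _ und₂ → checkBodyE {σ} {τ₂} x s (keepBasic ag₂ refl refl refl refl B₁)
            (λ i → trans (Agree.nat ag₂ finᵃ refl i) (Agree.nat ag₁ finᵃ refl i))
            (λ i → trans (Agree.real ag₂ distᵃ refl i) (Agree.real ag₁ distᵃ refl i))
            (trans (Agree.nat ag₂ i₁ᵃ refl 0) i₁≡) i₂≡ und₂)
    λ τ _ (und , _ , checked) → conclude und checked)
    where
    B₀ : Basic (writeℕ verdictᵃ 0 1 σ)
    B₀ = record { Basic B }
    _⇝_ : State → State → Set
    τ ⇝ υ = natMem τ verdictᵃ 0 ≡ 0 → natMem υ verdictᵃ 0 ≡ 0
    kept : ∀ x s τ υ → τ ⇝ υ → Checked σ x s τ → Checked σ x s υ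
    kept x s τ υ p (inj₁ z)    = inj₁ (p z)
    kept x s τ υ p (inj₂ pass) = inj₂ pass
    conclude : ∀ {v} → v ≡ 1 ⊎ (v ≡ 0 × Violation σ) → (∀ x s → v ≡ 0 ⊎ Passes σ x s) →
               (v ≡ 1 × (∀ x s → Passes σ x s)) ⊎ (v ≡ 0 × Violation σ)
    conclude (inj₂ violated) _       = inj₂ violated
    conclude (inj₁ refl)     checked = inj₁ (refl , λ x s → passes (checked x s))
      where
      passes : ∀ {P : Set} → 1 ≡ 0 ⊎ P → P
      passes (inj₂ p) = p

-- Correctness of the verdict and of the distances

module Solving
  (ℝ : RealNumbers) {n : ℕ} (D : Digraph n) (c : Weighted.WeightFunction ℝ D)
  {σ : Machine.State ℝ} (basic : Common.Basic ℝ D c σ) (square≡ : Machine.State.natMem σ squareᵃ 0 ≡ n ℕ.* n)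
  (G : GrowingForest.GrownAt ℝ D c σ (λ _ _ → Fin n)) (acyclic : Machine.State.natMem σ cyclicᵃ 0 ≡ 0)
  where
  open RealNumbers ℝ
  open LinearArithmetic ℝ
  open Digraph D
  open Weighted ℝ D
  open Machine ℝ
  open APSP ℝ D c
  open ProgramLogic ℝ
  open Weights ℝ D c
  open Common ℝ D c
  open Growing ℝ D c
  open GrowingForest ℝ D c
  open Grown G
  open Checking ℝ D c

  selected : ℕ → Bool
  selected r = 1 ≤ᵇ natMem σ treeᵃ r

  allNegative : ∀ {u v} → NegativeEdge c u v → (u , v) ∈ E
  allNegative {u} {v} ne with ℕ.<-cmp (toℕ u) (toℕ v)
  ... | tri< u<v _ _ = examined acyclic u<v u ne
  ... | tri≈ _ u≡v _ with refl ← toℕ-injective u≡v = ⊥-elim (noLoops (proj₁ ne))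
  ... | tri> _ _ v<u = Forest.symmetric forest (examined acyclic v<u u (symNeg ne))

  nontrivial : ∀ {u v} → NegativeEdge c u v → selected (toℕ (comp u)) ≡ true
  nontrivial ne = ≤ᵇ-true (marked (allNegative ne))

  open Binary selected
  open Tables ℝ D c comp (eOf σ) selected
  open Routes ℝ D c comp (eOf σ) (encoding n)
  open Relaxing ℝ
  open Dynamic ℝ D c forest selected nontrivial
  open Completeness ℝ D c forest allNegative (encoding n) using (nearlyConservative; routeBelow)
  open Soundness ℝ D c forest nontrivial (encoding n) using (soundPath; soundCheck)

  -- A successful check first yields near conservativity through completeness, and only then does
  -- soundness show that the entries are attained by simple paths. A violation contradicts
  -- `soundCheck`.
  solved : ∀ {σ₁ τ} → SoundWalks σ₁ → Reaches n σ₁ → Agree check σ₁ τ →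
           (natMem τ verdictᵃ 0 ≡ 1 × (∀ x s → Passes σ₁ x s)) ⊎ (natMem τ verdictᵃ 0 ≡ 0 × Violation σ₁) → HoldsSolution τ
  solved {σ₁} {τ} sound reaches ag (inj₂ (verdict≡ , violation)) = inj₁
    ((λ nc → light (soundCheck nc (sound 0 _ _ (total-positive n) found) arc′ plain)) , verdict≡)
    where open Violation violation
  solved {σ₁} {τ} sound reaches ag (inj₁ (verdict≡ , passes)) = inj₂ (nc , verdict≡ , λ s t _ → isDistance s t)
    where
    checked : ∀ {x s} (a : Arc x s) → ¬ NegativeEdge c x s → ∀ {w} → Route n 0 s x w → 0# ≤ w + c a
    checked {x} {s} a plain {w} r with reaches 0 s x w (total-positive n) r
    ... | fin , d≤w = linear (realMem σ₁ distᵃ (entry s x) ∷ w ∷ c a ∷ [])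
      ((𝟘 ≼ #0 ⊞ #2) ∷ (#0 ≼ #1) ∷ []) (𝟘 ≼ #1 ⊞ #2) refl (passes x s a plain fin , d≤w , tt)
    nc : NearlyConservative c
    nc = nearlyConservative checked
    below : ∀ {s t} (p : Path s t) → Below finᵃ distᵃ τ (entry s t) (pathWeight c p)
    below {s} {t} p with routeBelow checked (Path.walk p) (Path.simple p)
    ... | w , r , w≤p with reaches 0 s t w (total-positive n) r
    ...   | fin , d≤w = subst (1 ℕ.≤_) (sym (Agree.nat ag finᵃ refl _)) fin
                      , ≤-trans (≤-reflexive (≡⇒≈ (Agree.real ag distᵃ refl _))) (≤-trans d≤w w≤p)
    isDistance : ∀ s t → IsDistance c s t (distance τ s t)
    isDistance s t with natMem τ finᵃ (entry s t) in fin
    ... | zero  = λ p → positive (subst (1 ℕ.≤_) fin (proj₁ (below p)))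
      where
      positive : ¬ 1 ℕ.≤ 0
      positive ()
    ... | suc k with soundPath nc (sound 0 s t (total-positive n) (subst (1 ℕ.≤_) (trans (sym fin) (Agree.nat ag finᵃ refl _)) (s≤s z≤n)))
    ...   | p , p≤d = (p , ≤-antisym (≤-trans p≤d (≤-reflexive (≡⇒≈ (sym (Agree.real ag distᵃ refl _))))) (proj₂ (below p)))
                    , λ q → proj₂ (below q)

  private
    Level≤Budget : ∀ d → Level d ℕ.≤ Level 3 → Level d ℕ.≤ Budget
    Level≤Budget d le = ℕ.≤-trans le (ℕ.≤-trans (ℕ.m≤n*m (Level 3) (total n) {{ℕ.>-nonZero (total-positive n)}})
      (ℕ.m≤m+n _ _))

  -- Growing the forest takes time `n ^ 4` however few trees there are; it fits because at least the
  -- empty set is counted.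
  Level4≤Budget : Level 4 ℕ.≤ Budget
  Level4≤Budget = ℕ.*-monoʳ-≤ N (ℕ.m≤n*m (Level 3) (total n) {{ℕ.>-nonZero (total-positive n)}})

  solveE : Exec solve σ Budget HoldsSolution
  solveE =
    seqE (weakenE (Level≤Budget 1 (ℕ.≤-trans (Level≤ 1) (Level≤ 2)))
      (bitsE basic labels≡ (λ _ _ → refl) square≡ (λ _ → refl))) λ τ₁ ag₁ R₁ →
    seqE (weakenE (ℕ.≤-trans (ℕ.*-monoʳ-≤ (total n) (Level≤ 2)) (ℕ.m≤m+n _ _)) (clearE R₁)) λ τ₂ ag₂ empty →
    let R₂ = keepReady ag₂ refl refl R₁ in
    seqE (roundsE R₂ empty) λ τ₃ ag₃ (sound , reaches) →
    mapE (weakenE (Level≤Budget 2 (Level≤ 2)) (checkE (Ready.basic (keepReady ag₃ refl refl R₂))))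
      λ τ₄ ag₄ verdict≡ → solved sound reaches ag₄ verdict≡

  total≤ : ∀ {k} → HasNegativeTrees c k → total n ℕ.≤ 2 ℕ.^ k
  total≤ = Counting.total≤ ℝ D c comp (λ ne → Forest.sameTree forest (allNegative ne)) selected
    (λ r eq → witness r (≤ᵇ-true⁻ eq))

-- The program solves the problem within the stated time

open import Data.Nat using (_*_; _^_; _≤_)

theorem1 : Σ Program λ P → Σ ℕ λ C →
    (ℝ : RealNumbers) →
    let open Machine ℝ in
    (n : ℕ) (D : Digraph n) (c : Weighted.WeightFunction ℝ D) →
    let open Weighted ℝ D in
    let open APSP ℝ D c in
    (σ : State) → HoldsInput σ →
    ∃ λ (t : ℕ) → ∃ λ (τ : State) →
    (P , σ ⇓[ t ] τ)
    × HoldsSolution τ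
    × (∀ k₀ → HasNegativeTrees c k₀ → 1 ≤ n → t ≤ C * ((2 ^ k₀) * (n ^ 4)))
theorem1 = apsp , cost apsp * 16 , solution
  where
  double : ∀ {n} → 1 ≤ n → suc n ≤ n ℕ.+ n
  double {n} 1≤n = ℕ.+-monoˡ-≤ n 1≤n

  expand : ∀ n k → (n ℕ.+ n) * (k * ((n ℕ.+ n) * ((n ℕ.+ n) * ((n ℕ.+ n) * 1)))) ≡ 16 * (k * (n * (n * (n * (n * 1)))))
  expand = solve-∀

  -- The time bounds are in terms of `suc n`, which is at most `2 * n` for `1 ≤ n`; four such
  -- factors account for the 16.
  budget : ∀ n k T → T ≤ k → 1 ≤ n → suc n * (T * (suc n * (suc n * (suc n * 1)))) ≤ 16 * (k * n ^ 4)
  budget n k T T≤k 1≤n = ℕ.≤-trans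
    (ℕ.*-mono-≤ d (ℕ.*-mono-≤ T≤k (ℕ.*-mono-≤ d (ℕ.*-mono-≤ d (ℕ.*-monoˡ-≤ 1 d)))))
    (ℕ.≤-reflexive (expand n k))
    where d = double 1≤n

  within : ∀ Y {t X} → t ≤ cost apsp * X → X ≤ 16 * Y → t ≤ cost apsp * 16 * Y
  within Y {t} {X} t≤ X≤ = ℕ.≤-trans t≤ (ℕ.≤-trans (ℕ.*-monoʳ-≤ (cost apsp) X≤)
    (ℕ.≤-reflexive (sym (ℕ.*-assoc (cost apsp) 16 Y))))

  module _ (ℝ : RealNumbers) (n : ℕ) (D : Digraph n) (c : Weighted.WeightFunction ℝ D) (σ : Machine.State ℝ) where
    open Machine ℝ
    open Weighted ℝ D
    open APSP ℝ D c
    open ProgramLogic ℝ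
    open Common ℝ D c
    open GrowingForest ℝ D c

    Answer : Set
    Answer = ∃ λ (t : ℕ) → ∃ λ (τ : State) → (apsp , σ ⇓[ t ] τ) × HoldsSolution τ
           × (∀ k₀ → HasNegativeTrees c k₀ → 1 ≤ n → t ≤ cost apsp * 16 * ((2 ^ k₀) * (n ^ 4)))

    module _ {t₁ τ₁ t₂ τ₂} (run₁ : init , σ ⇓[ t₁ ] τ₁) (time₁ : t₁ ≤ cost init * Level 1) (initial : Initial τ₁)
             (run₂ : grow , τ₁ ⇓[ t₂ ] τ₂) (time₂ : t₂ ≤ cost grow * Level 4) (G : GrownAt τ₂ (λ _ _ → Fin n)) where
      ag₂ = agree-run run₂
      basic₂ = keepBasic ag₂ refl refl refl refl (Initial.basic initial)
      square₂ = trans (Agree.nat ag₂ squareᵃ refl 0) (Initial.square≡ initial)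

      Level1≤4 : Level 1 ≤ Level 4
      Level1≤4 = ℕ.≤-trans (Level≤ 1) (ℕ.≤-trans (Level≤ 2) (Level≤ 3))

      assemble : ∀ {X} → Level 4 ≤ X → 1 ≤ X →
                 Exec (ifᵖ (lit 1 ≤ⁿ scalar cyclicᵃ) (verdictᵃ := lit 0) solve) τ₂ X HoldsSolution → Exec apsp σ X HoldsSolution
      assemble {X} le 1≤X rest =
        seqE {Q = _≡ τ₁} (weakenE {X = Level 1} (ℕ.≤-trans Level1≤4 le) (exec run₁ time₁ refl)) λ { _ _ refl →
        seqE {Q = _≡ τ₂} (weakenE {X = Level 4} le (exec run₂ time₂ refl)) λ { _ _ refl → rest } }

      answer : Dec (1 ≤ natMem τ₂ cyclicᵃ 0) → Answer
      -- When a cycle of negative edges has been found no tables are built; the time is that of a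
      -- single set, and `1 ≤ 2 ^ k₀`.
      answer (yes 1≤cyc) = _ , _ , run , post , λ k₀ _ 1≤n → within (2 ^ k₀ * n ^ 4) time (ℕ.≤-trans
          (ℕ.≤-reflexive (cong (N *_) (sym (ℕ.*-identityˡ (Level 3))))) (budget n (2 ^ k₀) 1 (ℕ.m^n>0 2 k₀) 1≤n))
        where
        open Exec (assemble {Level 4} ℕ.≤-refl (1≤Level 4) (ifE (1≤Level 4)
          (λ _ → setℕE (1≤Level 4) (inj₁ ((λ nc → ℕ.<⇒≢ 1≤cyc (sym (Grown.noCycle G nc))) , refl)))
          (λ eq → ⊥-elim (ℕ.<⇒≱ (≤ᵇ-false⁻ eq) 1≤cyc))))
      answer (no ¬cyc) = _ , _ , run , post , λ k₀ trees 1≤n → within (2 ^ k₀ * n ^ 4) time (budget n (2 ^ k₀) _ (total≤ trees) 1≤n)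
        where
        cyc : natMem τ₂ cyclicᵃ 0 ≡ 0
        cyc = ℕ.n<1⇒n≡0 (ℕ.≰⇒> ¬cyc)
        open Solving ℝ D c basic₂ square₂ G cyc
        B = Dynamic.Budget ℝ D c (Grown.forest G) selected nontrivial
        1≤B = Dynamic.1≤Budget ℝ D c (Grown.forest G) selected nontrivial
        open Exec (assemble {B} Level4≤Budget 1≤B (ifE 1≤B
          (λ eq → ⊥-elim (ℕ.<⇒≢ (≤ᵇ-true⁻ eq) (sym cyc)))
          (λ _ → solveE)))

  solution : (ℝ : RealNumbers) (n : ℕ) (D : Digraph n) (c : Weighted.WeightFunction ℝ D) (σ : Machine.State ℝ) →
             APSP.HoldsInput ℝ D c σ → Answer ℝ n D c σ
  solution ℝ n D c σ input =
    let open ProgramLogic ℝ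
        exec run₁ time₁ post₁ = Common.initE ℝ D c input
        exec run₂ time₂ post₂ = GrowingForest.growE ℝ D c post₁
    in answer ℝ n D c σ run₁ time₁ post₁ run₂ time₂ post₂ (_ ℕ.≤? _)
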